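{- For every $n>0$, the $H$-triangle $H_n(x,y)$ associated with the Hochschild lattice $\mathrm{Hoch}(n)$ satisfies $$H_n(x,y)=\sum_{A}x^{|A|}y^{|A\cap\mathrm{Atom}(n)|},$$ where the sum runs over all antichains $A$ (including the empty one) of the poset $\mathbf{J}_n$.
   Context: Hochschild lattice. For $n\geq 1$, a triword of length $n$ is a tuple $u=(u_1,\ldots,u_n)$ such that (T1) $u_i\in\{0,1,2\}$ for all $i$; (T2) $u_1\neq 2$; (T3) if $u_i=0$, then $u_j\neq 1$ for all $j>i$. Let $\mathrm{Tri}(n)$ be the set of all triwords of length $n$. The Hochschild lattice is $\mathrm{Hoch}(n)=(\mathrm{Tri}(n),\leq)$ where $\leq$ is the componentwise order. It is known to be a semidistributive lattice: the join is the componentwise maximum, and the meet is obtained by taking the componentwise minimum and then replacing by $0$ every entry $1$ that has an entry $0$ somewhere to its left. Its join-irreducible elements are the triwords $\mathfrak{a}^{(i)}=(1,\ldots,1,0,\ldots,0)$ ($i$ ones followed by zeros) for $1\leq i\leq n$ and $\mathfrak{b}^{(i)}$ (a $2$ in position $i$, zeros elsewhere) for $2\leq i\leq n$. Its set of atoms is $\mathrm{Atom}(n)=\{\mathfrak{a}^{(1)},\mathfrak{b}^{(2)},\ldots,\mathfrak{b}^{(n)}\}$. The poset $\mathbf{J}_n$. $\mathbf{J}_n$ is the poset on the set of join-irreducible elements of $\mathrm{Hoch}(n)$ obtained from the componentwise order on this set by adding the relations $\mathfrak{b}^{(2)}<\mathfrak{a}^{(i)}$ for all $i>1$. Core label order.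 Let $L$ be a finite semidistributive lattice. For a cover relation $a\lessdot b$ put $\lambda(a,b)=\min\{c\in L\mid a\vee c=b\}$; this minimum exists and is join irreducible. The nucleus of $a\in L$ is $a_\downarrow=a\wedge\bigwedge_{b\lessdot a}b$. The core label set of $a$ is $\Psi(a)=\{\lambda(b,b')\mid a_\downarrow\leq b\lessdot b'\leq a\}$. The map $a\mapsto\Psi(a)$ is injective. The core label order $\mathrm{CLO}(L)$ is the poset $(L,\sqsubseteq)$ where $a\sqsubseteq b$ if and only if $\Psi(a)\subseteq\Psi(b)$. $H$-triangle. The poset $\mathrm{CLO}(\mathrm{Hoch}(n))$ is graded with least element $(0,\ldots,0)$; let $\mathrm{rk}$ be its rank function (so $\mathrm{rk}(0,\ldots,0)=0$) and $\mu_n$ its Möbius function (with $\mu_n(u,v)=0$ if $u\not\sqsubseteq v$). Define $$M_n(x,y)=\sum_{u,v\in\mathrm{Tri}(n)}\mu_n(u,v)\,x^{\mathrm{rk}(u)}y^{\mathrm{rk}(v)},\qquad H_n(x,y)=\bigl(x(y-1)+1\bigr)^n M_n\left(\frac{y}{y-1},\frac{x(y-1)}{x(y-1)+1}\right).$$ -}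

module Defs where

open import Algebra.Bundles using (CommutativeRing)
import Algebra.Construct.NaturalChoice.Max as Max
import Algebra.Construct.NaturalChoice.Min as Min
import Algebra.Definitions as AlgebraDefinitions
import Algebra.Properties.Monoid.Mult as Mult
import Algebra.Properties.Semiring.Exp as Exp
open import Data.Bool.Base using (if_then_else_)
open import Data.Empty using (⊥-elim-irr)
open import Data.Fin.Base as Fin using (Fin; toℕ)
open import Data.Fin.Patterns using (0F; 1F; 2F)
import Data.Fin.Properties as Fin
open import Data.Integer.Base as ℤ using (ℤ; 0ℤ; 1ℤ; +_; -[1+_])
open import Data.Irrelevant as Irrelevant using ([_])
open import Data.List.Base
  using (List; []; _∷_; _++_; map; foldr; filter; length; allFin; mapMaybe; cartesianProductWith)
open import Data.List.Membership.Propositional using (_∈_; lose; find)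
open import Data.List.Membership.Propositional.Properties using (∈-allFin; ∈-cartesianProductWith⁺)
open import Data.List.Relation.Unary.All as All using (All; []; _∷_)
open import Data.List.Relation.Unary.AllPairs using ([]; _∷_)
open import Data.List.Relation.Unary.Any as Any using (here; there)
open import Data.List.Relation.Unary.Unique.Propositional using (Unique)
import Data.List.Relation.Unary.Unique.Propositional.Properties as Unique
open import Data.Maybe.Base using (Maybe; just; nothing)
open import Data.Nat.Base as ℕ using (ℕ; zero; suc; z≤n; s≤s; s<s)
open import Data.Nat.Induction using (<-wellFounded)
import Data.Nat.Properties as ℕ
open import Data.Product.Base using (_×_; _,_; ∃-syntax; proj₁; proj₂)
open import Data.Refinement.Base using (Refinement-syntax; _,_; value)
open import Data.Refinement.Properties using (value-injective)
open import Data.Sum.Base using (_⊎_; inj₁; inj₂)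
open import Data.Vec.Base as Vec using (Vec; []; _∷_; lookup; tabulate; zipWith; replicate)
open import Data.Vec.Properties as Vec
  using (lookup-zipWith; lookup∘tabulate; tabulate∘lookup; tabulate-cong; lookup-replicate; ∷-injective)
open import Function.Base using (_∘_; _on_; id)
open import Induction.WellFounded using (Acc; acc; WellFounded; module Subrelation)
open import Level using (Level; 0ℓ)
import Relation.Binary.Construct.On as On
open import Relation.Binary.Core using (Rel)
open import Relation.Binary.Definitions using (Decidable; DecidableEquality; Reflexive; Transitive)
open import Relation.Binary.Lattice.Structures using (IsBoundedLattice)
open import Relation.Binary.PropositionalEquality
  using (_≡_; _≢_; refl; sym; trans; cong; subst; isEquivalence; module ≡-Reasoning)
open import Relation.Nullary using (Dec; yes; no; does; ¬_; ¬?; contradiction; _×-dec_; _⊎-dec_; _→-dec_)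
open import Relation.Nullary.Decidable using (map′)
open import Relation.Unary as Unary using (Pred; _⊆_)

private
  variable
    a p : Level
    A   : Set a
    n   : ℕ

subsets : List A → List (List A)
subsets []       = [] ∷ []
subsets (x ∷ xs) = map (x ∷_) (subsets xs) ++ subsets xs

whenever : {P : Set p} → Dec P → (P → A) → A → A
whenever (yes q) f d = f q
whenever (no _)  f d = d

-- Antisymmetry is not required: when it holds, w ⊏ v is the usual
-- "w ⊑ v and w ≢ v".
module FiniteOrder
  (elements : List A) (complete : ∀ x → x ∈ elements)
  (_≟_ : DecidableEquality A)
  {_⊑_ : Rel A 0ℓ} (_⊑?_ : Decidable _⊑_)
  (⊑-refl : Reflexive _⊑_) (⊑-trans : Transitive _⊑_)
  where

  _⊏_ : Rel A 0ℓ
  u ⊏ v = u ⊑ v × ¬ v ⊑ u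

  _⊏?_ : Decidable _⊏_
  u ⊏? v = u ⊑? v ×-dec ¬? (v ⊑? u)

  private
    below : A → List A → ℕ
    below v = length ∘ filter (_⊑? v)

    below-mono : ∀ {u v} → u ⊑ v → ∀ xs → below u xs ℕ.≤ below v xs
    below-mono {u} {v} u⊑v []       = z≤n
    below-mono {u} {v} u⊑v (x ∷ xs) with x ⊑? u | x ⊑? v
    ... | yes _  | yes _  = s≤s (below-mono u⊑v xs)
    ... | yes xu | no ¬xv = contradiction (⊑-trans xu u⊑v) ¬xv
    ... | no _   | yes _  = ℕ.m≤n⇒m≤1+n (below-mono u⊑v xs)
    ... | no _   | no _   = below-mono u⊑v xs

    below-strict : ∀ {u v} → u ⊏ v → ∀ {xs} → v ∈ xs → below u xs ℕ.< below v xs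
    below-strict {u} {v} (u⊑v , v⋢u) {x ∷ xs} (here refl) with x ⊑? u | x ⊑? x
    ... | yes vu | _      = contradiction vu v⋢u
    ... | no _   | yes _  = s≤s (below-mono u⊑v xs)
    ... | no _   | no ¬vv = contradiction ⊑-refl ¬vv
    below-strict {u} {v} u⊏v@(u⊑v , _) {x ∷ xs} (there v∈) with x ⊑? u | x ⊑? v
    ... | yes _  | yes _  = s<s (below-strict u⊏v v∈)
    ... | yes xu | no ¬xv = contradiction (⊑-trans xu u⊑v) ¬xv
    ... | no _   | yes _  = ℕ.m≤n⇒m≤1+n (below-strict u⊏v v∈)
    ... | no _   | no _   = below-strict u⊏v v∈

  ⊏-wellFounded : WellFounded _⊏_
  ⊏-wellFounded = Subrelation.wellFounded (λ {_} {v} u⊏v → below-strict u⊏v (complete v))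
    (On.wellFounded (λ v → below v elements) <-wellFounded)

  -- The length of a longest chain with top element v.  In a graded poset all
  -- maximal chains below v have this length, which is the rank of v.
  rankAcc : ∀ v → Acc _⊏_ v → ℕ
  rankAcc v (acc rs) =
    foldr ℕ._⊔_ 0 (map (λ w → whenever (w ⊏? v) (λ w⊏v → suc (rankAcc w (rs w⊏v))) 0) elements)

  rank : A → ℕ
  rank v = rankAcc v (⊏-wellFounded v)

  -- For u ⊏ v this is ∑_{u ⊑ w ⊑ v} μ(u,w) = 0 solved for μ(u,v).
  möbiusAcc : ∀ u v → Acc _⊏_ v → ℤ
  möbiusAcc u v (acc rs) =
    if does (u ≟ v) then 1ℤ
    else if does (u ⊑? v) then
      ℤ.- foldr ℤ._+_ 0ℤ
        (map (λ w → whenever (u ⊑? w ×-dec w ⊏? v) (λ (_ , w⊏v) → möbiusAcc u w (rs w⊏v)) 0ℤ) elements)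
    else 0ℤ

  möbius : A → A → ℤ
  möbius u v = möbiusAcc u v (⊏-wellFounded v)

record FiniteLattice : Set₁ where
  infix  4 _≤_ _≤?_
  infixr 6 _∨_
  infixr 7 _∧_
  field
    Carrier          : Set
    _≤_              : Rel Carrier 0ℓ
    _∨_ _∧_          : Carrier → Carrier → Carrier
    ⊤ ⊥              : Carrier
    isBoundedLattice : IsBoundedLattice _≡_ _≤_ _∨_ _∧_ ⊤ ⊥
    _≤?_             : Decidable _≤_
    elements         : List Carrier
    complete         : ∀ x → x ∈ elements
    unique           : Unique elements

  open IsBoundedLattice isBoundedLattice public using (antisym; reflexive)

  infix 4 _≟_ _<_ _<?_ _⋖_ _⋖?_

  _≟_ : DecidableEquality Carrier
  x ≟ y = map′ (λ (x≤y , y≤x) → antisym x≤y y≤x) (λ x≡y → reflexive x≡y , reflexive (sym x≡y))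
    (x ≤? y ×-dec y ≤? x)

  all? : {P : Pred Carrier 0ℓ} → Unary.Decidable P → Dec (∀ x → P x)
  all? P? = map′ (λ ps x → All.lookup ps (complete x)) (λ f → All.universal f elements)
    (All.all? P? elements)

  any? : {P : Pred Carrier 0ℓ} → Unary.Decidable P → Dec (∃[ x ] P x)
  any? P? = map′ (λ ps → let x , _ , px = find ps in x , px) (λ (x , px) → lose (complete x) px)
    (Any.any? P? elements)

  _<_ : Rel Carrier 0ℓ
  x < y = x ≤ y × x ≢ y

  _<?_ : Decidable _<_
  x <? y = x ≤? y ×-dec ¬? (x ≟ y)

  _⋖_ : Rel Carrier 0ℓ
  x ⋖ y = x < y × (∀ z → ¬ (x < z × z < y))

  _⋖?_ : Decidable _⋖_
  x ⋖? y = x <? y ×-dec all? (λ z → ¬? (x <? z ×-dec z <? y))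

  Atom : Pred Carrier 0ℓ
  Atom x = ⊥ ⋖ x

  atom? : Unary.Decidable Atom
  atom? x = ⊥ ⋖? x

  JoinIrreducible : Pred Carrier 0ℓ
  JoinIrreducible j = j ≢ ⊥ × (∀ x y → j ≡ x ∨ y → j ≡ x ⊎ j ≡ y)

  joinIrreducible? : Unary.Decidable JoinIrreducible
  joinIrreducible? j = ¬? (j ≟ ⊥) ×-dec
    all? (λ x → all? (λ y → (j ≟ x ∨ y) →-dec (j ≟ x ⊎-dec j ≟ y)))

module CoreLabelOrder (L : FiniteLattice) where
  open FiniteLattice L

  -- c = λ(x,y), the least element of { c ∣ x ∨ c = y }.  As a relation this makes
  -- sense in any finite lattice; if L is semidistributive and x ⋖ y, then exactly
  -- one such c exists.
  IsLabel : Carrier → Carrier → Pred Carrier 0ℓ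
  IsLabel x y c = x ∨ c ≡ y × (∀ d → x ∨ d ≡ y → c ≤ d)

  isLabel? : ∀ x y → Unary.Decidable (IsLabel x y)
  isLabel? x y c = (x ∨ c ≟ y) ×-dec all? (λ d → (x ∨ d ≟ y) →-dec (c ≤? d))

  nucleus : Carrier → Carrier
  nucleus x = foldr _∧_ x (filter (_⋖? x) elements)

  Ψ : Carrier → Pred Carrier 0ℓ
  Ψ x c = ∃[ y ] ∃[ y′ ] nucleus x ≤ y × y ⋖ y′ × y′ ≤ x × IsLabel y y′ c

  Ψ? : ∀ x → Unary.Decidable (Ψ x)
  Ψ? x c = any? λ y → any? λ y′ →
    (nucleus x ≤? y) ×-dec (y ⋖? y′) ×-dec (y′ ≤? x) ×-dec isLabel? y y′ c

  infix 4 _⊑_ _⊑?_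

  _⊑_ : Rel Carrier 0ℓ
  x ⊑ y = Ψ x ⊆ Ψ y

  _⊑?_ : Decidable _⊑_
  x ⊑? y = map′ (λ f {c} → f c) (λ f c → f {c}) (all? (λ c → Ψ? x c →-dec Ψ? y c))

  -- If L is semidistributive, then Ψ is injective, so that ⊑ is antisymmetric.
  open FiniteOrder elements complete _≟_ {_⊑_} _⊑?_ id (λ f g → g ∘ f) public
    using (rank; möbius)

Word : ℕ → Set
Word n = Vec (Fin 3) n

-- Positions are counted from 0 by Fin n.
IsTriword : Pred (Word n) 0ℓ
IsTriword {n} u =
  (∀ (i : Fin n) → toℕ i ≡ 0 → lookup u i ≢ 2F) ×
  (∀ (i j : Fin n) → i Fin.< j → lookup u i ≡ 0F → lookup u j ≢ 1F)

isTriword? : Unary.Decidable (IsTriword {n})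
isTriword? u =
  Fin.all? (λ i → (toℕ i ℕ.≟ 0) →-dec ¬? (lookup u i Fin.≟ 2F)) ×-dec
  Fin.all? (λ i → Fin.all? (λ j →
    (i Fin.<? j) →-dec (lookup u i Fin.≟ 0F) →-dec ¬? (lookup u j Fin.≟ 1F)))

Tri : ℕ → Set
Tri n = [ u ∈ Word n ∣ IsTriword u ]

infix 4 _≤ʷ_ _≤ʷ?_

_≤ʷ_ : Rel (Word n) 0ℓ
u ≤ʷ v = ∀ i → lookup u i Fin.≤ lookup v i

_≤ʷ?_ : Decidable (_≤ʷ_ {n})
u ≤ʷ? v = Fin.all? (λ i → lookup u i Fin.≤? lookup v i)

module ⊔ = Max (Fin.≤-totalOrder 3)
module ⊓ = Min (Fin.≤-totalOrder 3)

maxʷ minʷ : Word n → Word n → Word n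
maxʷ = zipWith ⊔._⊔_
minʷ = zipWith ⊓._⊓_

BadOne : Word n → Pred (Fin n) 0ℓ
BadOne w i = lookup w i ≡ 1F × ∃[ j ] j Fin.< i × lookup w j ≡ 0F

badOne? : (w : Word n) → Unary.Decidable (BadOne w)
badOne? w i = (lookup w i Fin.≟ 1F) ×-dec
  Fin.any? (λ j → (j Fin.<? i) ×-dec (lookup w j Fin.≟ 0F))

clear : Word n → Word n
clear w = tabulate (λ i → if does (badOne? w i) then 0F else lookup w i)

zeroʷ topʷ : ∀ n → Word n
zeroʷ n       = replicate n 0F
topʷ  zero    = []
topʷ  (suc n) = 1F ∷ replicate n 2F

private
  ≤0 : {k : Fin 3} → Fin._≤_ {3} {3} k 0F → k ≡ 0F
  ≤0 {0F} _ = refl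

  ≤2 : (k : Fin 3) → Fin._≤_ {3} {3} k 2F
  ≤2 k = Fin.toℕ≤pred[n] k

  max-lookup : (u v : Word n) → ∀ i → lookup (maxʷ u v) i ≡ lookup u i ⊔.⊔ lookup v i
  max-lookup u v i = lookup-zipWith ⊔._⊔_ i u v

  min-lookup : (u v : Word n) → ∀ i → lookup (minʷ u v) i ≡ lookup u i ⊓.⊓ lookup v i
  min-lookup u v i = lookup-zipWith ⊓._⊓_ i u v

  max-≤₁ : (u v : Word n) → u ≤ʷ maxʷ u v
  max-≤₁ u v i = subst (lookup u i Fin.≤_) (sym (max-lookup u v i)) (⊔.x≤x⊔y (lookup u i) (lookup v i))

  max-≤₂ : (u v : Word n) → v ≤ʷ maxʷ u v
  max-≤₂ u v i = subst (lookup v i Fin.≤_) (sym (max-lookup u v i)) (⊔.x≤y⊔x (lookup u i) (lookup v i))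

  max-least : (u v w : Word n) → u ≤ʷ w → v ≤ʷ w → maxʷ u v ≤ʷ w
  max-least u v w u≤w v≤w i = subst (Fin._≤ lookup w i) (sym (max-lookup u v i)) (⊔.⊔-lub (u≤w i) (v≤w i))

  min-≤₁ : (u v : Word n) → minʷ u v ≤ʷ u
  min-≤₁ u v i = subst (Fin._≤ lookup u i) (sym (min-lookup u v i)) (⊓.x⊓y≤x (lookup u i) (lookup v i))

  min-≤₂ : (u v : Word n) → minʷ u v ≤ʷ v
  min-≤₂ u v i = subst (Fin._≤ lookup v i) (sym (min-lookup u v i)) (⊓.x⊓y≤y (lookup u i) (lookup v i))

  min-greatest : (u v w : Word n) → w ≤ʷ u → w ≤ʷ v → w ≤ʷ minʷ u v
  min-greatest u v w w≤u w≤v i = subst (lookup w i Fin.≤_) (sym (min-lookup u v i)) (⊓.⊓-glb (w≤u i) (w≤v i))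

  ≤ʷ-refl : {u v : Word n} → u ≡ v → u ≤ʷ v
  ≤ʷ-refl refl i = ℕ.≤-refl

  ≤ʷ-trans : (u v w : Word n) → u ≤ʷ v → v ≤ʷ w → u ≤ʷ w
  ≤ʷ-trans _ _ _ p q i = ℕ.≤-trans (p i) (q i)

  ≤ʷ-antisym : {u v : Word n} → u ≤ʷ v → v ≤ʷ u → u ≡ v
  ≤ʷ-antisym {u = u} {v} p q = begin
    u                     ≡⟨ tabulate∘lookup u ⟨
    tabulate (lookup u)   ≡⟨ tabulate-cong (λ i → Fin.≤-antisym (p i) (q i)) ⟩
    tabulate (lookup v)   ≡⟨ tabulate∘lookup v ⟩
    v                     ∎
    where open ≡-Reasoning

  clear-lookup : (w : Word n) → ∀ i → lookup (clear w) i ≡ (if does (badOne? w i) then 0F else lookup w i)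
  clear-lookup w = lookup∘tabulate _

  clear-≤ : (w : Word n) → clear w ≤ʷ w
  clear-≤ w i = subst (Fin._≤ lookup w i) (sym (clear-lookup w i)) (go (badOne? w i))
    where
    go : (d : Dec (BadOne w i)) → (if does d then 0F else lookup w i) Fin.≤ lookup w i
    go (yes _) = z≤n
    go (no _)  = ℕ.≤-refl

  clear-greatest : (u w : Word n) → .(IsTriword u) → u ≤ʷ w → u ≤ʷ clear w
  clear-greatest u w t u≤w i = subst (lookup u i Fin.≤_) (sym (clear-lookup w i)) (go (badOne? w i))
    where
    digit : (k : Fin 3) → lookup u i ≢ 1F → lookup u i ≡ k → Fin._≤_ {3} {3} k 1F → Fin._≤_ {3} {3} k 0F
    digit 0F _  _  _        = z≤n
    digit 1F ne eq _        = contradiction eq ne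
    digit 2F _  _  (s≤s ())

    go : (d : Dec (BadOne w i)) → lookup u i Fin.≤ (if does d then 0F else lookup w i)
    go (no _)                       = u≤w i
    go (yes (wi≡1 , j , j<i , wj≡0)) =
      digit (lookup u i)
        (λ ui≡1 → ⊥-elim-irr (proj₂ t j i j<i (≤0 (subst (lookup u j Fin.≤_) wj≡0 (u≤w j))) ui≡1))
        refl (subst (lookup u i Fin.≤_) wi≡1 (u≤w i))

  max-triword : (u v : Word n) → IsTriword u → IsTriword v → IsTriword (maxʷ u v)
  max-triword u v (u2 , u01) (v2 , v01) = t2 , t3
    where
    t2 : ∀ i → toℕ i ≡ 0 → lookup (maxʷ u v) i ≢ 2F
    t2 i i≡0 eq with ⊔.⊔-sel (lookup u i) (lookup v i)
    ... | inj₁ e = u2 i i≡0 (trans (sym e) (trans (sym (max-lookup u v i)) eq))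
    ... | inj₂ e = v2 i i≡0 (trans (sym e) (trans (sym (max-lookup u v i)) eq))

    t3 : ∀ i j → i Fin.< j → lookup (maxʷ u v) i ≡ 0F → lookup (maxʷ u v) j ≢ 1F
    t3 i j i<j eq0 eq1 with ⊔.⊔-sel (lookup u j) (lookup v j)
    ... | inj₁ e = u01 i j i<j (≤0 (subst (lookup u i Fin.≤_) eq0 (max-≤₁ u v i)))
                     (trans (sym e) (trans (sym (max-lookup u v j)) eq1))
    ... | inj₂ e = v01 i j i<j (≤0 (subst (lookup v i Fin.≤_) eq0 (max-≤₂ u v i)))
                     (trans (sym e) (trans (sym (max-lookup u v j)) eq1))

  clear-triword : (w : Word n) → (∀ i → toℕ i ≡ 0 → lookup w i ≢ 2F) → IsTriword (clear w)
  clear-triword {n} w w2 =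
    (λ i i≡0 eq → go2 i i≡0 (badOne? w i) (trans (sym (clear-lookup w i)) eq)) ,
    (λ i j i<j eq0 eq1 → go1 i j i<j (badOne? w i) (badOne? w j)
      (trans (sym (clear-lookup w i)) eq0) (trans (sym (clear-lookup w j)) eq1))
    where
    go2 : ∀ i → toℕ i ≡ 0 → (d : Dec (BadOne w i)) → (if does d then 0F else lookup w i) ≢ 2F
    go2 i i≡0 (yes _) ()
    go2 i i≡0 (no _)  eq = w2 i i≡0 eq

    go1 : ∀ i j → i Fin.< j → (d : Dec (BadOne w i)) (e : Dec (BadOne w j)) →
          (if does d then 0F else lookup w i) ≡ 0F → (if does e then 0F else lookup w j) ≢ 1F
    go1 i j i<j _                          (yes _)   _   ()
    go1 i j i<j (yes (_ , k , k<i , wk≡0)) (no ¬bad) _   wj≡1 = ¬bad (wj≡1 , k , ℕ.<-trans k<i i<j , wk≡0)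
    go1 i j i<j (no _)                     (no ¬bad) wi≡0 wj≡1 = ¬bad (wj≡1 , i , i<j , wi≡0)

  min-2 : (u v : Word n) → IsTriword u → ∀ i → toℕ i ≡ 0 → lookup (minʷ u v) i ≢ 2F
  min-2 u v (u2 , _) i i≡0 eq = u2 i i≡0
    (Fin.≤-antisym (≤2 (lookup u i)) (subst (Fin._≤ lookup u i) eq (min-≤₁ u v i)))

  zero-triword : IsTriword (zeroʷ n)
  zero-triword {n} =
    (λ i _ eq → contradiction (trans (sym (lookup-replicate i 0F)) eq) λ ()) ,
    (λ _ j _ _ eq → contradiction (trans (sym (lookup-replicate j 0F)) eq) λ ())

  top-triword : IsTriword (topʷ n)
  top-triword {zero}  = (λ ()) , (λ ())
  top-triword {suc n} = t2 , t3
    where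
    t2 : ∀ i → toℕ i ≡ 0 → lookup (topʷ (suc n)) i ≢ 2F
    t2 Fin.zero _ ()

    t3 : ∀ i j → i Fin.< j → lookup (topʷ (suc n)) i ≡ 0F → lookup (topʷ (suc n)) j ≢ 1F
    t3 Fin.zero    _           _ () _
    t3 (Fin.suc i) (Fin.suc j) _ eq _ =
      contradiction (trans (sym (lookup-replicate i 2F)) eq) λ ()

  top-maximum : (u : Word n) → .(IsTriword u) → u ≤ʷ topʷ n
  top-maximum (k ∷ u) t Fin.zero    = aux k refl
    where
    aux : ∀ k′ → k ≡ k′ → Fin._≤_ {3} {3} k′ 1F
    aux 0F _  = z≤n
    aux 1F _  = s≤s z≤n
    aux 2F eq = ⊥-elim-irr (proj₁ t Fin.zero refl eq)
  top-maximum (k ∷ u) t (Fin.suc i) = subst (lookup u i Fin.≤_) (sym (lookup-replicate i 2F)) (≤2 (lookup u i))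

  zero-minimum : (u : Word n) → zeroʷ n ≤ʷ u
  zero-minimum u i = subst (Fin._≤ lookup u i) (sym (lookup-replicate i 0F)) z≤n

words : ∀ n → List (Word n)
words zero    = [] ∷ []
words (suc n) = cartesianProductWith _∷_ (allFin 3) (words n)

toTri : Word n → Maybe (Tri n)
toTri u with isTriword? u
... | yes t = just (u , [ t ])
... | no _  = nothing

triwords : ∀ n → List (Tri n)
triwords n = mapMaybe toTri (words n)

private
  words-complete : (u : Word n) → u ∈ words n
  words-complete []      = here refl
  words-complete (k ∷ u) = ∈-cartesianProductWith⁺ _∷_ (∈-allFin k) (words-complete u)

  words-unique : ∀ n → Unique (words n)
  words-unique zero    = [] ∷ []
  words-unique (suc n) = Unique.cartesianProductWith⁺ _∷_ ∷-injective (Unique.allFin⁺ 3) (words-unique n)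

  mapMaybe-complete : (u : Tri n) → ∀ {ws} → value u ∈ ws → u ∈ mapMaybe toTri ws
  mapMaybe-complete (u , [ t ]) {w ∷ ws} (here refl) with isTriword? w
  ... | yes _ = here refl
  ... | no ¬t = ⊥-elim-irr (¬t t)
  mapMaybe-complete u {w ∷ ws} (there u∈) with isTriword? w
  ... | yes _ = there (mapMaybe-complete u u∈)
  ... | no _  = mapMaybe-complete u u∈

  mapMaybe-fresh : ∀ {w : Word n} {ws} → All (w ≢_) ws → All (λ u → w ≢ value u) (mapMaybe toTri ws)
  mapMaybe-fresh []                     = []
  mapMaybe-fresh {ws = v ∷ _} (ne ∷ fr) with isTriword? v
  ... | yes _ = ne ∷ mapMaybe-fresh fr
  ... | no _  = mapMaybe-fresh fr

  mapMaybe-unique : ∀ {ws : List (Word n)} → Unique ws → Unique (mapMaybe toTri ws)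
  mapMaybe-unique []                     = []
  mapMaybe-unique {ws = w ∷ _} (fr ∷ un) with isTriword? w
  ... | yes _ = All.map (λ ne eq → ne (cong value eq)) (mapMaybe-fresh fr) ∷ mapMaybe-unique un
  ... | no _  = mapMaybe-unique un

Hoch : ℕ → FiniteLattice
Hoch n = record
  { Carrier          = Tri n
  ; _≤_              = _≤ʷ_ on value
  ; _∨_              = λ (u , s) (v , t) → maxʷ u v , Irrelevant.zipWith (max-triword u v) s t
  ; _∧_              = λ (u , s) (v , _) → clear (minʷ u v) ,
                         Irrelevant.map (clear-triword (minʷ u v) ∘ min-2 u v) s
  ; ⊤                = topʷ n , [ top-triword ]
  ; ⊥                = zeroʷ n , [ zero-triword ]
  ; isBoundedLattice = record
    { isLattice = record
      { isPartialOrder = record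
        { isPreorder = record
          { isEquivalence = isEquivalence
          ; reflexive     = λ eq → ≤ʷ-refl (cong value eq)
          ; trans         = λ {u} {v} {w} → ≤ʷ-trans (value u) (value v) (value w)
          }
        ; antisym = λ p q → value-injective (≤ʷ-antisym p q)
        }
      ; supremum = λ (u , _) (v , _) →
          max-≤₁ u v , max-≤₂ u v , λ (w , _) → max-least u v w
      ; infimum  = λ (u , _) (v , _) →
          ≤ʷ-trans (clear (minʷ u v)) (minʷ u v) u (clear-≤ (minʷ u v)) (min-≤₁ u v) ,
          ≤ʷ-trans (clear (minʷ u v)) (minʷ u v) v (clear-≤ (minʷ u v)) (min-≤₂ u v) ,
          λ { (w , [ t ]) w≤u w≤v → clear-greatest w (minʷ u v) t (min-greatest u v w w≤u w≤v) }
      }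
    ; maximum = λ { (u , [ t ]) → top-maximum u t }
    ; minimum = λ (u , _) → zero-minimum u
    }
  ; _≤?_     = λ u v → value u ≤ʷ? value v
  ; elements = triwords n
  ; complete = λ u → mapMaybe-complete u (words-complete (value u))
  ; unique   = mapMaybe-unique (words-unique n)
  }

𝔞 : ∀ n → ℕ → Word n
𝔞 n i = tabulate (λ k → if does (toℕ k ℕ.<? i) then 1F else 0F)

-- A 2 in the i-th position (counted from 1), zeros elsewhere.
𝔟 : ∀ n → ℕ → Word n
𝔟 n i = tabulate (λ k → if does (suc (toℕ k) ℕ.≟ i) then 2F else 0F)

module JPoset (n : ℕ) where
  open FiniteLattice (Hoch n)

  infix 4 _≤ᴶ_ _≤ᴶ?_

  -- The order of J_n, meaningful on join-irreducible elements.  No transitive closure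
  -- is needed: 𝔟⁽²⁾ is minimal among them, and those above 𝔞⁽ⁱ⁾ are the 𝔞⁽ʲ⁾ with i ≤ j.
  _≤ᴶ_ : Rel (Tri n) 0ℓ
  x ≤ᴶ y = x ≤ y ⊎ (value x ≡ 𝔟 n 2 × ∃[ i ] i ℕ.< suc n × 1 ℕ.< i × value y ≡ 𝔞 n i)

  _≤ᴶ?_ : Decidable _≤ᴶ_
  x ≤ᴶ? y = (x ≤? y) ⊎-dec (Vec.≡-dec Fin._≟_ (value x) (𝔟 n 2) ×-dec
    ℕ.anyUpTo? (λ i → (1 ℕ.<? i) ×-dec Vec.≡-dec Fin._≟_ (value y) (𝔞 n i)) (suc n))

  joinIrreducibles : List (Tri n)
  joinIrreducibles = filter joinIrreducible? elements

  IsAntichain : Pred (List (Tri n)) 0ℓ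
  IsAntichain A = All (λ x → All (λ y → x ≤ᴶ y → x ≡ y) A) A

  isAntichain? : Unary.Decidable IsAntichain
  isAntichain? A = All.all? (λ x → All.all? (λ y → (x ≤ᴶ? y) →-dec (x ≟ y)) A) A

  antichains : List (List (Tri n))
  antichains = filter isAntichain? (subsets joinIrreducibles)

  countAtoms : List (Tri n) → ℕ
  countAtoms A = length (filter atom? A)

-- Rational functions whose denominators are products of powers of d₁, …, dₖ ∈ ℤ[x,y]
-- are evaluated at elements x, y of an arbitrary commutative ring in which d₁, …, dₖ
-- become invertible.  With R = ℤ[x,y][1/d₁, …, 1/dₖ] ⊆ ℚ(x,y) and x, y the
-- indeterminates this is the rational function itself.
module Triangles {c ℓ} (R : CommutativeRing c ℓ) where
  open CommutativeRing R
  open Exp semiring public using (_^_)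
  open Mult +-monoid using () renaming (_×_ to _ℕ×_)
  open AlgebraDefinitions _≈_ using (Invertible)

  ∑ : List A → (A → Carrier) → Carrier
  ∑ xs f = foldr (λ x s → f x + s) 0# xs

  infixr 8 _·_
  _·_ : ℤ → Carrier → Carrier
  (+ k)    · r = k ℕ× r
  -[1+ k ] · r = - (suc k ℕ× r)

  IsUnit : Pred Carrier _
  IsUnit = Invertible 1# _*_

  _/_ : Carrier → {d : Carrier} → IsUnit d → Carrier
  r / (d⁻¹ , _) = r * d⁻¹

  M : ℕ → Carrier → Carrier → Carrier
  M n x y = ∑ (triwords n) λ u → ∑ (triwords n) λ v →
    möbius u v · (x ^ rank u * y ^ rank v)
    where open CoreLabelOrder (Hoch n)

  H : ℕ → (x y : Carrier) → IsUnit (y - 1#) → IsUnit (x * (y - 1#) + 1#) → Carrier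
  H n x y d₁ d₂ = (x * (y - 1#) + 1#) ^ n * M n (y / d₁) ((x * (y - 1#)) / d₂)

{-# OPTIONS --safe #-}

-- A triword u is determined by the set T of positions of its 2s and, if u₁ = 1, the position p of
-- its last 1.  Its core label set consists of the 𝔟⁽ⁱ⁾ with i ∈ T and, if u₁ = 1, of the 𝔞⁽ʲ⁾ with
-- p ≤ j < (position of the first 0).  So u ⊑ v can be decided letter by letter, and the rank of u
-- is |T| + [u₁ = 1].
--
-- The function F(v) = ∑_u μ(u,v) X^rk(u) is characterised by ∑_{w ⊑ v} F(w) = X^rk(v).  With
-- a = X − 1 the solution is F(v) = a^|T| if v₁ = 0 and F(v) = a^|T| (X − k) if v₁ = 1, where k is
-- the number of labels 𝔞⁽ʲ⁾ of v.  Summing F(v) Y^rk(v) and substituting, one finds for z = xy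
--   H_n(x,y) = (1 + z)^n + (n − 1) x (1 + z)^(n − 2).
-- On the other side, an antichain of J_n either consists of elements 𝔟⁽ⁱ⁾ and possibly 𝔞⁽¹⁾, all
-- of them atoms, or of one 𝔞⁽ⁱ⁾ with i > 1 and elements 𝔟⁽ʲ⁾ with j > 2; this gives the same sum.

module Submission where

open import Defs
open import Algebra.Bundles using (CommutativeRing)
import Algebra.Properties.CommutativeMonoid.Mult as CommutativeMonoidMult
import Algebra.Properties.CommutativeSemigroup as CommutativeSemigroupProperties
import Algebra.Properties.CommutativeSemiring.Exp as Exp
import Algebra.Properties.Group as GroupProperties
import Algebra.Properties.Ring as RingProperties
import Algebra.Properties.Semiring.Mult as Mult
import Algebra.Solver.Ring.NaturalCoefficients.Default as SemiringSolver
open import Data.Bool.Base using (Bool; true; false; if_then_else_; _∧_; T)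
open import Data.Bool.Properties using (T-∧; if-eta)
open import Data.Empty using (⊥-elim)
open import Data.Fin.Base as Fin using (Fin; zero; suc; toℕ)
open import Data.Fin.Patterns using (0F; 1F; 2F)
import Data.Fin.Properties as Fin
open import Data.Integer.Base as ℤ using (ℤ; +_; -[1+_])
import Data.Integer.Properties as ℤ
import Data.Irrelevant as Irrelevant
open import Data.List.Base using (List; []; _∷_; _++_; map; foldr; filter; length; mapMaybe; tabulate)
open import Data.List.Membership.Propositional using (_∈_)
open import Data.List.Membership.Propositional.Properties
  using (∈-filter⁺; ∈-filter⁻; ∈-++⁺ˡ; ∈-++⁺ʳ; ∈-++⁻; ∈-tabulate⁺; ∈-tabulate⁻)
open import Data.List.Membership.Propositional.Properties.WithK using (unique∧set⇒bag)
import Data.List.Properties as List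
open import Data.List.Relation.Binary.BagAndSetEquality using (∼bag⇒↭)
open import Data.List.Relation.Binary.Permutation.Propositional as ↭ using (_↭_)
open import Data.List.Relation.Binary.Permutation.Propositional.Properties using (All-resp-↭)
open import Data.List.Relation.Unary.All as All using (All; []; _∷_)
import Data.List.Relation.Unary.All.Properties as All
open import Data.List.Relation.Unary.AllPairs using (AllPairs; []; _∷_)
import Data.List.Relation.Unary.AllPairs.Properties as AllPairs
open import Data.List.Relation.Unary.Any using (here; there)
open import Data.List.Relation.Unary.Unique.Propositional using (Unique)
import Data.List.Relation.Unary.Unique.Propositional.Properties as Unique
open import Data.Nat.Base as ℕ using (ℕ; zero; suc; pred; z≤n; s≤s; z<s; s<s)
import Data.Nat.Properties as ℕ
open import Data.Product.Base using (_×_; _,_; ∃-syntax; proj₁; proj₂)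
open import Data.Refinement.Base using (_,_; value)
open import Data.Refinement.Properties using (value-injective)
open import Data.Sum.Base as Sum using (_⊎_; inj₁; inj₂; [_,_]′)
open import Data.Unit.Base using (tt)
open import Data.Vec.Base using ([]; _∷_; lookup; _[_]≔_)
open import Data.Vec.Properties
  using (lookup-replicate; lookup-zipWith; lookup∘tabulate; lookup∘update; lookup∘update′)
open import Function.Base using (_∘_)
open import Function.Bundles using (Equivalence; mk⇔)
open import Induction.WellFounded using (Acc; acc)
open import Level using (Level; 0ℓ)
open import Relation.Binary.Core using (Rel)
open import Relation.Binary.Definitions
  using (Antisymmetric; Decidable; DecidableEquality; Reflexive; Transitive)
open import Relation.Binary.Lattice.Structures using (IsBoundedLattice)
open import Relation.Binary.PropositionalEquality as ≡ using (_≡_; _≢_)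
import Relation.Binary.Reasoning.Setoid as SetoidReasoning
open import Relation.Nullary using (Dec; yes; no; does; ¬_; contradiction; _×-dec_; _→-dec_)
open import Relation.Nullary.Decidable using (T?; dec-false; dec-true; does-⇔; recompute)
open import Relation.Unary as Unary using (Pred)

-- The order is defined through labels of covers in an interval, so at the outset nothing about it
-- is recursive. It becomes so once the labels are read off the letters: `word⊑` is a Boolean
-- function that reads two words in parallel and mainly has to remember whether a 0 has occurred.
-- Sums over the triwords below `v` then satisfy recursions along `v`. One quantity is not
-- multiplicative in the letters, the number of labels 𝔞. It is carried along as a parameter `c`,
-- and all sums turn out to be affine in `c`. The closed form has a negative part; as the algebra is
-- done with semiring identities, that part stays on the other side of the equations and is
-- cancelled at the very end.

private
  variable
    a p : Level
    A B : Set a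
    n N : ℕ

-- Finite sums and Möbius inversion

module Sums {c ℓ} (R : CommutativeRing c ℓ) where
  open CommutativeRing R
  open Triangles R using (∑; _·_; _^_)
  open SetoidReasoning setoid
  open RingProperties ring
  open CommutativeSemigroupProperties +-commutativeSemigroup using (interchange)
  private module ℕ× = Mult semiring

  [_]_ : Bool → Carrier → Carrier
  [ β ] r = if β then r else 0#

  infixr 9 [_]_

  []-cong : ∀ β {r s} → r ≈ s → [ β ] r ≈ [ β ] s
  []-cong true  r≈s = r≈s
  []-cong false _   = refl

  []-∧ : ∀ β γ r → [ β ∧ γ ] r ≈ [ β ] [ γ ] r
  []-∧ true  γ r = refl
  []-∧ false γ r = refl

  []-distrib-*ˡ : ∀ r β s → r * [ β ] s ≈ [ β ] (r * s)
  []-distrib-*ˡ r true  s = refl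
  []-distrib-*ˡ r false s = zeroʳ r

  ∑-cong : {f g : A → Carrier} → ∀ xs → (∀ x → f x ≈ g x) → ∑ xs f ≈ ∑ xs g
  ∑-cong []       f≈g = refl
  ∑-cong (x ∷ xs) f≈g = +-cong (f≈g x) (∑-cong xs f≈g)

  ∑-zero : ∀ (xs : List A) → ∑ xs (λ _ → 0#) ≈ 0#
  ∑-zero []       = refl
  ∑-zero (x ∷ xs) = trans (+-identityˡ _) (∑-zero xs)

  ∑-++ : (f : A → Carrier) → ∀ xs ys → ∑ (xs ++ ys) f ≈ ∑ xs f + ∑ ys f
  ∑-++ f []       ys = sym (+-identityˡ _)
  ∑-++ f (x ∷ xs) ys = trans (+-congˡ (∑-++ f xs ys)) (sym (+-assoc _ _ _))

  ∑-map : (f : B → Carrier) (h : A → B) → ∀ xs → ∑ (map h xs) f ≈ ∑ xs (f ∘ h)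
  ∑-map f h []       = refl
  ∑-map f h (x ∷ xs) = +-congˡ (∑-map f h xs)

  ∑-distrib-+ : (f g : A → Carrier) → ∀ xs → ∑ xs (λ x → f x + g x) ≈ ∑ xs f + ∑ xs g
  ∑-distrib-+ f g []       = sym (+-identityˡ _)
  ∑-distrib-+ f g (x ∷ xs) = trans (+-congˡ (∑-distrib-+ f g xs)) (interchange _ _ _ _)

  ∑-*ˡ : ∀ r (f : A → Carrier) xs → r * ∑ xs f ≈ ∑ xs (λ x → r * f x)
  ∑-*ˡ r f []       = zeroʳ r
  ∑-*ˡ r f (x ∷ xs) = trans (distribˡ r _ _) (+-congˡ (∑-*ˡ r f xs))

  ∑-*ʳ : ∀ r (f : A → Carrier) xs → ∑ xs f * r ≈ ∑ xs (λ x → f x * r)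
  ∑-*ʳ r f []       = zeroˡ r
  ∑-*ʳ r f (x ∷ xs) = trans (distribʳ r _ _) (+-congˡ (∑-*ʳ r f xs))

  ∑-neg : (f : A → Carrier) → ∀ xs → ∑ xs (λ x → - f x) ≈ - ∑ xs f
  ∑-neg f []       = sym -0#≈0#
  ∑-neg f (x ∷ xs) = trans (+-congˡ (∑-neg f xs)) (-‿+-comm _ _)

  ∑-comm : (f : A → B → Carrier) → ∀ xs ys → ∑ xs (λ x → ∑ ys (f x)) ≈ ∑ ys (λ y → ∑ xs (λ x → f x y))
  ∑-comm f []       ys = sym (∑-zero ys)
  ∑-comm f (x ∷ xs) ys = trans (+-congˡ (∑-comm f xs ys)) (sym (∑-distrib-+ _ _ ys))

  ∑-filter : {P : Pred A p} (P? : Unary.Decidable P) (f : A → Carrier) → ∀ xs →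
             ∑ (filter P? xs) f ≈ ∑ xs (λ x → [ does (P? x) ] f x)
  ∑-filter P? f []       = refl
  ∑-filter P? f (x ∷ xs) with does (P? x)
  ... | true  = +-congˡ (∑-filter P? f xs)
  ... | false = trans (∑-filter P? f xs) (sym (+-identityˡ _))

  ∑-vanish : {f : A → Carrier} → ∀ {xs} → All (λ x → f x ≈ 0#) xs → ∑ xs f ≈ 0#
  ∑-vanish []         = refl
  ∑-vanish (eq ∷ eqs) = trans (+-cong eq (∑-vanish eqs)) (+-identityˡ _)

  ∑-single : (_≟_ : DecidableEquality A) (f : A → Carrier) → ∀ {xs} → Unique xs → ∀ {x} → x ∈ xs →
             ∑ xs (λ y → [ does (y ≟ x) ] f y) ≈ f x
  ∑-single _≟_ f {y ∷ xs} (y∉xs ∷ _) {x} (here x≡y) with y ≟ x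
  ... | no y≢x     = contradiction (≡.sym x≡y) y≢x
  ... | yes ≡.refl = trans (+-congˡ (∑-vanish (All.map off y∉xs))) (+-identityʳ _)
    where
    off : ∀ {z} → y ≢ z → [ does (z ≟ y) ] f z ≈ 0#
    off {z} y≢z with z ≟ y
    ... | yes z≡y = contradiction (≡.sym z≡y) y≢z
    ... | no _    = refl
  ∑-single _≟_ f {y ∷ xs} (y∉xs ∷ u) {x} (there x∈xs) with y ≟ x
  ... | yes ≡.refl = contradiction ≡.refl (All.lookup y∉xs x∈xs)
  ... | no _       = trans (+-identityˡ _) (∑-single _≟_ f u x∈xs)

  ·-homo-⊖ : ∀ m n r → (m ℤ.⊖ n) · r ≈ m ℕ×.× r - n ℕ×.× r
  ·-homo-⊖ m       zero    r = trans (sym (+-identityʳ _)) (+-congˡ (sym -0#≈0#))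
  ·-homo-⊖ zero    (suc n) r = sym (+-identityˡ _)
  ·-homo-⊖ (suc m) (suc n) r = begin
    (suc m ℤ.⊖ suc n) · r                         ≡⟨ ≡.cong (_· r) (ℤ.[1+m]⊖[1+n]≡m⊖n m n) ⟩
    (m ℤ.⊖ n) · r                                 ≈⟨ ·-homo-⊖ m n r ⟩
    m ℕ×.× r - n ℕ×.× r                           ≈⟨ +-identityˡ _ ⟨
    0# + (m ℕ×.× r - n ℕ×.× r)                    ≈⟨ +-congʳ (-‿inverseʳ r) ⟨
    (r - r) + (m ℕ×.× r - n ℕ×.× r)               ≈⟨ interchange _ _ _ _ ⟩
    (r + m ℕ×.× r) + (- r - n ℕ×.× r)             ≈⟨ +-congˡ (-‿+-comm _ _) ⟩
    (r + m ℕ×.× r) - (r + n ℕ×.× r)               ∎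

  ·-neg : ∀ i r → (ℤ.- i) · r ≈ - (i · r)
  ·-neg (+ zero)  r = sym -0#≈0#
  ·-neg (+ suc n) r = refl
  ·-neg -[1+ n ]  r = sym (-‿involutive _)

  ·-homo-+ : ∀ i j r → (i ℤ.+ j) · r ≈ i · r + j · r
  ·-homo-+ (+ m)    (+ n)    r = ℕ×.×-homo-+ r m n
  ·-homo-+ (+ m)    -[1+ n ] r = ·-homo-⊖ m (suc n) r
  ·-homo-+ -[1+ m ] (+ n)    r = trans (·-homo-⊖ n (suc m) r) (+-comm _ _)
  ·-homo-+ -[1+ m ] -[1+ n ] r = begin
    - (suc (suc (m ℕ.+ n)) ℕ×.× r)             ≡⟨ ≡.cong (λ k → - (suc k ℕ×.× r)) (ℕ.+-suc m n) ⟨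
    - ((suc m ℕ.+ suc n) ℕ×.× r)               ≈⟨ -‿cong (ℕ×.×-homo-+ r (suc m) (suc n)) ⟩
    - (suc m ℕ×.× r + suc n ℕ×.× r)            ≈⟨ -‿+-comm _ _ ⟨
    - (suc m ℕ×.× r) - (suc n ℕ×.× r)          ∎

  ·-sum : (f : A → ℤ) → ∀ xs r → foldr ℤ._+_ (+ 0) (map f xs) · r ≈ ∑ xs (λ x → f x · r)
  ·-sum f []       r = refl
  ·-sum f (x ∷ xs) r = trans (·-homo-+ (f x) _ r) (+-congˡ (·-sum f xs r))

  ·-assoc-* : ∀ i r s → i · (r * s) ≈ (i · r) * s
  ·-assoc-* (+ n)     r s = sym (ℕ×.×-assoc-* n r s)
  ·-assoc-* -[1+ n ]  r s = trans (-‿cong (sym (ℕ×.×-assoc-* (suc n) r s))) (-‿distribˡ-* _ _)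

  module Möbius
    (elements : List A) (complete : ∀ x → x ∈ elements) (unique : Unique elements)
    (_≟_ : DecidableEquality A)
    {_⊑_ : Rel A 0ℓ} (_⊑?_ : Decidable _⊑_)
    (⊑-refl : Reflexive _⊑_) (⊑-trans : Transitive _⊑_) (⊑-antisym : Antisymmetric _≡_ _⊑_)
    where

    open FiniteOrder elements complete _≟_ {_⊑_} _⊑?_ ⊑-refl ⊑-trans

    möbiusAcc-⋢ : ∀ {u v} (wf : Acc _⊏_ v) → ¬ u ⊑ v → möbiusAcc u v wf ≡ + 0
    möbiusAcc-⋢ {u} {v} (acc rs) u⋢v with u ≟ v | u ⊑? v
    ... | yes ≡.refl | _       = contradiction ⊑-refl u⋢v
    ... | no _       | yes u⊑v = contradiction u⊑v u⋢v
    ... | no _       | no _    = ≡.refl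

    -- The recursion for μ in a form without cases, so that both sides can be summed over `u`. For
    -- `u ≡ v` all summands vanish because `w ⊏ v` excludes `v ⊑ w`; for `u ⋢ v` they vanish by
    -- transitivity; otherwise the additional summands, those with `u ⋢ w`, are 0.
    möbiusAcc-step : ∀ u v (rs : ∀ {w} → w ⊏ v → Acc _⊏_ w) r → möbiusAcc u v (acc rs) · r ≈
      [ does (u ≟ v) ] r -
      ∑ elements (λ w → whenever (w ⊏? v) (λ w⊏v → möbiusAcc u w (rs w⊏v) · r) 0#)
    möbiusAcc-step u v rs r with u ≟ v
    ... | yes ≡.refl = begin
      r + 0#        ≈⟨ +-congˡ -0#≈0# ⟨
      r - 0#        ≈⟨ +-congˡ (-‿cong (∑-vanish (All.universal vanish elements))) ⟨
      r - ∑ elements (λ w → whenever (w ⊏? v) (λ w⊏v → möbiusAcc u w (rs w⊏v) · r) 0#) ∎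
      where
      vanish : ∀ w → whenever (w ⊏? u) (λ w⊏u → möbiusAcc u w (rs w⊏u) · r) 0# ≈ 0#
      vanish w with w ⊏? u
      ... | no _    = refl
      ... | yes w⊏u = reflexive (≡.cong (_· r) (möbiusAcc-⋢ (rs w⊏u) (proj₂ w⊏u)))
    ... | no _ with u ⊑? v
    ...   | no u⋢v = begin
      0#            ≈⟨ trans (+-congˡ -0#≈0#) (+-identityˡ _) ⟨
      0# - 0#       ≈⟨ +-congˡ (-‿cong (∑-vanish (All.universal vanish elements))) ⟨
      0# - ∑ elements (λ w → whenever (w ⊏? v) (λ w⊏v → möbiusAcc u w (rs w⊏v) · r) 0#) ∎
      where
      vanish : ∀ w → whenever (w ⊏? v) (λ w⊏v → möbiusAcc u w (rs w⊏v) · r) 0# ≈ 0#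
      vanish w with w ⊏? v
      ... | no _    = refl
      ... | yes w⊏v = reflexive (≡.cong (_· r)
        (möbiusAcc-⋢ (rs w⊏v) (λ u⊑w → u⋢v (⊑-trans u⊑w (proj₁ w⊏v)))))
    ...   | yes u⊑v = begin
      (ℤ.- foldr ℤ._+_ (+ 0) (map μ elements)) · r ≈⟨ ·-neg (foldr ℤ._+_ (+ 0) (map μ elements)) r ⟩
      - (foldr ℤ._+_ (+ 0) (map μ elements) · r)   ≈⟨ -‿cong (·-sum μ elements r) ⟩
      - ∑ elements (λ w → μ w · r)                 ≈⟨ -‿cong (∑-cong elements term) ⟩
      - ∑ elements (λ w → whenever (w ⊏? v) (λ w⊏v → möbiusAcc u w (rs w⊏v) · r) 0#) ≈⟨ +-identityˡ _ ⟨
      0# - ∑ elements (λ w → whenever (w ⊏? v) (λ w⊏v → möbiusAcc u w (rs w⊏v) · r) 0#) ∎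
      where
      μ : A → ℤ
      μ w = whenever (u ⊑? w ×-dec w ⊏? v) (λ (_ , w⊏v) → möbiusAcc u w (rs w⊏v)) (+ 0)

      term : ∀ w → μ w · r ≈ whenever (w ⊏? v) (λ w⊏v → möbiusAcc u w (rs w⊏v) · r) 0#
      term w with u ⊑? w | w ⊏? v
      ... | yes _  | yes _   = refl
      ... | yes _  | no _    = refl
      ... | no _   | no _    = refl
      ... | no u⋢w | yes w⊏v = reflexive (≡.cong (_· r) (≡.sym (möbiusAcc-⋢ (rs w⊏v) u⋢w)))

    -- Well-founded induction on `v`: after exchanging the sums, the inner sum over `u` is `f w` by
    -- the induction hypothesis at `w ⊏ v`, and `h v` minus all `f w` strictly below `v` leaves
    -- `f v`.
    möbiusAcc-inversion : {f h : A → Carrier} →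
      (∀ v → ∑ elements (λ w → [ does (w ⊑? v) ] f w) ≈ h v) →
      ∀ v (wf : Acc _⊏_ v) → ∑ elements (λ u → möbiusAcc u v wf · h u) ≈ f v
    möbiusAcc-inversion {f} {h} sum-f v (acc rs) = begin
      ∑ elements (λ u → möbiusAcc u v (acc rs) · h u)
        ≈⟨ ∑-cong elements (λ u → möbiusAcc-step u v rs (h u)) ⟩
      ∑ elements (λ u → [ does (u ≟ v) ] h u - ∑ elements (term u))
        ≈⟨ ∑-distrib-+ _ _ elements ⟩
      ∑ elements (λ u → [ does (u ≟ v) ] h u) + ∑ elements (λ u → - ∑ elements (term u))
        ≈⟨ +-cong (∑-single _≟_ h unique (complete v)) (∑-neg _ elements) ⟩
      h v - ∑ elements (λ u → ∑ elements (term u))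
        ≈⟨ +-congˡ (-‿cong (∑-comm term elements elements)) ⟩
      h v - ∑ elements (λ w → ∑ elements (λ u → term u w))
        ≈⟨ +-congˡ (-‿cong (∑-cong elements inner)) ⟩
      h v - ∑ elements (λ w → [ does (w ⊏? v) ] f w)
        ≈⟨ +-congʳ (sum-f v) ⟨
      ∑ elements (λ w → [ does (w ⊑? v) ] f w) - ∑ elements (λ w → [ does (w ⊏? v) ] f w)
        ≈⟨ +-congʳ (∑-cong elements split) ⟩
      ∑ elements (λ w → [ does (w ≟ v) ] f w + [ does (w ⊏? v) ] f w) - ∑ elements (λ w → [ does (w ⊏? v) ] f w)
        ≈⟨ +-congʳ (∑-distrib-+ _ _ elements) ⟩
      ∑ elements (λ w → [ does (w ≟ v) ] f w) + ∑ elements (λ w → [ does (w ⊏? v) ] f w)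
        - ∑ elements (λ w → [ does (w ⊏? v) ] f w)
        ≈⟨ trans (+-assoc _ _ _) (trans (+-congˡ (-‿inverseʳ _)) (+-identityʳ _)) ⟩
      ∑ elements (λ w → [ does (w ≟ v) ] f w)
        ≈⟨ ∑-single _≟_ f unique (complete v) ⟩
      f v ∎
      where
      term : A → A → Carrier
      term u w = whenever (w ⊏? v) (λ w⊏v → möbiusAcc u w (rs w⊏v) · h u) 0#

      -- The decision becomes an argument of `go`, so that `whenever` reduces and the recursive call
      -- uses the proof `rs w⊏v` stored in the summand.
      inner : ∀ w → ∑ elements (λ u → term u w) ≈ [ does (w ⊏? v) ] f w
      inner w = go (w ⊏? v)
        where
        go : (d : Dec (w ⊏ v)) →
             ∑ elements (λ u → whenever d (λ w⊏v → möbiusAcc u w (rs w⊏v) · h u) 0#) ≈ [ does d ] f w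
        go (yes w⊏v) = möbiusAcc-inversion sum-f w (rs w⊏v)
        go (no _)    = ∑-zero elements

      split : ∀ w → [ does (w ⊑? v) ] f w ≈ [ does (w ≟ v) ] f w + [ does (w ⊏? v) ] f w
      split w with w ≟ v | w ⊑? v | v ⊑? w
      ... | yes ≡.refl | yes _   | no ¬vv  = contradiction ⊑-refl ¬vv
      ... | yes ≡.refl | yes _   | yes _   = sym (+-identityʳ _)
      ... | yes ≡.refl | no ¬vv  | _       = contradiction ⊑-refl ¬vv
      ... | no w≢v     | yes w⊑v | yes v⊑w = contradiction (⊑-antisym w⊑v v⊑w) w≢v
      ... | no _       | yes _   | no _    = sym (+-identityˡ _)
      ... | no _       | no _    | _       = sym (+-identityˡ _)

    möbius-inversion : {f h : A → Carrier} →
      (∀ v → ∑ elements (λ w → [ does (w ⊑? v) ] f w) ≈ h v) →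
      ∀ v → ∑ elements (λ u → möbius u v · h u) ≈ f v
    möbius-inversion sum-f v = möbiusAcc-inversion sum-f v (⊏-wellFounded v)

-- Ranks as lengths of longest chains

module RankFunction
  (elements : List A) (complete : ∀ x → x ∈ elements)
  (_≟_ : DecidableEquality A)
  {_⊑_ : Rel A 0ℓ} (_⊑?_ : Decidable _⊑_)
  (⊑-refl : Reflexive _⊑_) (⊑-trans : Transitive _⊑_)
  where

  open FiniteOrder elements complete _≟_ {_⊑_} _⊑?_ ⊑-refl ⊑-trans

  module _ (r : A → ℕ) (r-strict : ∀ {u v} → u ⊏ v → r u ℕ.< r v)
    (r-pred : ∀ v → r v ≡ 0 ⊎ ∃[ w ] w ⊏ v × suc (r w) ≡ r v) where

    private
      maximum-≤ : (f : A → ℕ) → ∀ xs {k} → (∀ x → f x ℕ.≤ k) → foldr ℕ._⊔_ 0 (map f xs) ℕ.≤ k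
      maximum-≤ f []       f≤k = z≤n
      maximum-≤ f (x ∷ xs) f≤k = ℕ.⊔-lub (f≤k x) (maximum-≤ f xs f≤k)

      ≤-maximum : (f : A → ℕ) → ∀ {xs x} → x ∈ xs → f x ℕ.≤ foldr ℕ._⊔_ 0 (map f xs)
      ≤-maximum f (here ≡.refl) = ℕ.m≤m⊔n _ _
      ≤-maximum f (there x∈xs)  = ℕ.≤-trans (≤-maximum f x∈xs) (ℕ.m≤n⊔m _ _)

    -- `r-strict` bounds every chain with top `v` by `r v`; `r-pred` extends a chain downwards with
    -- a loss of exactly one at each step, so the bound is attained.
    rankAcc-unique : ∀ v (wf : Acc _⊏_ v) → rankAcc v wf ≡ r v
    rankAcc-unique v (acc rs) = ℕ.≤-antisym (maximum-≤ _ elements upper) lower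
      where
      term : A → ℕ
      term w = whenever (w ⊏? v) (λ w⊏v → suc (rankAcc w (rs w⊏v))) 0

      upper : ∀ w → term w ℕ.≤ r v
      upper w with w ⊏? v
      ... | yes w⊏v = ≡.subst (ℕ._< r v) (≡.sym (rankAcc-unique w (rs w⊏v))) (r-strict w⊏v)
      ... | no _    = z≤n

      term-⊏ : ∀ {w} → w ⊏ v → term w ≡ suc (r w)
      term-⊏ {w} w⊏v with w ⊏? v
      ... | yes q = ≡.cong suc (rankAcc-unique w (rs q))
      ... | no ¬q = contradiction w⊏v ¬q

      lower : r v ℕ.≤ foldr ℕ._⊔_ 0 (map term elements)
      lower with r-pred v
      ... | inj₁ rv≡0               = ≡.subst (ℕ._≤ _) (≡.sym rv≡0) z≤n
      ... | inj₂ (w , w⊏v , suc≡rv) =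
        ≡.subst (ℕ._≤ _) (≡.trans (term-⊏ w⊏v) suc≡rv) (≤-maximum term (complete w))

    rank-unique : ∀ v → rank v ≡ r v
    rank-unique v = rankAcc-unique v (⊏-wellFounded v)

-- The double sum of the M-triangle as a single sum

module CoreLabelSums {c ℓ} (R : CommutativeRing c ℓ) (L : FiniteLattice) where
  open CommutativeRing R
  open Triangles R using (∑; _·_; _^_)
  open Sums R
  open SetoidReasoning setoid
  open FiniteLattice L using (elements; complete; unique; _≟_) renaming (Carrier to |L|)
  open CoreLabelOrder L

  module _
    (⊑-antisym : ∀ {u v} → u ⊑ v → v ⊑ u → u ≡ v)
    (r : |L| → ℕ) (r-strict : ∀ {u v} → u ⊑ v × ¬ v ⊑ u → r u ℕ.< r v)
    (r-pred : ∀ v → r v ≡ 0 ⊎ ∃[ w ] (w ⊑ v × ¬ v ⊑ w) × suc (r w) ≡ r v)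
    where

    open Möbius elements complete unique _≟_ {_⊑_} _⊑?_ (λ p → p) (λ f g → g ∘ f)
      (λ {u} {v} → ⊑-antisym {u} {v})
    open RankFunction elements complete _≟_ {_⊑_} _⊑?_ (λ p → p) (λ f g → g ∘ f)

    rank≡ : ∀ v → rank v ≡ r v
    rank≡ = rank-unique r (λ {u} {v} → r-strict {u} {v}) r-pred

    -- Summing over `u` first turns the inner sum into `f v` by Möbius inversion. It suffices to
    -- guess a solution `f` of the summatory equation; no value of μ is ever computed.
    ∑-möbius-rank : ∀ X Y (f : |L| → Carrier) →
      (∀ v → ∑ elements (λ w → [ does (w ⊑? v) ] f w) ≈ X ^ r v) →
      ∑ elements (λ u → ∑ elements (λ v → möbius u v · (X ^ rank u * Y ^ rank v))) ≈
      ∑ elements (λ v → f v * Y ^ r v)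
    ∑-möbius-rank X Y f sum-f = begin
      ∑ elements (λ u → ∑ elements (λ v → möbius u v · (X ^ rank u * Y ^ rank v)))
        ≈⟨ ∑-comm (λ u v → möbius u v · (X ^ rank u * Y ^ rank v)) elements elements ⟩
      ∑ elements (λ v → ∑ elements (λ u → möbius u v · (X ^ rank u * Y ^ rank v)))
        ≈⟨ ∑-cong elements (λ v → ∑-cong elements (λ u → ·-assoc-* (möbius u v) _ _)) ⟩
      ∑ elements (λ v → ∑ elements (λ u → möbius u v · (X ^ rank u) * Y ^ rank v))
        ≈⟨ ∑-cong elements (λ v → ∑-*ʳ (Y ^ rank v) (λ u → möbius u v · (X ^ rank u)) elements) ⟨
      ∑ elements (λ v → ∑ elements (λ u → möbius u v · (X ^ rank u)) * Y ^ rank v)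
        ≈⟨ ∑-cong elements (λ v → *-cong
             (möbius-inversion {h = λ u → X ^ rank u}
               (λ v → trans (sum-f v) (reflexive (≡.cong (X ^_) (≡.sym (rank≡ v))))) v)
             (reflexive (≡.cong (Y ^_) (rank≡ v)))) ⟩
      ∑ elements (λ v → f v * Y ^ r v) ∎

-- The core label sets of triwords

module Nucleus (L : FiniteLattice) where
  open FiniteLattice L renaming (_∧_ to infixr 7 _⊓_)
  open IsBoundedLattice isBoundedLattice
    using (x≤x∨y; y≤x∨y; ∨-least; x∧y≤x; x∧y≤y; ∧-greatest) renaming (trans to ≤-trans; refl to ≤-refl)
  open CoreLabelOrder L using (nucleus)

  -- `x ∨ j` is above `x`, distinct from it since `j` is not below `x`, and at most `y`; a cover
  -- leaves only `y`. The label equations below are obtained in this way.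
  ⋖-∨ : ∀ x y j → x ⋖ y → j ≤ y → ¬ j ≤ x → x ∨ j ≡ y
  ⋖-∨ x y j ((x≤y , _) , between) j≤y j≰x with x ∨ j ≟ y
  ... | yes eq = eq
  ... | no neq = contradiction
    ((x≤x∨y x j , λ eq → j≰x (≡.subst (j ≤_) (≡.sym eq) (y≤x∨y x j))) , ∨-least x≤y j≤y , neq)
    (between (x ∨ j))

  nucleus-≤ : ∀ x → nucleus x ≤ x
  nucleus-≤ x = go (filter (_⋖? x) elements)
    where
    go : ∀ zs → foldr _⊓_ x zs ≤ x
    go []       = ≤-refl
    go (z ∷ zs) = ≤-trans (x∧y≤y z _) (go zs)

  nucleus-⋖ : ∀ {x z} → z ⋖ x → nucleus x ≤ z
  nucleus-⋖ {x} {z} z⋖x = go (∈-filter⁺ (_⋖? x) (complete z) z⋖x)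
    where
    go : ∀ {zs} → z ∈ zs → foldr _⊓_ x zs ≤ z
    go (here ≡.refl) = x∧y≤x _ _
    go (there z∈zs)  = ≤-trans (x∧y≤y _ _) (go z∈zs)

  nucleus-greatest : ∀ {x y} → y ≤ x → (∀ z → z ⋖ x → y ≤ z) → y ≤ nucleus x
  nucleus-greatest {x} {y} y≤x y≤z =
    go (filter (_⋖? x) elements) (λ z z∈ → y≤z z (proj₂ (∈-filter⁻ (_⋖? x) {xs = elements} z∈)))
    where
    go : ∀ zs → (∀ z → z ∈ zs → y ≤ z) → y ≤ foldr _⊓_ x zs
    go []       _ = y≤x
    go (z ∷ zs) h = ∧-greatest (h z (here ≡.refl)) (go zs (λ w → h w ∘ there))

private
  ≤0F : {k : Fin 3} → Fin._≤_ {3} {3} k 0F → k ≡ 0F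
  ≤0F {0F} _ = ≡.refl

  2F≤ : {k : Fin 3} → Fin._≤_ {3} {3} 2F k → k ≡ 2F
  2F≤ {2F} _ = ≡.refl
  2F≤ {1F} (s≤s ())

  1F≤ : {k : Fin 3} → k ≢ 0F → Fin._≤_ {3} {3} 1F k
  1F≤ {0F} k≢0 = contradiction ≡.refl k≢0
  1F≤ {1F} _   = s≤s z≤n
  1F≤ {2F} _   = s≤s z≤n

  1F≤⇒≢0F : {k : Fin 3} → Fin._≤_ {3} {3} 1F k → k ≢ 0F
  1F≤⇒≢0F () ≡.refl

  fin3 : ∀ {k : Fin 3} → k ≢ 0F → k ≢ 1F → k ≡ 2F
  fin3 {0F} k≢0 _   = contradiction ≡.refl k≢0
  fin3 {1F} _   k≢1 = contradiction ≡.refl k≢1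
  fin3 {2F} _   _   = ≡.refl

infixl 9 _!_

_!_ : Tri n → Fin n → Fin 3
u ! i = lookup (value u) i

triword : (u : Tri n) → IsTriword (value u)
triword (u , Irrelevant.[ t ]) = recompute (isTriword? u) t

OnesBeforeZeros : Word n → Set
OnesBeforeZeros {n} w = ∀ (i j : Fin n) → i Fin.< j → lookup w i ≡ 0F → lookup w j ≢ 1F

-- Ψ x contains 𝔞⁽ʲ⁺¹⁾ precisely when Live holds of x and j (positions counted from 0).
Live : Word n → Fin n → Set
Live w j = (∀ k → k Fin.≤ j → lookup w k ≢ 0F) × (∀ k → j Fin.< k → lookup w k ≢ 1F)

before-1 : ∀ (w : Word n) → OnesBeforeZeros w → ∀ {j k} → lookup w j ≡ 1F → k Fin.≤ j → lookup w k ≢ 0F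
before-1 w ones {j} {k} wj≡1 k≤j wk≡0 with k Fin.≟ j
... | yes ≡.refl = contradiction (≡.trans (≡.sym wj≡1) wk≡0) λ ()
... | no k≢j     = ones k j (Fin.≤∧≢⇒< k≤j k≢j) wk≡0 wj≡1

last-1 : ∀ (w : Word n) → (∀ k → lookup w k ≢ 1F) ⊎
         ∃[ l ] lookup w l ≡ 1F × (∀ k → l Fin.< k → lookup w k ≢ 1F)
last-1 []      = inj₁ λ ()
last-1 (k ∷ w) with last-1 w | k Fin.≟ 1F
... | inj₂ (l , wl≡1 , after) | _     = inj₂ (suc l , wl≡1 , λ { (suc i) (s<s l<i) → after i l<i })
... | inj₁ none | yes k≡1 = inj₂ (zero , k≡1 , λ { (suc i) _ → none i })
... | inj₁ none | no k≢1  = inj₁ λ { zero → k≢1 ; (suc i) → none i }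

last-1-live : ∀ (w : Word n) → OnesBeforeZeros w → ∀ {l} → lookup w l ≡ 1F →
              (∀ k → l Fin.< k → lookup w k ≢ 1F) → Live w l
last-1-live w ones wl≡1 after = (λ k → before-1 w ones wl≡1) , after

lookup-𝔞-≤ : ∀ {i : ℕ} {k : Fin n} → toℕ k ℕ.< i → lookup (𝔞 n i) k ≡ 1F
lookup-𝔞-≤ {i = i} {k} k<i = ≡.trans (lookup∘tabulate _ k)
  (≡.cong (if_then 1F else 0F) (dec-true (toℕ k ℕ.<? i) k<i))

lookup-𝔞-> : ∀ {i : ℕ} {k : Fin n} → i ℕ.≤ toℕ k → lookup (𝔞 n i) k ≡ 0F
lookup-𝔞-> {i = i} {k} i≤k = ≡.trans (lookup∘tabulate _ k)
  (≡.cong (if_then 1F else 0F) (dec-false (toℕ k ℕ.<? i) (ℕ.≤⇒≯ i≤k)))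

lookup-𝔟-≡ : ∀ (i : Fin n) → lookup (𝔟 n (suc (toℕ i))) i ≡ 2F
lookup-𝔟-≡ i = ≡.trans (lookup∘tabulate _ i)
  (≡.cong (if_then 2F else 0F) (dec-true (suc (toℕ i) ℕ.≟ suc (toℕ i)) ≡.refl))

lookup-𝔟-≢ : ∀ {i k : Fin n} → k ≢ i → lookup (𝔟 n (suc (toℕ i))) k ≡ 0F
lookup-𝔟-≢ {i = i} {k} k≢i = ≡.trans (lookup∘tabulate _ k)
  (≡.cong (if_then 2F else 0F)
    (dec-false (suc (toℕ k) ℕ.≟ suc (toℕ i)) (k≢i ∘ Fin.toℕ-injective ∘ ℕ.suc-injective)))

𝔞ᵗ : Fin n → Tri n
𝔞ᵗ {n} j = 𝔞 n (suc (toℕ j)) , Irrelevant.[ tri ]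
  where
  no-2 : ∀ i → lookup (𝔞 n (suc (toℕ j))) i ≢ 2F
  no-2 i eq with toℕ i ℕ.<? suc (toℕ j)
  ... | yes i≤j = contradiction (≡.trans (≡.sym (lookup-𝔞-≤ i≤j)) eq) λ ()
  ... | no i≰j  = contradiction (≡.trans (≡.sym (lookup-𝔞-> (ℕ.≮⇒≥ i≰j))) eq) λ ()

  tri : IsTriword (𝔞 n (suc (toℕ j)))
  tri = (λ i _ → no-2 i) , ones
    where
    ones : OnesBeforeZeros (𝔞 n (suc (toℕ j)))
    ones i k i<k ai≡0 ak≡1 with toℕ k ℕ.<? suc (toℕ j)
    ... | yes k≤j = contradiction (≡.trans (≡.sym (lookup-𝔞-≤ (ℕ.<-trans i<k k≤j))) ai≡0) λ ()
    ... | no k≰j  = contradiction (≡.trans (≡.sym (lookup-𝔞-> (ℕ.≮⇒≥ k≰j))) ak≡1) λ ()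

-- The first entry of a triword is not 2, so 𝔟ᵗ k has its 2 at position suc k.
𝔟ᵗ : Fin N → Tri (suc N)
𝔟ᵗ {N} k = 𝔟 (suc N) (suc (toℕ (suc k))) , Irrelevant.[ tri ]
  where
  no-1 : ∀ i → lookup (𝔟 (suc N) (suc (toℕ (suc k)))) i ≢ 1F
  no-1 i eq with i Fin.≟ suc k
  ... | yes ≡.refl = contradiction (≡.trans (≡.sym (lookup-𝔟-≡ (suc k))) eq) λ ()
  ... | no i≢k     = contradiction (≡.trans (≡.sym (lookup-𝔟-≢ i≢k)) eq) λ ()

  tri : IsTriword (𝔟 (suc N) (suc (toℕ (suc k))))
  tri = (λ { zero _ eq → contradiction (≡.trans (≡.sym (lookup-𝔟-≢ {i = suc k} {zero} (λ ()))) eq) λ () })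
      , (λ _ j _ _ → no-1 j)

𝔞-! : ∀ (j : Fin n) {k} → k Fin.≤ j → 𝔞ᵗ j ! k ≡ 1F
𝔞-! j k≤j = lookup-𝔞-≤ (s≤s k≤j)

𝔞-!-> : ∀ (j : Fin n) {k} → j Fin.< k → 𝔞ᵗ j ! k ≡ 0F
𝔞-!-> j j<k = lookup-𝔞-> j<k

𝔟-! : ∀ (k : Fin N) → 𝔟ᵗ k ! suc k ≡ 2F
𝔟-! k = lookup-𝔟-≡ (suc k)

𝔟-!-≢ : ∀ (k : Fin N) {i} → i ≢ suc k → 𝔟ᵗ k ! i ≡ 0F
𝔟-!-≢ k = lookup-𝔟-≢

𝔟ᵗ-injective : ∀ (k l : Fin N) → 𝔟ᵗ k ≡ 𝔟ᵗ l → k ≡ l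
𝔟ᵗ-injective k l eq with k Fin.≟ l
... | yes k≡l = k≡l
... | no k≢l  = contradiction
  (≡.trans (≡.sym (𝔟-! k)) (≡.trans (≡.cong (_! suc k) eq) (𝔟-!-≢ l (k≢l ∘ Fin.suc-injective)))) λ ()

𝔞≢𝔟 : ∀ (j : Fin (suc N)) (k : Fin N) → 𝔞ᵗ j ≢ 𝔟ᵗ k
𝔞≢𝔟 j k eq =
  contradiction (≡.trans (≡.sym (𝔞-! j z≤n)) (≡.trans (≡.cong (_! zero) eq) (𝔟-!-≢ k {zero} (λ ())))) λ ()

𝔞ᵗ-injective : ∀ (j k : Fin n) → 𝔞ᵗ j ≡ 𝔞ᵗ k → j ≡ k
𝔞ᵗ-injective j k eq = Fin.≤-antisym (≤-from j k eq) (≤-from k j (≡.sym eq))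
  where
  ≤-from : ∀ (j k : Fin n) → 𝔞ᵗ j ≡ 𝔞ᵗ k → j Fin.≤ k
  ≤-from j k eq with j Fin.≤? k
  ... | yes j≤k = j≤k
  ... | no j≰k  = contradiction
    (≡.trans (≡.sym (𝔞-! j ℕ.≤-refl)) (≡.trans (≡.cong (_! j) eq) (𝔞-!-> k (ℕ.≰⇒> j≰k)))) λ ()

-- Covers that change one entry, and the nucleus

module _ {n : ℕ} where
  open FiniteLattice (Hoch n)
  open Nucleus (Hoch n)
  open CoreLabelOrder (Hoch n)

  ∨-! : ∀ x y i → (x ∨ y) ! i ≡ x ! i ⊎ (x ∨ y) ! i ≡ y ! i
  ∨-! x y i with ⊔.⊔-sel (x ! i) (y ! i)
  ... | inj₁ eq = inj₁ (≡.trans (lookup-zipWith ⊔._⊔_ i (value x) (value y)) eq)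
  ... | inj₂ eq = inj₂ (≡.trans (lookup-zipWith ⊔._⊔_ i (value x) (value y)) eq)

  ∨-!-cancel : ∀ x y {z i} → x ∨ y ≡ z → x ! i ≢ z ! i → y ! i ≡ z ! i
  ∨-!-cancel x y {z} {i} eq neq with ∨-! x y i
  ... | inj₁ e = contradiction (≡.trans (≡.sym e) (≡.cong (_! i) eq)) neq
  ... | inj₂ e = ≡.trans (≡.sym e) (≡.cong (_! i) eq)

  𝔞≤ : ∀ x j → (∀ k → k Fin.≤ j → x ! k ≢ 0F) → 𝔞ᵗ j ≤ x
  𝔞≤ x j x≢0 k with k Fin.≤? j
  ... | yes k≤j = ≡.subst (Fin._≤ x ! k) (≡.sym (𝔞-! j k≤j)) (1F≤ (x≢0 k k≤j))
  ... | no k≰j  = ≡.subst (Fin._≤ x ! k) (≡.sym (𝔞-!-> j (ℕ.≰⇒> k≰j))) z≤n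

  ≤𝔞 : ∀ x j → 𝔞ᵗ j ≤ x → ∀ k → k Fin.≤ j → x ! k ≢ 0F
  ≤𝔞 x j a≤x k k≤j = 1F≤⇒≢0F (≡.subst (Fin._≤ x ! k) (𝔞-! j k≤j) (a≤x k))

  -- By (T3) a 1 in position `j` forces every earlier entry to be nonzero.
  𝔞≤-1 : ∀ x {j} → x ! j ≡ 1F → 𝔞ᵗ j ≤ x
  𝔞≤-1 x {j} xj≡1 = 𝔞≤ x j (λ k → before-1 (value x) (proj₂ (triword x)) xj≡1)

  find-< : ∀ {x y} → x < y → ∃[ i ] x ! i Fin.< y ! i
  find-< {x} {y} (x≤y , x≢y)
    with i , yi≰xi ← Fin.¬∀⟶∃¬ n (λ i → y ! i Fin.≤ x ! i) (λ i → y ! i Fin.≤? x ! i)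
           (λ y≤x → x≢y (antisym {x} {y} x≤y y≤x))
    = i , ℕ.≰⇒> yi≰xi

  -- A triword between `x` and `y` agrees with both off `i`, so only its entry at `i` is open. The
  -- condition `sel` speaks of triwords rather than letters because (T3) can exclude the letter 1,
  -- and then 0 and 2 are neighbours.
  ⋖-local : ∀ {x y} i → (∀ j → j ≢ i → x ! j ≡ y ! j) → x ! i Fin.< y ! i →
            (∀ z → x ≤ z → z ≤ y → z ! i ≡ x ! i ⊎ z ! i ≡ y ! i) → x ⋖ y
  ⋖-local {x} {y} i off xi<yi sel = (x≤y , x≢y) , between
    where
    x≤y : x ≤ y
    x≤y j with j Fin.≟ i
    ... | yes ≡.refl = ℕ.<⇒≤ xi<yi
    ... | no j≢i     = ℕ.≤-reflexive (≡.cong toℕ (off j j≢i))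

    x≢y : x ≢ y
    x≢y eq = ℕ.<-irrefl (≡.cong (λ u → toℕ (u ! i)) eq) xi<yi

    between : ∀ z → ¬ (x < z × z < y)
    between z ((x≤z , x≢z) , z≤y , z≢y) with sel z x≤z z≤y
    ... | inj₁ zi≡xi = x≢z (antisym x≤z z≤x)
      where
      z≤x : z ≤ x
      z≤x j with j Fin.≟ i
      ... | yes ≡.refl = ℕ.≤-reflexive (≡.cong toℕ zi≡xi)
      ... | no j≢i     = ≡.subst (z ! j Fin.≤_) (≡.sym (off j j≢i)) (z≤y j)
    ... | inj₂ zi≡yi = z≢y (antisym z≤y y≤z)
      where
      y≤z : y ≤ z
      y≤z j with j Fin.≟ i
      ... | yes ≡.refl = ℕ.≤-reflexive (≡.cong toℕ (≡.sym zi≡yi))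
      ... | no j≢i     = ≡.subst (Fin._≤ z ! j) (off j j≢i) (x≤z j)

  -- The last two hypotheses are what (T3) demands of the entries after a new 0 and before a new 1;
  -- excluding the letter 2 preserves (T2).
  update : (x : Tri n) (i : Fin n) (k : Fin 3) → k ≢ 2F → (k ≡ 0F → ∀ q → i Fin.< q → x ! q ≢ 1F) →
           (k ≡ 1F → ∀ p → p Fin.< i → x ! p ≢ 0F) → Tri n
  update x i k k≢2 after before = value x [ i ]≔ k , Irrelevant.[ first , ones ]
    where
    first : ∀ j → toℕ j ≡ 0 → lookup (value x [ i ]≔ k) j ≢ 2F
    first j j≡0 eq with j Fin.≟ i
    ... | yes ≡.refl = k≢2 (≡.trans (≡.sym (lookup∘update i (value x) k)) eq)
    ... | no j≢i     = proj₁ (triword x) j j≡0 (≡.trans (≡.sym (lookup∘update′ j≢i (value x) k)) eq)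

    ones : OnesBeforeZeros (value x [ i ]≔ k)
    ones p q p<q p≡0 q≡1 with p Fin.≟ i | q Fin.≟ i
    ... | yes ≡.refl | yes ≡.refl = ℕ.<-irrefl ≡.refl p<q
    ... | yes ≡.refl | no q≢i     = after (≡.trans (≡.sym (lookup∘update i (value x) k)) p≡0) q p<q
      (≡.trans (≡.sym (lookup∘update′ q≢i (value x) k)) q≡1)
    ... | no p≢i     | yes ≡.refl = before (≡.trans (≡.sym (lookup∘update i (value x) k)) q≡1) p p<q
      (≡.trans (≡.sym (lookup∘update′ p≢i (value x) k)) p≡0)
    ... | no p≢i     | no q≢i     = proj₂ (triword x) p q p<q
      (≡.trans (≡.sym (lookup∘update′ p≢i (value x) k)) p≡0)
      (≡.trans (≡.sym (lookup∘update′ q≢i (value x) k)) q≡1)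

  -- Only the entry `i` is lowered: to 0 if some 0 precedes it, to 1 otherwise. In the first case
  -- (T3) forbids a 1 at `i` in every triword below `x`, so going from 2 straight to 0 is still a
  -- cover.
  lower-2 : ∀ x i → x ! i ≡ 2F → ∃[ y ] y ⋖ x × y ! i ≢ 2F
  lower-2 x i xi≡2 with Fin.any? (λ p → (p Fin.<? i) ×-dec (x ! p Fin.≟ 0F))
  ... | yes (p , p<i , xp≡0) = y , ⋖-local i (λ j j≢i → lookup∘update′ j≢i (value x) 0F) yi<xi sel ,
      λ eq → contradiction (≡.trans (≡.sym yi≡0) eq) λ ()
    where
    y : Tri n
    y = update x i 0F (λ ()) (λ _ q i<q → proj₂ (triword x) p q (ℕ.<-trans p<i i<q) xp≡0) (λ ())
    yi≡0 : y ! i ≡ 0F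
    yi≡0 = lookup∘update i (value x) 0F
    yi<xi : y ! i Fin.< x ! i
    yi<xi rewrite yi≡0 | xi≡2 = s≤s z≤n
    sel : ∀ z → y ≤ z → z ≤ x → z ! i ≡ y ! i ⊎ z ! i ≡ x ! i
    sel z _ z≤x with z ! i in eq
    ... | 0F = inj₁ (≡.sym yi≡0)
    ... | 1F = contradiction eq (proj₂ (triword z) p i p<i (≤0F (≡.subst (z ! p Fin.≤_) xp≡0 (z≤x p))))
    ... | 2F = inj₂ (≡.sym xi≡2)
  ... | no none = y , ⋖-local i (λ j j≢i → lookup∘update′ j≢i (value x) 1F) yi<xi sel ,
      λ eq → contradiction (≡.trans (≡.sym yi≡1) eq) λ ()
    where
    y : Tri n
    y = update x i 1F (λ ()) (λ ()) (λ _ p p<i xp≡0 → none (p , p<i , xp≡0))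
    yi≡1 : y ! i ≡ 1F
    yi≡1 = lookup∘update i (value x) 1F
    yi<xi : y ! i Fin.< x ! i
    yi<xi rewrite yi≡1 | xi≡2 = s≤s (s≤s z≤n)
    sel : ∀ z → y ≤ z → z ≤ x → z ! i ≡ y ! i ⊎ z ! i ≡ x ! i
    sel z y≤z _ with z ! i | ≡.subst (Fin._≤ z ! i) yi≡1 (y≤z i)
    ... | 1F | _ = inj₁ (≡.sym yi≡1)
    ... | 2F | _ = inj₂ (≡.sym xi≡2)

  module _ (x : Tri n) {j : Fin n} (live : Live (value x) j) where

    -- Liveness permits both letters at `j`: a 0 because no 1 follows, a 1 because no 0 precedes.
    -- The cover formed by the two words carries the label 𝔞⁽ʲ⁺¹⁾.
    live-0 live-1 : Tri n
    live-0 = update x j 0F (λ ()) (λ _ → proj₂ live) (λ ())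
    live-1 = update x j 1F (λ ()) (λ ()) (λ _ p p<j → proj₁ live p (ℕ.<⇒≤ p<j))

    live-0-! : live-0 ! j ≡ 0F
    live-0-! = lookup∘update j (value x) 0F

    live-1-! : live-1 ! j ≡ 1F
    live-1-! = lookup∘update j (value x) 1F

    live-0-!-≢ : ∀ {k} → k ≢ j → live-0 ! k ≡ x ! k
    live-0-!-≢ k≢j = lookup∘update′ k≢j (value x) 0F

    live-1-!-≢ : ∀ {k} → k ≢ j → live-1 ! k ≡ x ! k
    live-1-!-≢ k≢j = lookup∘update′ k≢j (value x) 1F

    live-0⋖live-1 : live-0 ⋖ live-1
    live-0⋖live-1 = ⋖-local j (λ k k≢j → ≡.trans (live-0-!-≢ k≢j) (≡.sym (live-1-!-≢ k≢j))) 0<1 sel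
      where
      0<1 : live-0 ! j Fin.< live-1 ! j
      0<1 rewrite live-0-! | live-1-! = s≤s z≤n
      sel : ∀ z → live-0 ≤ z → z ≤ live-1 → z ! j ≡ live-0 ! j ⊎ z ! j ≡ live-1 ! j
      sel z _ z≤ with z ! j | ≡.subst (z ! j Fin.≤_) live-1-! (z≤ j)
      ... | 0F | _      = inj₁ (≡.sym live-0-!)
      ... | 1F | _      = inj₂ (≡.sym live-1-!)
      ... | 2F | s≤s ()

    live-1≤ : live-1 ≤ x
    live-1≤ k with k Fin.≟ j
    ... | yes ≡.refl = ≡.subst (Fin._≤ x ! j) (≡.sym live-1-!) (1F≤ (proj₁ live j ℕ.≤-refl))
    ... | no k≢j     = ℕ.≤-reflexive (≡.cong toℕ (live-1-!-≢ k≢j))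

    live-1≡ : x ! j ≡ 1F → live-1 ≡ x
    live-1≡ xj≡1 = antisym live-1≤ x≤
      where
      x≤ : x ≤ live-1
      x≤ k with k Fin.≟ j
      ... | yes ≡.refl = ℕ.≤-reflexive (≡.cong toℕ (≡.trans xj≡1 (≡.sym live-1-!)))
      ... | no k≢j     = ℕ.≤-reflexive (≡.cong toℕ (≡.sym (live-1-!-≢ k≢j)))

  nucleus-last-1 : ∀ x {j} → Live (value x) j → x ! j ≡ 1F → nucleus x ! j ≡ 0F
  nucleus-last-1 x {j} live xj≡1 = ≤0F (≡.subst (nucleus x ! j Fin.≤_) (live-0-! x live)
    (nucleus-⋖ (≡.subst (live-0 x live ⋖_) (live-1≡ x live xj≡1) (live-0⋖live-1 x live)) j))

  -- A 2 at `j` is lowered in some lower cover, so the nucleus has no 2 there. If `x` has a 2 at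
  -- `j`, its last 1 lies before `j`; it exists because the first entry is neither 0 nor 2. A lower
  -- cover deletes that 1, and then (T3) forbids the nucleus a 1 at `j`.
  nucleus-live : ∀ x {j} → Live (value x) j → nucleus x ! j ≡ 0F
  nucleus-live x {j} live with nucleus x ! j in eq
  ... | 0F = ≡.refl
  ... | 2F with y , y⋖x , yj≢2 ← lower-2 x j (2F≤ (≡.subst (Fin._≤ x ! j) eq (nucleus-≤ x j)))
      = contradiction (2F≤ (≡.subst (Fin._≤ y ! j) eq (nucleus-⋖ y⋖x j))) yj≢2
  ... | 1F with x ! j Fin.≟ 1F
  ...   | yes xj≡1 = contradiction (≡.trans (≡.sym eq) (nucleus-last-1 x live xj≡1)) λ ()
  ...   | no xj≢1 with last-1 (value x)
  ...     | inj₁ none = contradiction (fin3 (proj₁ live (first j) z≤j) (none (first j)))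
                          (proj₁ (triword x) (first j) (first≡0 j))
    where
    first : ∀ {n} → Fin n → Fin n
    first zero    = zero
    first (suc _) = zero
    first≡0 : ∀ {n} (j : Fin n) → toℕ (first j) ≡ 0
    first≡0 zero    = ≡.refl
    first≡0 (suc _) = ≡.refl
    z≤j : first j Fin.≤ j
    z≤j = ≡.subst (ℕ._≤ toℕ j) (≡.sym (first≡0 j)) z≤n
  ...     | inj₂ (l , xl≡1 , after) with l Fin.<? j
  ...       | no l≮j  = contradiction xl≡1 (l≢1 (ℕ.≮⇒≥ l≮j))
    where
    l≢1 : j Fin.≤ l → x ! l ≢ 1F
    l≢1 j≤l xl≡1 with j Fin.≟ l
    ... | yes ≡.refl = xj≢1 xl≡1
    ... | no j≢l     = proj₂ live l (Fin.≤∧≢⇒< j≤l j≢l) xl≡1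
  ...       | yes l<j = contradiction eq (proj₂ (triword (nucleus x)) l j l<j
    (nucleus-last-1 x (last-1-live (value x) (proj₂ (triword x)) xl≡1 after) xl≡1))

  -- The cover `live-0 ⋖ live-1` lies above the nucleus, which has a 0 at `j`. Its label is least
  -- because any `d` with `live-0 ∨ d ≡ live-1` must itself supply the 1 at `j`.
  Ψ-𝔞 : ∀ x {j} → Live (value x) j → Ψ x (𝔞ᵗ j)
  Ψ-𝔞 x {j} live = live-0 x live , live-1 x live , nucleus≤ , live-0⋖live-1 x live , live-1≤ x live ,
    ⋖-∨ (live-0 x live) (live-1 x live) (𝔞ᵗ j) (live-0⋖live-1 x live) (𝔞≤-1 (live-1 x live) (live-1-! x live))
        (λ a≤ → ≤𝔞 (live-0 x live) j a≤ j ℕ.≤-refl (live-0-! x live)) ,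
    λ d eq → 𝔞≤-1 d (≡.trans (∨-!-cancel (live-0 x live) d eq
      (λ e → contradiction (≡.trans (≡.sym (live-0-! x live)) (≡.trans e (live-1-! x live))) λ ()))
      (live-1-! x live))
    where
    nucleus≤ : nucleus x ≤ live-0 x live
    nucleus≤ k with k Fin.≟ j
    ... | yes ≡.refl = ℕ.≤-reflexive (≡.cong toℕ (≡.trans (nucleus-live x live) (≡.sym (live-0-! x live))))
    ... | no k≢j     = ≡.subst (nucleus x ! k Fin.≤_) (≡.sym (live-0-!-≢ x live k≢j)) (nucleus-≤ x k)

module _ {N : ℕ} where
  open FiniteLattice (Hoch (suc N))
  open IsBoundedLattice isBoundedLattice using () renaming (trans to ≤-trans)
  open Nucleus (Hoch (suc N))
  open CoreLabelOrder (Hoch (suc N))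

  𝔟≤ : ∀ x {k} → x ! suc k ≡ 2F → 𝔟ᵗ k ≤ x
  𝔟≤ x {k} xk≡2 i with i Fin.≟ suc k
  ... | yes ≡.refl = ℕ.≤-reflexive (≡.cong toℕ (≡.trans (𝔟-! k) (≡.sym xk≡2)))
  ... | no i≢k     = ≡.subst (Fin._≤ x ! i) (≡.sym (𝔟-!-≢ k i≢k)) z≤n

  ≤𝔟 : ∀ x {k} → 𝔟ᵗ k ≤ x → x ! suc k ≡ 2F
  ≤𝔟 x {k} b≤x = 2F≤ (≡.subst (Fin._≤ x ! suc k) (𝔟-! k) (b≤x (suc k)))

  Ψ-𝔟 : ∀ x {k} → x ! suc k ≡ 2F → Ψ x (𝔟ᵗ k)
  Ψ-𝔟 x {k} xk≡2 with y , y⋖x , yk≢2 ← lower-2 x (suc k) xk≡2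
    = y , x , nucleus-⋖ y⋖x , y⋖x , (λ _ → ℕ.≤-refl) ,
      ⋖-∨ y x (𝔟ᵗ k) y⋖x (𝔟≤ x xk≡2) (yk≢2 ∘ ≤𝔟 y) ,
      λ d eq → 𝔟≤ d (≡.trans (∨-!-cancel y d eq (λ e → yk≢2 (≡.trans e xk≡2))) xk≡2)

  -- At a position where `y` is smaller than `y′`, a 2 of `y′` yields a 𝔟 and a 1 yields an 𝔞 that
  -- is below `y′` but not below `y`. By `⋖-∨` it is a candidate for the label; conversely `c` has
  -- to supply that entry, hence lies above it.
  Ψ-elim : ∀ {x c} → Ψ x c →
           (∃[ k ] c ≡ 𝔟ᵗ k × x ! suc k ≡ 2F) ⊎ (∃[ j ] c ≡ 𝔞ᵗ j × Live (value x) j)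
  Ψ-elim {x} {c} (y , y′ , nucleus≤y , y⋖y′ , y′≤x , y∨c≡y′ , least) = cases (find-< (proj₁ y⋖y′))
    where
    cases : ∃[ i ] y ! i Fin.< y′ ! i →
            (∃[ k ] c ≡ 𝔟ᵗ k × x ! suc k ≡ 2F) ⊎ (∃[ j ] c ≡ 𝔞ᵗ j × Live (value x) j)
    cases (i , yi<) with y′ ! i in eq
    cases (zero , yi<)  | 2F = contradiction eq (proj₁ (triword y′) zero ≡.refl)
    cases (suc k , yi<) | 2F = inj₁ (k , antisym c≤b b≤c ,
        2F≤ (≡.subst (Fin._≤ x ! suc k) eq (y′≤x (suc k))))
      where
      yk≢2 : y ! suc k ≢ 2F
      yk≢2 e = ℕ.<-irrefl (≡.cong toℕ e) yi<
      c≤b : c ≤ 𝔟ᵗ k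
      c≤b = least (𝔟ᵗ k) (⋖-∨ y y′ (𝔟ᵗ k) y⋖y′ (𝔟≤ y′ eq) (yk≢2 ∘ ≤𝔟 y))
      b≤c : 𝔟ᵗ k ≤ c
      b≤c = 𝔟≤ c (≡.trans (∨-!-cancel y c y∨c≡y′ (λ e → yk≢2 (≡.trans e eq))) eq)
    cases (j , yj<) | 1F = inj₂ (j , antisym c≤a a≤c ,
        (λ k k≤j xk≡0 → ≤𝔞 y′ j a≤y′ k k≤j (≤0F (≡.subst (y′ ! k Fin.≤_) xk≡0 (y′≤x k)))) ,
        (λ k j<k xk≡1 → ≤𝔞 y j (≤-trans {𝔞ᵗ j} {nucleus x} {y} (a≤nucleus k j<k xk≡1) nucleus≤y)
          j ℕ.≤-refl yj≡0))
      where
      yj≡0 : y ! j ≡ 0F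
      yj≡0 = ≤0F (ℕ.≤-pred yj<)
      a≤y′ : 𝔞ᵗ j ≤ y′
      a≤y′ = 𝔞≤-1 y′ eq
      c≤a : c ≤ 𝔞ᵗ j
      c≤a = least (𝔞ᵗ j) (⋖-∨ y y′ (𝔞ᵗ j) y⋖y′ a≤y′ (λ a≤y → ≤𝔞 y j a≤y j ℕ.≤-refl yj≡0))
      a≤c : 𝔞ᵗ j ≤ c
      a≤c = 𝔞≤-1 c (≡.trans
        (∨-!-cancel y c y∨c≡y′ (λ e → contradiction (≡.trans (≡.sym yj≡0) (≡.trans e eq)) λ ())) eq)
      -- A lower cover `z` of `x` not above `𝔞ᵗ j` would satisfy `z ∨ 𝔞ᵗ j ≡ x` and thus supply the
      -- 1 at `k` itself; then (T3) puts it above `𝔞ᵗ j` after all. So a 1 to the right of `j` would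
      -- put `𝔞ᵗ j` below the nucleus and hence below `y`, where the entry `j` is 0.
      a≤nucleus : ∀ k → j Fin.< k → x ! k ≡ 1F → 𝔞ᵗ j ≤ nucleus x
      a≤nucleus k j<k xk≡1 = nucleus-greatest {x} {𝔞ᵗ j} a≤x (λ z z⋖x → below z z⋖x (𝔞ᵗ j ≤? z))
        where
        a≤x : 𝔞ᵗ j ≤ x
        a≤x = ≤-trans {𝔞ᵗ j} {y′} {x} a≤y′ y′≤x
        zk≡1 : ∀ z → z ∨ 𝔞ᵗ j ≡ x → (z ∨ 𝔞ᵗ j) ! k ≡ z ! k ⊎ (z ∨ 𝔞ᵗ j) ! k ≡ 𝔞ᵗ j ! k → z ! k ≡ 1F
        zk≡1 z eq (inj₁ e) = ≡.trans (≡.sym e) (≡.trans (≡.cong (_! k) eq) xk≡1)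
        zk≡1 z eq (inj₂ e) = contradiction
          (≡.trans (≡.sym (𝔞-!-> j j<k)) (≡.trans (≡.sym e) (≡.trans (≡.cong (_! k) eq) xk≡1))) λ ()
        below : ∀ z → z ⋖ x → Dec (𝔞ᵗ j ≤ z) → 𝔞ᵗ j ≤ z
        below z z⋖x (yes a≤z) = a≤z
        below z z⋖x (no a≰z)  = 𝔞≤ z j (λ l l≤j → before-1 (value z) (proj₂ (triword z))
          (zk≡1 z (⋖-∨ z x (𝔞ᵗ j) z⋖x a≤x a≰z) (∨-! z (𝔞ᵗ j) k)) (ℕ.≤-trans l≤j (ℕ.<⇒≤ j<k)))

  ⊑⇒twos : ∀ {u v} → u ⊑ v → ∀ i → u ! i ≡ 2F → v ! i ≡ 2F
  ⊑⇒twos {u} {v} u⊑v zero    eq = contradiction eq (proj₁ (triword u) zero ≡.refl)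
  ⊑⇒twos {u} {v} u⊑v (suc k) eq = cases (Ψ-elim {v} {𝔟ᵗ k} (u⊑v {𝔟ᵗ k} (Ψ-𝔟 u {k} eq)))
    where
    cases : (∃[ l ] 𝔟ᵗ k ≡ 𝔟ᵗ l × v ! suc l ≡ 2F) ⊎ (∃[ j ] 𝔟ᵗ k ≡ 𝔞ᵗ j × Live (value v) j) →
            v ! suc k ≡ 2F
    cases (inj₁ (l , b≡b , vl≡2)) = ≡.subst (λ l → v ! suc l ≡ 2F) (≡.sym (𝔟ᵗ-injective k l b≡b)) vl≡2
    cases (inj₂ (j , b≡a , _))    = contradiction (≡.sym b≡a) (𝔞≢𝔟 j k)

  ⊑⇒live : ∀ {u v} → u ⊑ v → ∀ j → Live (value u) j → Live (value v) j
  ⊑⇒live {u} {v} u⊑v j live = cases (Ψ-elim {v} {𝔞ᵗ j} (u⊑v {𝔞ᵗ j} (Ψ-𝔞 u live)))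
    where
    cases : (∃[ k ] 𝔞ᵗ j ≡ 𝔟ᵗ k × v ! suc k ≡ 2F) ⊎ (∃[ l ] 𝔞ᵗ j ≡ 𝔞ᵗ l × Live (value v) l) →
            Live (value v) j
    cases (inj₁ (k , a≡b , _))     = contradiction a≡b (𝔞≢𝔟 j k)
    cases (inj₂ (l , a≡a , live′)) = ≡.subst (Live (value v)) (≡.sym (𝔞ᵗ-injective j l a≡a)) live′

  twos∧live⇒⊑ : ∀ {u v} → (∀ i → u ! i ≡ 2F → v ! i ≡ 2F) →
                (∀ j → Live (value u) j → Live (value v) j) → u ⊑ v
  twos∧live⇒⊑ {u} {v} twos lives {c} Ψuc = cases (Ψ-elim {u} {c} Ψuc)
    where
    cases : (∃[ k ] c ≡ 𝔟ᵗ k × u ! suc k ≡ 2F) ⊎ (∃[ j ] c ≡ 𝔞ᵗ j × Live (value u) j) → Ψ v c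
    cases (inj₁ (k , c≡b , uk≡2)) = ≡.subst (Ψ v) (≡.sym c≡b) (Ψ-𝔟 v {k} (twos (suc k) uk≡2))
    cases (inj₂ (j , c≡a , live)) = ≡.subst (Ψ v) (≡.sym c≡a) (Ψ-𝔞 v {j} (lives j live))

-- The core label order, letter by letter

NoOnes : Word n → Set
NoOnes w = ∀ k → lookup w k ≢ 1F

Twos⊆ : Word n → Word n → Set
Twos⊆ u v = ∀ i → lookup u i ≡ 2F → lookup v i ≡ 2F

Live⊆ : Word n → Word n → Set
Live⊆ u v = ∀ j → Live u j → Live v j

twos : Word n → ℕ
twos []       = 0
twos (0F ∷ w) = twos w
twos (1F ∷ w) = twos w
twos (2F ∷ w) = suc (twos w)

-- On a word whose ones precede its zeros it suffices to look in front of the first zero.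
noOnes : Word n → Bool
noOnes []       = true
noOnes (0F ∷ _) = true
noOnes (1F ∷ _) = false
noOnes (2F ∷ w) = noOnes w

-- Reading a pair of triwords u ⊑ v from left to right: dead⊑ describes what follows
-- once a 0 has occurred in u, live⊑ what follows while no 0 has occurred in u or v.
dead⊑ : Word n → Word n → Bool
dead⊑ []       []       = true
dead⊑ (0F ∷ u) (_ ∷ v)  = dead⊑ u v
dead⊑ (1F ∷ _) (_ ∷ _)  = false
dead⊑ (2F ∷ _) (0F ∷ _) = false
dead⊑ (2F ∷ _) (1F ∷ _) = false
dead⊑ (2F ∷ u) (2F ∷ v) = dead⊑ u v

live⊑ : Word n → Word n → Bool
live⊑ []       []       = true
live⊑ (0F ∷ u) (0F ∷ v) = dead⊑ u v
live⊑ (0F ∷ _) (1F ∷ _) = false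
-- The position just before this 0 is live in the first word; it is live in the second one only if
-- no 1 follows in `v`.
live⊑ (0F ∷ u) (2F ∷ v) = noOnes v ∧ dead⊑ u v
live⊑ (1F ∷ _) (0F ∷ _) = false
live⊑ (1F ∷ u) (1F ∷ v) = live⊑ u v
live⊑ (1F ∷ u) (2F ∷ v) = live⊑ u v
live⊑ (2F ∷ _) (0F ∷ _) = false
live⊑ (2F ∷ _) (1F ∷ _) = false
live⊑ (2F ∷ u) (2F ∷ v) = live⊑ u v

word⊑ : Word n → Word n → Bool
word⊑ []       []       = true
word⊑ (0F ∷ u) (_ ∷ v)  = dead⊑ u v
word⊑ (1F ∷ _) (0F ∷ _) = false
word⊑ (1F ∷ u) (1F ∷ v) = live⊑ u v
word⊑ (1F ∷ _) (2F ∷ _) = false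
word⊑ (2F ∷ _) (_ ∷ _)  = false

isDead isLive isTri : Word n → Bool
isDead []       = true
isDead (0F ∷ w) = isDead w
isDead (1F ∷ _) = false
isDead (2F ∷ w) = isDead w

isLive []       = true
isLive (0F ∷ w) = isDead w
isLive (1F ∷ w) = isLive w
isLive (2F ∷ w) = isLive w

isTri []       = true
isTri (0F ∷ w) = isDead w
isTri (1F ∷ w) = isLive w
isTri (2F ∷ _) = false

rk : Word n → ℕ
rk []       = 0
rk (0F ∷ w) = twos w
rk (1F ∷ w) = suc (twos w)
rk (2F ∷ w) = 0

ones-tail : ∀ {k} (w : Word n) → OnesBeforeZeros (k ∷ w) → OnesBeforeZeros w
ones-tail w ones i j i<j = ones (suc i) (suc j) (s<s i<j)

ones-0∷ : (w : Word n) → OnesBeforeZeros (0F ∷ w) → NoOnes w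
ones-0∷ w ones k = ones zero (suc k) z<s ≡.refl

noOnes⇒ones : (w : Word n) → NoOnes w → OnesBeforeZeros w
noOnes⇒ones w none _ j _ _ = none j

ones-∷ : ∀ {k} (w : Word n) → (k ≡ 0F → NoOnes w) → OnesBeforeZeros w → OnesBeforeZeros (k ∷ w)
ones-∷ w none ones zero    (suc j) _         = λ k≡0 → none k≡0 j
ones-∷ w none ones (suc i) (suc j) (s<s i<j) = ones i j i<j

isDead-sound : (w : Word n) → T (isDead w) → NoOnes w
isDead-sound (0F ∷ w) d zero    ()
isDead-sound (0F ∷ w) d (suc i) = isDead-sound w d i
isDead-sound (2F ∷ w) d zero    ()
isDead-sound (2F ∷ w) d (suc i) = isDead-sound w d i

isDead-complete : (w : Word n) → NoOnes w → T (isDead w)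
isDead-complete []       _    = tt
isDead-complete (0F ∷ w) none = isDead-complete w (none ∘ suc)
isDead-complete (1F ∷ w) none = ⊥-elim (none zero ≡.refl)
isDead-complete (2F ∷ w) none = isDead-complete w (none ∘ suc)

isLive-sound : (w : Word n) → T (isLive w) → OnesBeforeZeros w
isLive-sound []       l = λ ()
isLive-sound (0F ∷ w) l =
  ones-∷ w (λ _ → isDead-sound w l) (noOnes⇒ones w (isDead-sound w l))
isLive-sound (1F ∷ w) l = ones-∷ w (λ ()) (isLive-sound w l)
isLive-sound (2F ∷ w) l = ones-∷ w (λ ()) (isLive-sound w l)

isLive-complete : (w : Word n) → OnesBeforeZeros w → T (isLive w)
isLive-complete []       _    = tt
isLive-complete (0F ∷ w) ones = isDead-complete w (ones-0∷ w ones)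
isLive-complete (1F ∷ w) ones = isLive-complete w (ones-tail w ones)
isLive-complete (2F ∷ w) ones = isLive-complete w (ones-tail w ones)

isTri-sound : (w : Word n) → T (isTri w) → IsTriword w
isTri-sound []       t = (λ ()) , (λ ())
isTri-sound (0F ∷ w) t = (λ { zero _ () ; (suc _) () }) , isLive-sound (0F ∷ w) t
isTri-sound (1F ∷ w) t = (λ { zero _ () ; (suc _) () }) , isLive-sound (1F ∷ w) t
isTri-sound (2F ∷ w) ()

isTri-complete : (w : Word n) → IsTriword w → T (isTri w)
isTri-complete []       _        = tt
isTri-complete (0F ∷ w) (_ , os) = isLive-complete (0F ∷ w) os
isTri-complete (1F ∷ w) (_ , os) = isLive-complete (1F ∷ w) os
isTri-complete (2F ∷ w) (f , _)  = ⊥-elim (f zero ≡.refl ≡.refl)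

noOnes-sound : (w : Word n) → OnesBeforeZeros w → T (noOnes w) → NoOnes w
noOnes-sound (0F ∷ w) ones _ zero    ()
noOnes-sound (0F ∷ w) ones _ (suc i) = ones-0∷ w ones i
noOnes-sound (2F ∷ w) ones t zero    ()
noOnes-sound (2F ∷ w) ones t (suc i) = noOnes-sound w (ones-tail w ones) t i

noOnes-complete : (w : Word n) → NoOnes w → T (noOnes w)
noOnes-complete []       _    = tt
noOnes-complete (0F ∷ w) _    = tt
noOnes-complete (1F ∷ w) none = ⊥-elim (none zero ≡.refl)
noOnes-complete (2F ∷ w) none = noOnes-complete w (none ∘ suc)

noOnes-∷ : ∀ {k} {w : Word n} → k ≢ 1F → NoOnes w → NoOnes (k ∷ w)
noOnes-∷ k≢1 none zero    = k≢1
noOnes-∷ k≢1 none (suc i) = none i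

live-zero : ∀ {k} (w : Word n) → k ≢ 0F → NoOnes w → Live (k ∷ w) zero
live-zero w k≢0 none = (λ { zero _ → k≢0 ; (suc _) () }) , (λ { (suc i) _ → none i })

live-zero⁻¹ : ∀ {k} (w : Word n) → Live (k ∷ w) zero → NoOnes w
live-zero⁻¹ w (_ , after) i = after (suc i) z<s

live-suc : ∀ {k} (w : Word n) j → k ≢ 0F → Live w j → Live (k ∷ w) (suc j)
live-suc w j k≢0 (before , after) =
  (λ { zero _ → k≢0 ; (suc i) (s≤s i≤j) → before i i≤j }) , (λ { (suc i) (s<s j<i) → after i j<i })

live-suc⁻¹ : ∀ {k} (w : Word n) j → Live (k ∷ w) (suc j) → Live w j
live-suc⁻¹ w j (before , after) =
  (λ i i≤j → before (suc i) (s≤s i≤j)) , (λ i j<i → after (suc i) (s<s j<i))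

¬live-0∷ : ∀ (w : Word n) j → ¬ Live (0F ∷ w) j
¬live-0∷ w j (before , _) = before zero z≤n ≡.refl

live-head : ∀ {k l} (w : Word n) j → l ≢ 0F → Live (k ∷ w) j → Live (l ∷ w) j
live-head w zero    l≢0 live = live-zero w l≢0 (live-zero⁻¹ w live)
live-head w (suc j) l≢0 live = live-suc w j l≢0 (live-suc⁻¹ w j live)

exists-live : ∀ (w : Word n) → OnesBeforeZeros w → ∃[ j ] Live (1F ∷ w) j
exists-live w ones with last-1 (1F ∷ w)
... | inj₁ none            = ⊥-elim (none zero ≡.refl)
... | inj₂ (j , eq , after) = j , last-1-live (1F ∷ w) (ones-∷ w (λ ()) ones) {j} eq after

dead⊑-noOnes : ∀ (u v : Word n) → T (dead⊑ u v) → NoOnes u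
dead⊑-noOnes (0F ∷ u) (_ ∷ v)  d zero    ()
dead⊑-noOnes (0F ∷ u) (_ ∷ v)  d (suc i) = dead⊑-noOnes u v d i
dead⊑-noOnes (2F ∷ u) (2F ∷ v) d zero    ()
dead⊑-noOnes (2F ∷ u) (2F ∷ v) d (suc i) = dead⊑-noOnes u v d i

dead⊑-twos : ∀ (u v : Word n) → T (dead⊑ u v) → Twos⊆ u v
dead⊑-twos (0F ∷ u) (_ ∷ v)  d zero    ()
dead⊑-twos (0F ∷ u) (_ ∷ v)  d (suc i) = dead⊑-twos u v d i
dead⊑-twos (2F ∷ u) (2F ∷ v) d zero    = λ _ → ≡.refl
dead⊑-twos (2F ∷ u) (2F ∷ v) d (suc i) = dead⊑-twos u v d i

dead⊑-complete : ∀ (u v : Word n) → NoOnes u → Twos⊆ u v → T (dead⊑ u v)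
dead⊑-complete []       []       _    _   = tt
dead⊑-complete (0F ∷ u) (_ ∷ v)  none two = dead⊑-complete u v (none ∘ suc) (two ∘ suc)
dead⊑-complete (1F ∷ u) (_ ∷ v)  none two = ⊥-elim (none zero ≡.refl)
dead⊑-complete (2F ∷ u) (0F ∷ v) none two = contradiction (two zero ≡.refl) λ ()
dead⊑-complete (2F ∷ u) (1F ∷ v) none two = contradiction (two zero ≡.refl) λ ()
dead⊑-complete (2F ∷ u) (2F ∷ v) none two = dead⊑-complete u v (none ∘ suc) (two ∘ suc)

live⊑-ones : ∀ (u v : Word n) → T (live⊑ u v) → OnesBeforeZeros u
live⊑-ones []       []       l = λ ()
live⊑-ones (0F ∷ u) (0F ∷ v) l = ones-∷ u (λ _ → dead⊑-noOnes u v l) (noOnes⇒ones u (dead⊑-noOnes u v l))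
live⊑-ones (0F ∷ u) (2F ∷ v) l = ones-∷ u (λ _ → none) (noOnes⇒ones u none)
  where none = dead⊑-noOnes u v (proj₂ (Equivalence.to (T-∧ {noOnes v}) l))
live⊑-ones (1F ∷ u) (1F ∷ v) l = ones-∷ u (λ ()) (live⊑-ones u v l)
live⊑-ones (1F ∷ u) (2F ∷ v) l = ones-∷ u (λ ()) (live⊑-ones u v l)
live⊑-ones (2F ∷ u) (2F ∷ v) l = ones-∷ u (λ ()) (live⊑-ones u v l)

live⊑-twos : ∀ (u v : Word n) → T (live⊑ u v) → Twos⊆ u v
live⊑-twos (0F ∷ u) (0F ∷ v) l zero    ()
live⊑-twos (0F ∷ u) (0F ∷ v) l (suc i) = dead⊑-twos u v l i
live⊑-twos (0F ∷ u) (2F ∷ v) l zero    ()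
live⊑-twos (0F ∷ u) (2F ∷ v) l (suc i) = dead⊑-twos u v (proj₂ (Equivalence.to (T-∧ {noOnes v}) l)) i
live⊑-twos (1F ∷ u) (1F ∷ v) l zero    ()
live⊑-twos (1F ∷ u) (1F ∷ v) l (suc i) = live⊑-twos u v l i
live⊑-twos (1F ∷ u) (2F ∷ v) l zero    ()
live⊑-twos (1F ∷ u) (2F ∷ v) l (suc i) = live⊑-twos u v l i
live⊑-twos (2F ∷ u) (2F ∷ v) l zero    = λ _ → ≡.refl
live⊑-twos (2F ∷ u) (2F ∷ v) l (suc i) = live⊑-twos u v l i

-- The leading `1F` on both sides stands for the letters read so far, all of them nonzero; position
-- zero is the last of these. At each step `live-head` exchanges the nonzero letter now in front for
-- a new `1F`.
live⊑-live : ∀ (u v : Word n) → OnesBeforeZeros v → T (live⊑ u v) → Live⊆ (1F ∷ u) (1F ∷ v)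
live⊑-live []       []       os l zero    _    = live-zero [] (λ ()) (λ ())
live⊑-live (0F ∷ u) (0F ∷ v) os l zero    _    = live-zero (0F ∷ v) (λ ()) (noOnes-∷ (λ ()) (ones-0∷ v os))
live⊑-live (0F ∷ u) (0F ∷ v) os l (suc j) live = ⊥-elim (¬live-0∷ u j (live-suc⁻¹ (0F ∷ u) j live))
live⊑-live (0F ∷ u) (2F ∷ v) os l zero    _    = live-zero (2F ∷ v) (λ ())
  (noOnes-∷ (λ ()) (noOnes-sound v (ones-tail v os) (proj₁ (Equivalence.to T-∧ l))))
live⊑-live (0F ∷ u) (2F ∷ v) os l (suc j) live = ⊥-elim (¬live-0∷ u j (live-suc⁻¹ (0F ∷ u) j live))
live⊑-live (1F ∷ u) (1F ∷ v) os l zero    live = ⊥-elim (live-zero⁻¹ (1F ∷ u) live zero ≡.refl)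
live⊑-live (1F ∷ u) (1F ∷ v) os l (suc j) live = live-suc (1F ∷ v) j (λ ())
  (live⊑-live u v (ones-tail v os) l j (live-suc⁻¹ (1F ∷ u) j live))
live⊑-live (1F ∷ u) (2F ∷ v) os l zero    live = ⊥-elim (live-zero⁻¹ (1F ∷ u) live zero ≡.refl)
live⊑-live (1F ∷ u) (2F ∷ v) os l (suc j) live = live-suc (2F ∷ v) j (λ ())
  (live-head v j (λ ()) (live⊑-live u v (ones-tail v os) l j (live-suc⁻¹ (1F ∷ u) j live)))
live⊑-live (2F ∷ u) (2F ∷ v) os l zero    live = live-zero (2F ∷ v) (λ ()) (noOnes-∷ (λ ())
  (live-zero⁻¹ v (live⊑-live u v (ones-tail v os) l zero
    (live-zero u (λ ()) (live-zero⁻¹ (2F ∷ u) live ∘ suc)))))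
live⊑-live (2F ∷ u) (2F ∷ v) os l (suc j) live = live-suc (2F ∷ v) j (λ ())
  (live-head v j (λ ()) (live⊑-live u v (ones-tail v os) l j
    (live-head u j (λ ()) (live-suc⁻¹ (2F ∷ u) j live))))

-- Each value `false` is refuted by a missing 2 or a missing live position: the last position read
-- for `0F` against `1F`, and the last 1 of the first word for `1F` against `0F`.
live⊑-complete : ∀ (u v : Word n) → OnesBeforeZeros u → Twos⊆ u v → Live⊆ (1F ∷ u) (1F ∷ v) → T (live⊑ u v)
live⊑-complete []       []       os two lives = tt
live⊑-complete (0F ∷ u) (0F ∷ v) os two lives = dead⊑-complete u v (ones-0∷ u os) (two ∘ suc)
live⊑-complete (0F ∷ u) (1F ∷ v) os two lives = ⊥-elim (live-zero⁻¹ (1F ∷ v)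
  (lives zero (live-zero (0F ∷ u) (λ ()) (noOnes-∷ (λ ()) (ones-0∷ u os)))) zero ≡.refl)
live⊑-complete (0F ∷ u) (2F ∷ v) os two lives = Equivalence.from T-∧
  ( noOnes-complete v (live-zero⁻¹ (2F ∷ v)
      (lives zero (live-zero (0F ∷ u) (λ ()) (noOnes-∷ (λ ()) (ones-0∷ u os)))) ∘ suc)
  , dead⊑-complete u v (ones-0∷ u os) (two ∘ suc))
live⊑-complete (1F ∷ u) (0F ∷ v) os two lives with j , live ← exists-live u (ones-tail u os) =
  ⊥-elim (¬live-0∷ v j (live-suc⁻¹ (0F ∷ v) j (lives (suc j) (live-suc (1F ∷ u) j (λ ()) live))))
live⊑-complete (1F ∷ u) (1F ∷ v) os two lives = live⊑-complete u v (ones-tail u os) (two ∘ suc)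
  λ j live → live-suc⁻¹ (1F ∷ v) j (lives (suc j) (live-suc (1F ∷ u) j (λ ()) live))
live⊑-complete (1F ∷ u) (2F ∷ v) os two lives = live⊑-complete u v (ones-tail u os) (two ∘ suc)
  λ j live → live-head v j (λ ()) (live-suc⁻¹ (2F ∷ v) j (lives (suc j) (live-suc (1F ∷ u) j (λ ()) live)))
live⊑-complete (2F ∷ u) (0F ∷ v) os two lives = contradiction (two zero ≡.refl) λ ()
live⊑-complete (2F ∷ u) (1F ∷ v) os two lives = contradiction (two zero ≡.refl) λ ()
live⊑-complete (2F ∷ u) (2F ∷ v) os two lives = live⊑-complete u v (ones-tail u os) (two ∘ suc)
  λ j live → live-head v j (λ ()) (live-suc⁻¹ (2F ∷ v) j
    (lives (suc j) (live-suc (2F ∷ u) j (λ ()) (live-head u j (λ ()) live))))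

word⊑-twos : ∀ (u v : Word n) → T (word⊑ u v) → Twos⊆ u v
word⊑-twos (0F ∷ u) (_ ∷ v)  l zero    ()
word⊑-twos (0F ∷ u) (_ ∷ v)  l (suc i) = dead⊑-twos u v l i
word⊑-twos (1F ∷ u) (1F ∷ v) l zero    ()
word⊑-twos (1F ∷ u) (1F ∷ v) l (suc i) = live⊑-twos u v l i
word⊑-twos (1F ∷ u) (2F ∷ v) () _
word⊑-twos (2F ∷ u) (_ ∷ v)  () _

word⊑-live : ∀ (u v : Word n) → OnesBeforeZeros v → T (word⊑ u v) → Live⊆ u v
word⊑-live (0F ∷ u) (_ ∷ v)  os l = λ j live → ⊥-elim (¬live-0∷ u j live)
word⊑-live (1F ∷ u) (1F ∷ v) os l = live⊑-live u v (ones-tail v os) l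
word⊑-live (1F ∷ u) (2F ∷ v) os ()
word⊑-live (2F ∷ u) (_ ∷ v)  os ()

word⊑-complete : ∀ (u v : Word n) → IsTriword u → IsTriword v → Twos⊆ u v → Live⊆ u v → T (word⊑ u v)
word⊑-complete []       []       _        _       two lives = tt
word⊑-complete (0F ∷ u) (_ ∷ v)  (_ , os) _       two lives = dead⊑-complete u v (ones-0∷ u os) (two ∘ suc)
word⊑-complete (1F ∷ u) (0F ∷ v) (_ , os) _       two lives with j , live ← exists-live u (ones-tail u os) =
  ⊥-elim (¬live-0∷ v j (lives j live))
word⊑-complete (1F ∷ u) (1F ∷ v) (_ , os) _       two lives =
  live⊑-complete u v (ones-tail u os) (two ∘ suc) lives
word⊑-complete (1F ∷ u) (2F ∷ v) _        (f , _) two lives = ⊥-elim (f zero ≡.refl ≡.refl)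
word⊑-complete (2F ∷ u) (_ ∷ v)  (f , _)  _       two lives = ⊥-elim (f zero ≡.refl ≡.refl)

-- This lets predecessors be constructed as plain words, and it absorbs the indicator `isTri` in
-- sums over the words below `v`.
word⊑⇒isTri : ∀ (u v : Word n) → T (word⊑ u v) → T (isTri u)
word⊑⇒isTri []       []       _ = tt
word⊑⇒isTri (0F ∷ u) (_ ∷ v)  l = isDead-complete u (dead⊑-noOnes u v l)
word⊑⇒isTri (1F ∷ u) (1F ∷ v) l = isLive-complete u (live⊑-ones u v l)
word⊑⇒isTri (1F ∷ u) (2F ∷ v) ()
word⊑⇒isTri (2F ∷ u) (_ ∷ v)  ()

-- The rank of a triword

dead⊑-≤ : ∀ (u v : Word n) → T (dead⊑ u v) → twos u ℕ.≤ twos v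
dead⊑-≤ []       []       _ = z≤n
dead⊑-≤ (0F ∷ u) (0F ∷ v) d = dead⊑-≤ u v d
dead⊑-≤ (0F ∷ u) (1F ∷ v) d = dead⊑-≤ u v d
dead⊑-≤ (0F ∷ u) (2F ∷ v) d = ℕ.m≤n⇒m≤1+n (dead⊑-≤ u v d)
dead⊑-≤ (2F ∷ u) (2F ∷ v) d = s≤s (dead⊑-≤ u v d)

dead⊑-< : ∀ (u v : Word n) → NoOnes v → T (dead⊑ u v) → u ≡ v ⊎ twos u ℕ.< twos v
dead⊑-< []       []       none d = inj₁ ≡.refl
dead⊑-< (0F ∷ u) (0F ∷ v) none d = Sum.map₁ (≡.cong (0F ∷_)) (dead⊑-< u v (none ∘ suc) d)
dead⊑-< (0F ∷ u) (1F ∷ v) none d = ⊥-elim (none zero ≡.refl)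
dead⊑-< (0F ∷ u) (2F ∷ v) none d = inj₂ (s≤s (dead⊑-≤ u v d))
dead⊑-< (2F ∷ u) (2F ∷ v) none d = Sum.map (≡.cong (2F ∷_)) s≤s (dead⊑-< u v (none ∘ suc) d)

live⊑-< : ∀ (u v : Word n) → OnesBeforeZeros v → T (live⊑ u v) → u ≡ v ⊎ twos u ℕ.< twos v
live⊑-< []       []       os l = inj₁ ≡.refl
live⊑-< (0F ∷ u) (0F ∷ v) os l = Sum.map₁ (≡.cong (0F ∷_)) (dead⊑-< u v (ones-0∷ v os) l)
live⊑-< (0F ∷ u) (2F ∷ v) os l = inj₂ (s≤s (dead⊑-≤ u v (proj₂ (Equivalence.to (T-∧ {noOnes v}) l))))
live⊑-< (1F ∷ u) (1F ∷ v) os l = Sum.map₁ (≡.cong (1F ∷_)) (live⊑-< u v (ones-tail v os) l)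
live⊑-< (1F ∷ u) (2F ∷ v) os l with live⊑-< u v (ones-tail v os) l
... | inj₁ ≡.refl = inj₂ ℕ.≤-refl
... | inj₂ u<v    = inj₂ (ℕ.m≤n⇒m≤1+n u<v)
live⊑-< (2F ∷ u) (2F ∷ v) os l = Sum.map (≡.cong (2F ∷_)) s≤s (live⊑-< u v (ones-tail v os) l)

-- Where the words first differ, a 0 or 1 of `u` stands against a 2 of `v`, or the initial letters
-- are 0 and 1. Either way `v` gains one unit, and afterwards the 2s of `u` are still among those of
-- `v`. Both antisymmetry and strictness of the rank follow from this.
word⊑-< : ∀ (u v : Word n) → IsTriword v → T (word⊑ u v) → u ≡ v ⊎ rk u ℕ.< rk v
word⊑-< []       []       _        l = inj₁ ≡.refl
word⊑-< (0F ∷ u) (0F ∷ v) (_ , os) l = Sum.map₁ (≡.cong (0F ∷_)) (dead⊑-< u v (ones-0∷ v os) l)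
word⊑-< (0F ∷ u) (1F ∷ v) _        l = inj₂ (s≤s (dead⊑-≤ u v l))
word⊑-< (0F ∷ u) (2F ∷ v) (f , _)  l = ⊥-elim (f zero ≡.refl ≡.refl)
word⊑-< (1F ∷ u) (1F ∷ v) (_ , os) l = Sum.map (≡.cong (1F ∷_)) s≤s (live⊑-< u v (ones-tail v os) l)
word⊑-< (1F ∷ u) (2F ∷ v) _        ()
word⊑-< (2F ∷ u) (_ ∷ v)  _        ()

-- A new 0 in front would violate (T3) if 1s remained behind it; deleting them costs no rank, since
-- there only the 2s count.
kill-ones : Word n → Word n
kill-ones []       = []
kill-ones (0F ∷ w) = 0F ∷ kill-ones w
kill-ones (1F ∷ w) = 0F ∷ kill-ones w
kill-ones (2F ∷ w) = 2F ∷ kill-ones w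

kill-ones-⊑ : (w : Word n) → T (dead⊑ (kill-ones w) w)
kill-ones-⊑ []       = tt
kill-ones-⊑ (0F ∷ w) = kill-ones-⊑ w
kill-ones-⊑ (1F ∷ w) = kill-ones-⊑ w
kill-ones-⊑ (2F ∷ w) = kill-ones-⊑ w

twos-kill-ones : (w : Word n) → twos (kill-ones w) ≡ twos w
twos-kill-ones []       = ≡.refl
twos-kill-ones (0F ∷ w) = twos-kill-ones w
twos-kill-ones (1F ∷ w) = twos-kill-ones w
twos-kill-ones (2F ∷ w) = ≡.cong suc (twos-kill-ones w)

dead-pred : (v : Word n) → twos v ≡ 0 ⊎ ∃[ u ] T (dead⊑ u v) × suc (twos u) ≡ twos v
dead-pred []       = inj₁ ≡.refl
dead-pred (0F ∷ v) with dead-pred v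
... | inj₁ eq           = inj₁ eq
... | inj₂ (u , d , eq) = inj₂ (0F ∷ u , d , eq)
dead-pred (1F ∷ v) with dead-pred v
... | inj₁ eq           = inj₁ eq
... | inj₂ (u , d , eq) = inj₂ (0F ∷ u , d , eq)
dead-pred (2F ∷ v) = inj₂ (0F ∷ kill-ones v , kill-ones-⊑ v , ≡.cong suc (twos-kill-ones v))

-- One unit of rank is removed by turning the initial 1 into 0, or, if the word begins with 0, by
-- turning its first 2 into 0.
word-pred : (v : Word n) → rk v ≡ 0 ⊎ ∃[ u ] T (word⊑ u v) × suc (rk u) ≡ rk v
word-pred []       = inj₁ ≡.refl
word-pred (0F ∷ v) with dead-pred v
... | inj₁ eq           = inj₁ eq
... | inj₂ (u , d , eq) = inj₂ (0F ∷ u , d , eq)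
word-pred (1F ∷ v) = inj₂ (0F ∷ kill-ones v , kill-ones-⊑ v , ≡.cong suc (twos-kill-ones v))
word-pred (2F ∷ v) = inj₁ ≡.refl

-- From words back to the core label order

module _ {N : ℕ} where
  open CoreLabelOrder (Hoch (suc N))

  ⊑⇒word⊑ : ∀ u v → u ⊑ v → T (word⊑ (value u) (value v))
  ⊑⇒word⊑ u v u⊑v = word⊑-complete (value u) (value v) (triword u) (triword v)
    (⊑⇒twos {u = u} {v} (λ {c} → u⊑v {c})) (⊑⇒live {u = u} {v} (λ {c} → u⊑v {c}))

  word⊑⇒⊑ : ∀ u v → T (word⊑ (value u) (value v)) → u ⊑ v
  word⊑⇒⊑ u v l {c} = twos∧live⇒⊑ {u = u} {v} (word⊑-twos (value u) (value v) l)
    (word⊑-live (value u) (value v) (proj₂ (triword v)) l) {c}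

  does-⊑? : ∀ u v → does (u ⊑? v) ≡ word⊑ (value u) (value v)
  does-⊑? u v = does-⇔
    (mk⇔ (λ p → ⊑⇒word⊑ u v (λ {c} → p {c})) (λ l {c} → word⊑⇒⊑ u v l {c}))
    (u ⊑? v) (T? (word⊑ (value u) (value v)))

  ⊑⇒≡⊎rk< : ∀ u v → u ⊑ v → u ≡ v ⊎ rk (value u) ℕ.< rk (value v)
  ⊑⇒≡⊎rk< u v u⊑v =
    Sum.map₁ value-injective (word⊑-< (value u) (value v) (triword v) (⊑⇒word⊑ u v (λ {c} → u⊑v {c})))

  ⊑-antisym : ∀ {u v} → u ⊑ v → v ⊑ u → u ≡ v
  ⊑-antisym {u} {v} u⊑v v⊑u = cases (⊑⇒≡⊎rk< u v (λ {c} → u⊑v {c})) (⊑⇒≡⊎rk< v u (λ {c} → v⊑u {c}))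
    where
    cases : u ≡ v ⊎ rk (value u) ℕ.< rk (value v) → v ≡ u ⊎ rk (value v) ℕ.< rk (value u) → u ≡ v
    cases (inj₁ u≡v) _          = u≡v
    cases (inj₂ _)   (inj₁ v≡u) = ≡.sym v≡u
    cases (inj₂ u<v) (inj₂ v<u) = contradiction v<u (ℕ.<-asym u<v)

  rk-strict : ∀ {u v} → u ⊑ v × ¬ v ⊑ u → rk (value u) ℕ.< rk (value v)
  rk-strict {u} {v} (u⊑v , v⋢u) = cases (⊑⇒≡⊎rk< u v (λ {c} → u⊑v {c}))
    where
    cases : u ≡ v ⊎ rk (value u) ℕ.< rk (value v) → rk (value u) ℕ.< rk (value v)
    cases (inj₁ u≡v) = contradiction (λ {c} → ≡.subst (λ w → Ψ w c) (≡.sym u≡v)) v⋢u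
    cases (inj₂ u<v) = u<v

  rk-pred : ∀ v → rk (value v) ≡ 0 ⊎ ∃[ w ] (w ⊑ v × ¬ v ⊑ w) × suc (rk (value w)) ≡ rk (value v)
  rk-pred v = Sum.map₂ lift (word-pred (value v))
    where
    lift : ∃[ u ] T (word⊑ u (value v)) × suc (rk u) ≡ rk (value v) →
           ∃[ w ] (w ⊑ v × ¬ v ⊑ w) × suc (rk (value w)) ≡ rk (value v)
    lift (u , l , eq) = w , ((λ {c} → word⊑⇒⊑ w v l {c}) , v⋢w) , eq
      where
      w : Tri (suc N)
      w = u , Irrelevant.[ isTri-sound u (word⊑⇒isTri u (value v) l) ]
      w<v : rk u ℕ.< rk (value v)
      w<v = ℕ.≤-reflexive eq
      v⋢w : ¬ v ⊑ w
      v⋢w v⊑w = cases (⊑⇒≡⊎rk< v w (λ {c} → v⊑w {c}))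
        where
        cases : ¬ (v ≡ w ⊎ rk (value v) ℕ.< rk u)
        cases (inj₁ v≡w) = ℕ.<-irrefl (≡.cong (rk ∘ value) (≡.sym v≡w)) w<v
        cases (inj₂ v<w) = ℕ.<-asym v<w w<v

-- The M-triangle and the H-triangle

module WordSums {c ℓ} (R : CommutativeRing c ℓ) where
  open CommutativeRing R hiding (zero)
  open Triangles R
  open Sums R
  open SetoidReasoning setoid
  open Exp commutativeSemiring using (^-distrib-*; ^-congˡ)
  open CommutativeMonoidMult +-commutativeMonoid using (×-distrib-+)
  open Mult semiring using (×-congʳ; ×-comm-*) renaming (_×_ to _ℕ×_)
  open GroupProperties +-group using () renaming (∙-cancelʳ to +-cancelʳ)
  open SemiringSolver commutativeSemiring using (solve; _:=_; _:+_; _:*_; con)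

  -- In the semiring identities below, a difference `c - 1#` is a variable of its own, tied to `c`
  -- by this equation.
  1+[c-1] : ∀ c → c ≈ 1# + (c - 1#)
  1+[c-1] c = begin
    c             ≈⟨ +-identityˡ c ⟨
    0# + c        ≈⟨ +-congʳ (-‿inverseʳ 1#) ⟨
    1# - 1# + c   ≈⟨ +-assoc _ _ _ ⟩
    1# + (- 1# + c) ≈⟨ +-congˡ (+-comm _ _) ⟩
    1# + (c - 1#) ∎

  ∑-words : ∀ n (h : Word (suc n) → Carrier) → ∑ (words (suc n)) h ≈
            ∑ (words n) (h ∘ (0F ∷_)) + (∑ (words n) (h ∘ (1F ∷_)) + ∑ (words n) (h ∘ (2F ∷_)))
  ∑-words n h = begin
    ∑ (map (0F ∷_) (words n) ++ map (1F ∷_) (words n) ++ map (2F ∷_) (words n) ++ []) h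
      ≈⟨ ∑-++ h (map (0F ∷_) (words n)) _ ⟩
    ∑ (map (0F ∷_) (words n)) h + ∑ (map (1F ∷_) (words n) ++ map (2F ∷_) (words n) ++ []) h
      ≈⟨ +-cong (∑-map h (0F ∷_) (words n)) (∑-++ h (map (1F ∷_) (words n)) _) ⟩
    ∑ (words n) (h ∘ (0F ∷_)) + (∑ (map (1F ∷_) (words n)) h + ∑ (map (2F ∷_) (words n) ++ []) h)
      ≈⟨ +-congˡ (+-cong (∑-map h (1F ∷_) (words n)) (∑-++ h (map (2F ∷_) (words n)) [])) ⟩
    ∑ (words n) (h ∘ (0F ∷_)) + (∑ (words n) (h ∘ (1F ∷_)) + (∑ (map (2F ∷_) (words n)) h + 0#))
      ≈⟨ +-congˡ (+-congˡ (trans (+-identityʳ _) (∑-map h (2F ∷_) (words n)))) ⟩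
    ∑ (words n) (h ∘ (0F ∷_)) + (∑ (words n) (h ∘ (1F ∷_)) + ∑ (words n) (h ∘ (2F ∷_))) ∎

  -- Sums over all words split by the first letter, so the triword condition is moved into an
  -- indicator.
  ∑-triwords : ∀ n (h : Word n → Carrier) → ∑ (triwords n) (h ∘ value) ≈ ∑ (words n) (λ w → [ isTri w ] h w)
  ∑-triwords n h = mapMaybe-toTri (words n)
    where
    mapMaybe-toTri : ∀ ws → ∑ (mapMaybe toTri ws) (h ∘ value) ≈ ∑ ws (λ w → [ isTri w ] h w)
    mapMaybe-toTri []       = refl
    mapMaybe-toTri (w ∷ ws) with isTriword? w | isTri w | isTri-complete w | isTri-sound w
    ... | yes _ | true  | _ | _ = +-congˡ (mapMaybe-toTri ws)
    ... | yes t | false | c | _ = ⊥-elim (c t)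
    ... | no ¬t | true  | _ | s = contradiction (s tt) ¬t
    ... | no _  | false | _ | _ = trans (mapMaybe-toTri ws) (sym (+-identityˡ _))

  ∑-[]-*ˡ : ∀ n r (β : Word n → Bool) (f : Word n → Carrier) →
            ∑ (words n) (λ w → [ β w ] (r * f w)) ≈ r * ∑ (words n) (λ w → [ β w ] f w)
  ∑-[]-*ˡ n r β f = trans (∑-cong (words n) (λ w → sym ([]-distrib-*ˡ r (β w) (f w))))
    (sym (∑-*ˡ r (λ w → [ β w ] f w) (words n)))

  module _ (X a : Carrier) (X≈1+a : X ≈ 1# + a) where

    -- The parameter c is X − k, where k is the number of letters read since the last 1, inclusive.
    liveWeight : Carrier → Word n → Carrier
    liveWeight c []       = c
    liveWeight c (0F ∷ w) = c * a ^ twos w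
    liveWeight c (1F ∷ w) = liveWeight a w
    liveWeight c (2F ∷ w) = a * liveWeight (c - 1#) w

    weight : Word n → Carrier
    weight []       = 1#
    weight (0F ∷ w) = a ^ twos w
    weight (1F ∷ w) = liveWeight a w
    weight (2F ∷ w) = 0#

    -- Only a 2 of `v` leaves a choice: keep it, with weight `a`, or replace it by 0. This gives a
    -- factor `1# + a`, that is `X`.
    ∑-dead⊑ : (v : Word n) → ∑ (words n) (λ w → [ dead⊑ w v ] (a ^ twos w)) ≈ X ^ twos v
    ∑-dead⊑ []                = +-identityʳ 1#
    ∑-dead⊑ {suc n} (0F ∷ v) = begin
      ∑ (words (suc n)) (λ w → [ dead⊑ w (0F ∷ v) ] (a ^ twos w)) ≈⟨ ∑-words n _ ⟩
      ∑ (words n) (λ w → [ dead⊑ w v ] (a ^ twos w)) + (∑ (words n) (λ _ → 0#) + ∑ (words n) (λ _ → 0#))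
        ≈⟨ +-cong (∑-dead⊑ v) (+-cong (∑-zero (words n)) (∑-zero (words n))) ⟩
      X ^ twos v + (0# + 0#)
        ≈⟨ solve 1 (λ p → p :+ (con 0 :+ con 0) := p) refl (X ^ twos v) ⟩
      X ^ twos v ∎
    ∑-dead⊑ {suc n} (1F ∷ v) = begin
      ∑ (words (suc n)) (λ w → [ dead⊑ w (1F ∷ v) ] (a ^ twos w)) ≈⟨ ∑-words n _ ⟩
      ∑ (words n) (λ w → [ dead⊑ w v ] (a ^ twos w)) + (∑ (words n) (λ _ → 0#) + ∑ (words n) (λ _ → 0#))
        ≈⟨ +-cong (∑-dead⊑ v) (+-cong (∑-zero (words n)) (∑-zero (words n))) ⟩
      X ^ twos v + (0# + 0#)
        ≈⟨ solve 1 (λ p → p :+ (con 0 :+ con 0) := p) refl (X ^ twos v) ⟩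
      X ^ twos v ∎
    ∑-dead⊑ {suc n} (2F ∷ v) = begin
      ∑ (words (suc n)) (λ w → [ dead⊑ w (2F ∷ v) ] (a ^ twos w)) ≈⟨ ∑-words n _ ⟩
      ∑ (words n) (λ w → [ dead⊑ w v ] (a ^ twos w)) +
        (∑ (words n) (λ _ → 0#) + ∑ (words n) (λ w → [ dead⊑ w v ] (a * a ^ twos w)))
        ≈⟨ +-cong (∑-dead⊑ v) (+-cong (∑-zero (words n))
             (trans (∑-[]-*ˡ n a (λ w → dead⊑ w v) (λ w → a ^ twos w)) (*-congˡ (∑-dead⊑ v)))) ⟩
      X ^ twos v + (0# + a * X ^ twos v)
        ≈⟨ solve 2 (λ p a → p :+ (con 0 :+ a :* p) := (con 1 :+ a) :* p) refl (X ^ twos v) a ⟩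
      (1# + a) * X ^ twos v ≈⟨ *-congʳ X≈1+a ⟨
      X * X ^ twos v ∎

    private
      -- Here c′ stands for c − 1: without subtraction the identity is one of semirings.
      live-step : ∀ {c c′ p} β → c ≈ 1# + c′ →
        [ β ] (c * p) + (p * (if true then a else a) + a * (p * (if β then c′ else a)))
        ≈ X * p * (if β then c else a)
      live-step {c} {c′} {p} true c≈ = begin
        c * p + (p * a + a * (p * c′)) ≈⟨ +-congʳ (*-congʳ c≈) ⟩
        (1# + c′) * p + (p * a + a * (p * c′))
          ≈⟨ solve 3 (λ c′ p a → (con 1 :+ c′) :* p :+ (p :* a :+ a :* (p :* c′))
                               := (con 1 :+ a) :* p :* (con 1 :+ c′)) refl c′ p a ⟩
        (1# + a) * p * (1# + c′) ≈⟨ *-cong (*-congʳ X≈1+a) c≈ ⟨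
        X * p * c ∎
      live-step {c} {c′} {p} false c≈ = begin
        0# + (p * a + a * (p * a))
          ≈⟨ solve 2 (λ p a → con 0 :+ (p :* a :+ a :* (p :* a)) := (con 1 :+ a) :* p :* a) refl p a ⟩
        (1# + a) * p * a ≈⟨ *-congʳ (*-congʳ X≈1+a) ⟨
        X * p * a ∎

      []-∑ : ∀ β (f : Word n → Carrier) → ∑ (words n) (λ w → [ β ] f w) ≈ [ β ] ∑ (words n) f
      []-∑     true  f = refl
      []-∑ {n} false f = ∑-zero (words n)

    -- The decisive case is a 2 in front of `v` with `noOnes v`. The letters 0, 1, 2 below it
    -- contribute `c`, `a` and `a * (c - 1#)` times the same power of `X`, in total `(1# + a) * c`;
    -- lowering `c` by one at each 2 is what closes the recursion. If a 1 is still to come in `v`,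
    -- the letter 0 is excluded and that 1 resets the factor to `a`.
    ∑-live⊑ : ∀ c (v : Word n) → ∑ (words n) (λ w → [ live⊑ w v ] liveWeight c w) ≈
              X ^ twos v * (if noOnes v then c else a)
    ∑-live⊑ c []               = trans (+-identityʳ c) (sym (*-identityˡ c))
    ∑-live⊑ {suc n} c (0F ∷ v) = begin
      ∑ (words (suc n)) (λ w → [ live⊑ w (0F ∷ v) ] liveWeight c w) ≈⟨ ∑-words n _ ⟩
      ∑ (words n) (λ w → [ dead⊑ w v ] (c * a ^ twos w)) + (∑ (words n) (λ _ → 0#) + ∑ (words n) (λ _ → 0#))
        ≈⟨ +-cong (trans (∑-[]-*ˡ n c (λ w → dead⊑ w v) (λ w → a ^ twos w)) (*-congˡ (∑-dead⊑ v)))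
             (+-cong (∑-zero (words n)) (∑-zero (words n))) ⟩
      c * X ^ twos v + (0# + 0#)
        ≈⟨ solve 2 (λ c p → c :* p :+ (con 0 :+ con 0) := p :* c) refl c (X ^ twos v) ⟩
      X ^ twos v * c ∎
    ∑-live⊑ {suc n} c (1F ∷ v) = begin
      ∑ (words (suc n)) (λ w → [ live⊑ w (1F ∷ v) ] liveWeight c w) ≈⟨ ∑-words n _ ⟩
      ∑ (words n) (λ _ → 0#) + (∑ (words n) (λ w → [ live⊑ w v ] liveWeight a w) + ∑ (words n) (λ _ → 0#))
        ≈⟨ +-cong (∑-zero (words n)) (+-cong (∑-live⊑ a v) (∑-zero (words n))) ⟩
      0# + (X ^ twos v * (if noOnes v then a else a) + 0#)
        ≈⟨ trans (+-identityˡ _) (+-identityʳ _) ⟩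
      X ^ twos v * (if noOnes v then a else a)
        ≈⟨ *-congˡ (reflexive (if-eta (noOnes v))) ⟩
      X ^ twos v * a ∎
    ∑-live⊑ {suc n} c (2F ∷ v) = begin
      ∑ (words (suc n)) (λ w → [ live⊑ w (2F ∷ v) ] liveWeight c w) ≈⟨ ∑-words n _ ⟩
      ∑ (words n) (λ w → [ noOnes v ∧ dead⊑ w v ] (c * a ^ twos w)) +
        (∑ (words n) (λ w → [ live⊑ w v ] liveWeight a w) +
         ∑ (words n) (λ w → [ live⊑ w v ] (a * liveWeight (c - 1#) w)))
        ≈⟨ +-cong zeros (+-cong ones (trans (∑-[]-*ˡ n a (λ w → live⊑ w v) (liveWeight (c - 1#)))
             (*-congˡ (∑-live⊑ (c - 1#) v)))) ⟩
      [ noOnes v ] (c * X ^ twos v) +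
        (X ^ twos v * a + a * (X ^ twos v * (if noOnes v then c - 1# else a)))
        ≈⟨ live-step (noOnes v) (1+[c-1] c) ⟩
      X * X ^ twos v * (if noOnes v then c else a) ∎
      where
      zeros : ∑ (words n) (λ w → [ noOnes v ∧ dead⊑ w v ] (c * a ^ twos w)) ≈ [ noOnes v ] (c * X ^ twos v)
      zeros = begin
        ∑ (words n) (λ w → [ noOnes v ∧ dead⊑ w v ] (c * a ^ twos w))
          ≈⟨ ∑-cong (words n) (λ w → []-∧ (noOnes v) (dead⊑ w v) _) ⟩
        ∑ (words n) (λ w → [ noOnes v ] [ dead⊑ w v ] (c * a ^ twos w))
          ≈⟨ []-∑ (noOnes v) (λ w → [ dead⊑ w v ] (c * a ^ twos w)) ⟩
        [ noOnes v ] ∑ (words n) (λ w → [ dead⊑ w v ] (c * a ^ twos w))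
          ≈⟨ []-cong (noOnes v) (trans (∑-[]-*ˡ n c (λ w → dead⊑ w v) (λ w → a ^ twos w)) (*-congˡ (∑-dead⊑ v))) ⟩
        [ noOnes v ] (c * X ^ twos v) ∎
      ones : ∑ (words n) (λ w → [ live⊑ w v ] liveWeight a w) ≈ X ^ twos v * a
      ones = trans (∑-live⊑ a v) (*-congˡ (reflexive (if-eta (noOnes v))))

    ∑-word⊑ : (v : Word (suc n)) → IsTriword v → ∑ (words (suc n)) (λ w → [ word⊑ w v ] weight w) ≈ X ^ rk v
    ∑-word⊑ {n} (0F ∷ v) _ = begin
      ∑ (words (suc n)) (λ w → [ word⊑ w (0F ∷ v) ] weight w) ≈⟨ ∑-words n _ ⟩
      ∑ (words n) (λ w → [ dead⊑ w v ] (a ^ twos w)) + (∑ (words n) (λ _ → 0#) + ∑ (words n) (λ _ → 0#))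
        ≈⟨ +-cong (∑-dead⊑ v) (+-cong (∑-zero (words n)) (∑-zero (words n))) ⟩
      X ^ twos v + (0# + 0#)
        ≈⟨ solve 1 (λ p → p :+ (con 0 :+ con 0) := p) refl (X ^ twos v) ⟩
      X ^ twos v ∎
    ∑-word⊑ {n} (1F ∷ v) _ = begin
      ∑ (words (suc n)) (λ w → [ word⊑ w (1F ∷ v) ] weight w) ≈⟨ ∑-words n _ ⟩
      ∑ (words n) (λ w → [ dead⊑ w v ] (a ^ twos w)) +
        (∑ (words n) (λ w → [ live⊑ w v ] liveWeight a w) + ∑ (words n) (λ _ → 0#))
        ≈⟨ +-cong (∑-dead⊑ v) (+-cong (∑-live⊑ a v) (∑-zero (words n))) ⟩
      X ^ twos v + (X ^ twos v * (if noOnes v then a else a) + 0#)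
        ≈⟨ +-congˡ (+-congʳ (*-congˡ (reflexive (if-eta (noOnes v))))) ⟩
      X ^ twos v + (X ^ twos v * a + 0#)
        ≈⟨ solve 2 (λ p a → p :+ (p :* a :+ con 0) := (con 1 :+ a) :* p) refl (X ^ twos v) a ⟩
      (1# + a) * X ^ twos v ≈⟨ *-congʳ X≈1+a ⟨
      X * X ^ twos v ∎
    ∑-word⊑ (2F ∷ v) (first , _) = ⊥-elim (first zero ≡.refl ≡.refl)

    module _ (N : ℕ) where
      open CoreLabelOrder (Hoch (suc N)) using (_⊑_; _⊑?_)
      open CoreLabelSums R (Hoch (suc N))

      ∑-⊑ : ∀ v → ∑ (triwords (suc N)) (λ w → [ does (w ⊑? v) ] weight (value w)) ≈ X ^ rk (value v)
      ∑-⊑ v = begin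
        ∑ (triwords (suc N)) (λ w → [ does (w ⊑? v) ] weight (value w))
          ≈⟨ ∑-cong (triwords (suc N)) (λ w → reflexive (≡.cong ([_] weight (value w)) (does-⊑? w v))) ⟩
        ∑ (triwords (suc N)) (λ w → [ word⊑ (value w) (value v) ] weight (value w))
          ≈⟨ ∑-triwords (suc N) (λ w → [ word⊑ w (value v) ] weight w) ⟩
        ∑ (words (suc N)) (λ w → [ isTri w ] [ word⊑ w (value v) ] weight w)
          ≈⟨ ∑-cong (words (suc N)) (λ w → absorb (isTri w) (word⊑ w (value v)) (word⊑⇒isTri w (value v))) ⟩
        ∑ (words (suc N)) (λ w → [ word⊑ w (value v) ] weight w)
          ≈⟨ ∑-word⊑ (value v) (triword v) ⟩
        X ^ rk (value v) ∎
        where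
        absorb : ∀ β γ {r} → (T γ → T β) → [ β ] [ γ ] r ≈ [ γ ] r
        absorb true  γ     _ = refl
        absorb false false _ = refl
        absorb false true  h = ⊥-elim (h tt)

      M-weight : ∀ Y → M (suc N) X Y ≈ ∑ (words (suc N)) (λ w → [ isTri w ] (weight w * Y ^ rk w))
      M-weight Y = trans
        (∑-möbius-rank (λ {u} {v} → ⊑-antisym {u = u} {v}) (λ v → rk (value v))
          (λ {u} {v} → rk-strict {u = u} {v}) rk-pred X Y (λ v → weight (value v)) ∑-⊑)
        (∑-triwords (suc N) (λ v → weight v * Y ^ rk v))

    module _ (Y t : Carrier) (t≈aY : t ≈ a * Y) where

      -- The letters are independent: a 0 contributes 1 and a 2 contributes `a * Y`.
      ∑-dead : ∀ n → ∑ (words n) (λ w → [ isDead w ] (a ^ twos w * Y ^ twos w)) ≈ (1# + t) ^ n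
      ∑-dead zero    = trans (+-identityʳ _) (*-identityˡ _)
      ∑-dead (suc n) = begin
        ∑ (words (suc n)) (λ w → [ isDead w ] (a ^ twos w * Y ^ twos w)) ≈⟨ ∑-words n _ ⟩
        S + (∑ (words n) (λ _ → 0#) + ∑ (words n) (λ w → [ isDead w ] (a * a ^ twos w * (Y * Y ^ twos w))))
          ≈⟨ +-congˡ (+-cong (∑-zero (words n)) (trans (∑-cong (words n) (λ w → []-cong (isDead w) (regroup w)))
               (∑-[]-*ˡ n t isDead (λ w → a ^ twos w * Y ^ twos w)))) ⟩
        S + (0# + t * S)
          ≈⟨ solve 2 (λ s t → s :+ (con 0 :+ t :* s) := (con 1 :+ t) :* s) refl S t ⟩
        (1# + t) * S ≈⟨ *-congˡ (∑-dead n) ⟩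
        (1# + t) * (1# + t) ^ n ∎
        where
        S : Carrier
        S = ∑ (words n) (λ w → [ isDead w ] (a ^ twos w * Y ^ twos w))
        regroup : ∀ w → a * a ^ twos w * (Y * Y ^ twos w) ≈ t * (a ^ twos w * Y ^ twos w)
        regroup w = trans
          (solve 4 (λ a p Y q → a :* p :* (Y :* q) := a :* Y :* (p :* q)) refl a (a ^ twos w) Y (Y ^ twos w))
          (*-congʳ (sym t≈aY))

      -- P N is the subtracted part of the sum, kept on the other side of the equations below.
      private
        q : ℕ → Carrier
        q n = (1# + t) ^ n

        P : ℕ → Carrier
        P n = n ℕ× (X * t * q (pred n))

        P-step : ∀ n → (1# + t) * P n ≈ n ℕ× (X * t * q n)
        P-step zero    = zeroʳ _
        P-step (suc n) = begin
          (1# + t) * (suc n ℕ× (X * t * q n)) ≈⟨ ×-comm-* (suc n) (1# + t) _ ⟩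
          suc n ℕ× ((1# + t) * (X * t * q n))
            ≈⟨ ×-congʳ (suc n) (solve 3 (λ X t q → (con 1 :+ t) :* (X :* t :* q) := X :* t :* ((con 1 :+ t) :* q))
                 refl X t (q n)) ⟩
          suc n ℕ× (X * t * q (suc n)) ∎

      -- Splitting off the first letter gives K(n+1, c) = c qⁿ + K(n, a) + t K(n, c - 1) with q = 1
      -- + t. The solution is affine in c: the coefficient of c is qⁿ and the constant term is n (a
      -- - t) qⁿ⁻¹. Writing a - t = (1 + t) a - X t distributes it over the two sides.
      ∑-live : ∀ n c → ∑ (words n) (λ w → [ isLive w ] (liveWeight c w * Y ^ twos w)) + P n ≈
               q n * (c + n ℕ× a)
      ∑-live zero    c = solve 1 (λ c → c :* con 1 :+ con 0 :+ con 0 := con 1 :* (c :+ con 0)) refl c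
      ∑-live (suc n) c = begin
        ∑ (words (suc n)) (λ w → [ isLive w ] (liveWeight c w * Y ^ twos w)) + P (suc n)
          ≈⟨ +-congʳ (∑-words n _) ⟩
        ∑ (words n) (λ w → [ isDead w ] (c * a ^ twos w * Y ^ twos w)) +
          (K a + ∑ (words n) (λ w → [ isLive w ] (a * liveWeight (c - 1#) w * (Y * Y ^ twos w))))
          + P (suc n)
          ≈⟨ +-congʳ (+-cong zeros (+-congˡ twos′)) ⟩
        c * q n + (K a + t * K (c - 1#)) + (X * t * q n + n ℕ× (X * t * q n))
          ≈⟨ +-congˡ (+-congˡ (P-step n)) ⟨
        c * q n + (K a + t * K (c - 1#)) + (X * t * q n + (1# + t) * P n)
          ≈⟨ solve 7 (λ c q A B t X P →
               c :* q :+ (A :+ t :* B) :+ (X :* t :* q :+ (con 1 :+ t) :* P)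
               := c :* q :+ (A :+ P) :+ t :* (B :+ P) :+ X :* t :* q)
             refl c (q n) (K a) (K (c - 1#)) t X (P n) ⟩
        c * q n + (K a + P n) + t * (K (c - 1#) + P n) + X * t * q n
          ≈⟨ +-cong (+-cong (+-cong (*-congʳ c≈) (∑-live n a)) (*-congˡ (∑-live n (c - 1#))))
               (*-congʳ (*-congʳ X≈1+a)) ⟩
        (1# + c′) * q n + q n * (a + na) + t * (q n * (c′ + na)) + (1# + a) * t * q n
          ≈⟨ solve 5 (λ c′ q a na t →
               (con 1 :+ c′) :* q :+ q :* (a :+ na) :+ t :* (q :* (c′ :+ na)) :+ (con 1 :+ a) :* t :* q
               := (con 1 :+ t) :* q :* (con 1 :+ c′ :+ (a :+ na)))
             refl c′ (q n) a na t ⟩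
        q (suc n) * (1# + c′ + suc n ℕ× a) ≈⟨ *-congˡ (+-congʳ c≈) ⟨
        q (suc n) * (c + suc n ℕ× a) ∎
        where
        K : Carrier → Carrier
        K c = ∑ (words n) (λ w → [ isLive w ] (liveWeight c w * Y ^ twos w))
        c′ na : Carrier
        c′ = c - 1#
        na = n ℕ× a
        c≈ : c ≈ 1# + c′
        c≈ = 1+[c-1] c
        zeros : ∑ (words n) (λ w → [ isDead w ] (c * a ^ twos w * Y ^ twos w)) ≈ c * q n
        zeros = begin
          ∑ (words n) (λ w → [ isDead w ] (c * a ^ twos w * Y ^ twos w))
            ≈⟨ ∑-cong (words n) (λ w → []-cong (isDead w) (*-assoc _ _ _)) ⟩
          ∑ (words n) (λ w → [ isDead w ] (c * (a ^ twos w * Y ^ twos w)))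
            ≈⟨ ∑-[]-*ˡ n c isDead (λ w → a ^ twos w * Y ^ twos w) ⟩
          c * ∑ (words n) (λ w → [ isDead w ] (a ^ twos w * Y ^ twos w))
            ≈⟨ *-congˡ (∑-dead n) ⟩
          c * q n ∎
        twos′ : ∑ (words n) (λ w → [ isLive w ] (a * liveWeight (c - 1#) w * (Y * Y ^ twos w))) ≈ t * K (c - 1#)
        twos′ = trans
          (∑-cong (words n) (λ w → []-cong (isLive w) (trans
            (solve 4 (λ a g Y p → a :* g :* (Y :* p) := a :* Y :* (g :* p)) refl
               a (liveWeight (c - 1#) w) Y (Y ^ twos w))
            (*-congʳ (sym t≈aY)))))
          (∑-[]-*ˡ n t isLive (λ w → liveWeight (c - 1#) w * Y ^ twos w))

      -- An initial 0 leaves a word without 1s and contributes `q N`. An initial 1 contributes `Y`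
      -- times the sum of `∑-live` at `c = a`, because that 1 is itself the first letter counted by
      -- k.
      M-closed : ∀ N → M (suc N) X Y + Y * P N ≈ q N * (1# + Y * (suc N ℕ× a))
      M-closed N = begin
        M (suc N) X Y + Y * P N ≈⟨ +-congʳ (M-weight N Y) ⟩
        ∑ (words (suc N)) (λ w → [ isTri w ] (weight w * Y ^ rk w)) + Y * P N ≈⟨ +-congʳ (∑-words N _) ⟩
        ∑ (words N) (λ w → [ isDead w ] (a ^ twos w * Y ^ twos w)) +
          (∑ (words N) (λ w → [ isLive w ] (liveWeight a w * (Y * Y ^ twos w))) + ∑ (words N) (λ _ → 0#)) + Y * P N
          ≈⟨ +-congʳ (+-cong (∑-dead N) (+-cong lives (∑-zero (words N)))) ⟩
        q N + (Y * K + 0#) + Y * P N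
          ≈⟨ solve 4 (λ q Y K P → q :+ (Y :* K :+ con 0) :+ Y :* P := q :+ Y :* (K :+ P)) refl (q N) Y K (P N) ⟩
        q N + Y * (K + P N) ≈⟨ +-congˡ (*-congˡ (∑-live N a)) ⟩
        q N + Y * (q N * (a + N ℕ× a))
          ≈⟨ solve 3 (λ q Y b → q :+ Y :* (q :* b) := q :* (con 1 :+ Y :* b)) refl (q N) Y (a + N ℕ× a) ⟩
        q N * (1# + Y * (suc N ℕ× a)) ∎
        where
        K : Carrier
        K = ∑ (words N) (λ w → [ isLive w ] (liveWeight a w * Y ^ twos w))
        lives : ∑ (words N) (λ w → [ isLive w ] (liveWeight a w * (Y * Y ^ twos w))) ≈ Y * K
        lives = trans
          (∑-cong (words N) (λ w → []-cong (isLive w)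
            (solve 3 (λ g Y p → g :* (Y :* p) := Y :* (g :* p)) refl (liveWeight a w) Y (Y ^ twos w))))
          (∑-[]-*ˡ N Y isLive (λ w → liveWeight a w * Y ^ twos w))

  -- The exponent pred N is meaningless for N = 0, but then it occurs with multiplicity 0.
  H-closed : ∀ N x y (d₁ : IsUnit (y - 1#)) (d₂ : IsUnit (x * (y - 1#) + 1#)) →
    H (suc N) x y d₁ d₂ ≈ (1# + x * y) ^ suc N + N ℕ× (x * (1# + x * y) ^ pred N)
  H-closed N x y d₁@(i , id≈1 , _) d₂@(j , jD≈1 , _) = +-cancelʳ W _ _ (begin
    D ^ suc N * M (suc N) X Y + W              ≈⟨ +-congˡ (W≈ N) ⟨
    D ^ suc N * M (suc N) X Y + D ^ suc N * (Y * P N) ≈⟨ distribˡ _ _ _ ⟨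
    D ^ suc N * (M (suc N) X Y + Y * P N)      ≈⟨ *-congˡ (M-closed X i X≈1+i Y t t≈iY N) ⟩
    D ^ suc N * ((1# + t) ^ N * (1# + Y * (suc N ℕ× i)))
      ≈⟨ solve 4 (λ D p q r → D :* p :* (q :* r) := p :* q :* (D :* r)) refl D (D ^ N) ((1# + t) ^ N) _ ⟩
    D ^ N * (1# + t) ^ N * (D * (1# + Y * (suc N ℕ× i)))
      ≈⟨ *-cong (trans (sym (^-distrib-* D (1# + t) N)) (^-congˡ N D[1+t]≈)) D[1+nYi]≈ ⟩
    s ^ N * (s + N ℕ× x)                       ≈⟨ distribˡ _ _ _ ⟩
    s ^ N * s + s ^ N * (N ℕ× x)               ≈⟨ +-cong (*-comm _ _) (tail N) ⟩
    s ^ suc N + (N ℕ× (x * s ^ pred N) + W)    ≈⟨ +-assoc _ _ _ ⟨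
    s ^ suc N + N ℕ× (x * s ^ pred N) + W      ∎)
    where
    d D X Y t s W : Carrier
    d = y - 1#
    D = x * d + 1#
    -- As `y` is `1# + d`, this is `1# + i`: the inverse `i` of `y - 1#` plays the part of `a`.
    X = y / d₁
    Y = (x * d) / d₂
    -- This is `a * Y` for `a = i`, with `d` cancelled.
    t = x * j
    s = 1# + x * y
    -- The subtracted part `D ^ suc N * (Y * P N)` after substitution, to be cancelled from both
    -- sides.
    W = N ℕ× (x * y * x * s ^ pred N)

    P : ℕ → Carrier
    P n = n ℕ× (X * t * (1# + t) ^ pred n)

    y≈1+d : y ≈ 1# + d
    y≈1+d = 1+[c-1] y

    X≈1+i : X ≈ 1# + i
    X≈1+i = begin
      y * i          ≈⟨ *-congʳ y≈1+d ⟩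
      (1# + d) * i   ≈⟨ solve 2 (λ d i → (con 1 :+ d) :* i := i :* d :+ i) refl d i ⟩
      i * d + i      ≈⟨ +-congʳ id≈1 ⟩
      1# + i         ∎

    t≈iY : t ≈ i * Y
    t≈iY = begin
      x * j                ≈⟨ *-identityˡ _ ⟨
      1# * (x * j)         ≈⟨ *-congʳ id≈1 ⟨
      i * d * (x * j)      ≈⟨ solve 4 (λ i d x j → i :* d :* (x :* j) := i :* (x :* d :* j)) refl i d x j ⟩
      i * (x * d * j)      ∎

    Dt≈x : D * t ≈ x
    Dt≈x = begin
      D * (x * j)    ≈⟨ solve 3 (λ D x j → D :* (x :* j) := x :* (j :* D)) refl D x j ⟩
      x * (j * D)    ≈⟨ *-congˡ jD≈1 ⟩
      x * 1#         ≈⟨ *-identityʳ x ⟩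
      x              ∎

    D+x≈s : D + x ≈ s
    D+x≈s = begin
      x * d + 1# + x      ≈⟨ solve 2 (λ x d → x :* d :+ con 1 :+ x := con 1 :+ x :* (con 1 :+ d)) refl x d ⟩
      1# + x * (1# + d)   ≈⟨ +-congˡ (*-congˡ y≈1+d) ⟨
      s                   ∎

    D[1+t]≈ : D * (1# + t) ≈ s
    D[1+t]≈ = begin
      D * (1# + t)   ≈⟨ trans (distribˡ D 1# t) (+-cong (*-identityʳ D) Dt≈x) ⟩
      D + x          ≈⟨ D+x≈s ⟩
      s              ∎

    D[1+nYi]≈ : D * (1# + Y * (suc N ℕ× i)) ≈ s + N ℕ× x
    D[1+nYi]≈ = begin
      D * (1# + Y * (suc N ℕ× i))
        ≈⟨ solve 3 (λ D Y b → D :* (con 1 :+ Y :* b) := D :+ D :* Y :* b) refl D Y (suc N ℕ× i) ⟩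
      D + D * Y * (suc N ℕ× i) ≈⟨ +-congˡ (×-comm-* (suc N) _ _) ⟩
      D + suc N ℕ× (D * Y * i)
        ≈⟨ +-congˡ (×-congʳ (suc N) (trans (solve 3 (λ D Y i → D :* Y :* i := D :* (i :* Y)) refl D Y i)
             (trans (*-congˡ (sym t≈iY)) Dt≈x))) ⟩
      D + suc N ℕ× x           ≈⟨ +-assoc _ _ _ ⟨
      D + x + N ℕ× x           ≈⟨ +-congʳ D+x≈s ⟩
      s + N ℕ× x               ∎

    W≈ : ∀ n → D ^ suc n * (Y * P n) ≈ n ℕ× (x * y * x * s ^ pred n)
    W≈ zero    = trans (*-congˡ (zeroʳ Y)) (zeroʳ _)
    W≈ (suc n) = begin
      D ^ suc (suc n) * (Y * P (suc n))   ≈⟨ *-assoc _ _ _ ⟨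
      D ^ suc (suc n) * Y * P (suc n)     ≈⟨ ×-comm-* (suc n) _ _ ⟩
      suc n ℕ× (D ^ suc (suc n) * Y * (X * t * (1# + t) ^ n)) ≈⟨ ×-congʳ (suc n) (begin
        -- One factor `D` turns `t` into `x`, one turns `i * Y` into `x`, and the remaining `n` turn
        -- each `1# + t` into `s`.
        D * (D * D ^ n) * Y * (y * i * t * (1# + t) ^ n)
          ≈⟨ solve 7 (λ D p Y y i t q →
               D :* (D :* p) :* Y :* (y :* i :* t :* q) := D :* t :* y :* (D :* (i :* Y)) :* (p :* q))
             refl D (D ^ n) Y y i t ((1# + t) ^ n) ⟩
        D * t * y * (D * (i * Y)) * (D ^ n * (1# + t) ^ n)
          ≈⟨ *-cong (*-cong (*-congʳ Dt≈x) (trans (*-congˡ (sym t≈iY)) Dt≈x))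
               (trans (sym (^-distrib-* D (1# + t) n)) (^-congˡ n D[1+t]≈)) ⟩
        x * y * x * s ^ n ∎) ⟩
      suc n ℕ× (x * y * x * s ^ n) ∎

    -- One factor `s` is opened as `1# + x * y`: the 1 gives the second term of the closed form, and
    -- `x * y` gives exactly `W`.
    tail : ∀ n → s ^ n * (n ℕ× x) ≈ n ℕ× (x * s ^ pred n) + n ℕ× (x * y * x * s ^ pred n)
    tail zero    = trans (zeroʳ _) (sym (+-identityʳ _))
    tail (suc n) = begin
      s ^ suc n * (suc n ℕ× x)      ≈⟨ ×-comm-* (suc n) _ _ ⟩
      suc n ℕ× (s * s ^ n * x)
        ≈⟨ ×-congʳ (suc n) (solve 3 (λ z p x → (con 1 :+ z) :* p :* x := x :* p :+ z :* x :* p)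
             refl (x * y) (s ^ n) x) ⟩
      suc n ℕ× (x * s ^ n + x * y * x * s ^ n) ≈⟨ ×-distrib-+ _ _ (suc n) ⟩
      suc n ℕ× (x * s ^ n) + suc n ℕ× (x * y * x * s ^ n) ∎

-- Antichains of J_n

module AntichainSums {c ℓ} (R : CommutativeRing c ℓ)
  {A : Set} (_≟_ : DecidableEquality A) {_≼_ : Rel A 0ℓ} (_≼?_ : Decidable _≼_)
  {P : Pred A 0ℓ} (P? : Unary.Decidable P) (x y : CommutativeRing.Carrier R)
  where
  open CommutativeRing R hiding (zero)
  open Triangles R
  open Sums R
  open SetoidReasoning setoid
  open SemiringSolver commutativeSemiring using (solve; _:=_; _:+_; _:*_; con)
  open Mult semiring using () renaming (_×_ to _ℕ×_)

  Antichain : Pred (List A) 0ℓ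
  Antichain as = All (λ a → All (λ b → a ≼ b → a ≡ b) as) as

  antichain? : Unary.Decidable Antichain
  antichain? as = All.all? (λ a → All.all? (λ b → (a ≼? b) →-dec (a ≟ b)) as) as

  -- Every element is incomparable to itself in this sense, in accordance with `Antichain`, which
  -- tolerates repeated entries.
  Incomparable : Rel A 0ℓ
  Incomparable a b = (a ≼ b → a ≡ b) × (b ≼ a → b ≡ a)

  incomparable? : Decidable Incomparable
  incomparable? a b = ((a ≼? b) →-dec (a ≟ b)) ×-dec ((b ≼? a) →-dec (b ≟ a))

  weight : A → Carrier
  weight a = if does (P? a) then x * y else x

  ∏weight : List A → Carrier
  ∏weight []       = 1#
  ∏weight (a ∷ as) = weight a * ∏weight as

  ∏weight-≈ : ∀ as → x ^ length as * y ^ length (filter P? as) ≈ ∏weight as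
  ∏weight-≈ []       = *-identityˡ 1#
  ∏weight-≈ (a ∷ as) with does (P? a)
  ... | true  = trans (solve 4 (λ x p y q → x :* p :* (y :* q) := x :* y :* (p :* q)) refl x _ y _)
    (*-congˡ (∏weight-≈ as))
  ... | false = trans (*-assoc _ _ _) (*-congˡ (∏weight-≈ as))

  term : List A → Carrier
  term as = [ does (antichain? as) ] ∏weight as

  ∏weight-↭ : ∀ {as bs} → as ↭ bs → ∏weight as ≈ ∏weight bs
  ∏weight-↭ ↭.refl         = refl
  ∏weight-↭ (↭.prep a p)   = *-congˡ (∏weight-↭ p)
  ∏weight-↭ (↭.swap a b p) = trans (*-congˡ (*-congˡ (∏weight-↭ p)))
    (solve 3 (λ a b p → a :* (b :* p) := b :* (a :* p)) refl (weight a) (weight b) _)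
  ∏weight-↭ (↭.trans p q)  = trans (∏weight-↭ p) (∏weight-↭ q)

  antichain-↭ : ∀ {as bs} → as ↭ bs → Antichain as → Antichain bs
  antichain-↭ p = All-resp-↭ p ∘ All.map (All-resp-↭ p)

  term-↭ : ∀ {as bs} → as ↭ bs → term as ≈ term bs
  term-↭ {as} {bs} p = trans
    (reflexive (≡.cong ([_] ∏weight as)
      (does-⇔ (mk⇔ (antichain-↭ p) (antichain-↭ (↭.↭-sym p))) (antichain? as) (antichain? bs))))
    ([]-cong (does (antichain? bs)) (∏weight-↭ p))

  ∑-subsets-∷ : ∀ a as (h : List A → Carrier) →
    ∑ (subsets (a ∷ as)) h ≈ ∑ (subsets as) (h ∘ (a ∷_)) + ∑ (subsets as) h
  ∑-subsets-∷ a as h = trans (∑-++ h (map (a ∷_) (subsets as)) (subsets as))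
    (+-congʳ (∑-map h (a ∷_) (subsets as)))

  -- Subsets are lists here, so permuting the ground list also permutes the entries within each
  -- subset; hence the invariance demanded of `h`. It permits listing the join-irreducibles as 𝔞s
  -- followed by 𝔟s.
  ∑-subsets-↭ : ∀ {as bs} (h : List A → Carrier) → (∀ {cs ds} → cs ↭ ds → h cs ≈ h ds) →
                as ↭ bs → ∑ (subsets as) h ≈ ∑ (subsets bs) h
  ∑-subsets-↭ h h-↭ ↭.refl = refl
  ∑-subsets-↭ {a ∷ as} {_ ∷ bs} h h-↭ (↭.prep a p) = begin
    ∑ (subsets (a ∷ as)) h ≈⟨ ∑-subsets-∷ a as h ⟩
    ∑ (subsets as) (h ∘ (a ∷_)) + ∑ (subsets as) h
      ≈⟨ +-cong (∑-subsets-↭ (h ∘ (a ∷_)) (h-↭ ∘ ↭.prep a) p) (∑-subsets-↭ h h-↭ p) ⟩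
    ∑ (subsets bs) (h ∘ (a ∷_)) + ∑ (subsets bs) h ≈⟨ ∑-subsets-∷ a bs h ⟨
    ∑ (subsets (a ∷ bs)) h ∎
  ∑-subsets-↭ {_ ∷ _ ∷ as} {_ ∷ _ ∷ bs} h h-↭ (↭.swap a b p) = begin
    ∑ (subsets (a ∷ b ∷ as)) h ≈⟨ two a b as ⟩
    ∑ (subsets as) (λ cs → h (a ∷ b ∷ cs)) + ∑ (subsets as) (h ∘ (a ∷_)) +
      (∑ (subsets as) (h ∘ (b ∷_)) + ∑ (subsets as) h)
      ≈⟨ +-cong (+-cong (trans (∑-cong (subsets as) (λ cs → h-↭ (↭.swap a b ↭.refl)))
                               (∑-subsets-↭ (λ cs → h (b ∷ a ∷ cs)) (h-↭ ∘ ↭.prep b ∘ ↭.prep a) p))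
                        (∑-subsets-↭ (h ∘ (a ∷_)) (h-↭ ∘ ↭.prep a) p))
                (+-cong (∑-subsets-↭ (h ∘ (b ∷_)) (h-↭ ∘ ↭.prep b) p) (∑-subsets-↭ h h-↭ p)) ⟩
    ∑ (subsets bs) (λ cs → h (b ∷ a ∷ cs)) + ∑ (subsets bs) (h ∘ (a ∷_)) +
      (∑ (subsets bs) (h ∘ (b ∷_)) + ∑ (subsets bs) h)
      ≈⟨ solve 4 (λ p q r s → p :+ q :+ (r :+ s) := p :+ r :+ (q :+ s)) refl _ _ _ _ ⟩
    ∑ (subsets bs) (λ cs → h (b ∷ a ∷ cs)) + ∑ (subsets bs) (h ∘ (b ∷_)) +
      (∑ (subsets bs) (h ∘ (a ∷_)) + ∑ (subsets bs) h) ≈⟨ two b a bs ⟨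
    ∑ (subsets (b ∷ a ∷ bs)) h ∎
    where
    two : ∀ a b as → ∑ (subsets (a ∷ b ∷ as)) h ≈
      ∑ (subsets as) (λ cs → h (a ∷ b ∷ cs)) + ∑ (subsets as) (h ∘ (a ∷_)) +
      (∑ (subsets as) (h ∘ (b ∷_)) + ∑ (subsets as) h)
    two a b as = trans (∑-subsets-∷ a (b ∷ as) h)
      (+-cong (∑-subsets-∷ b as (h ∘ (a ∷_))) (∑-subsets-∷ b as h))
  ∑-subsets-↭ h h-↭ (↭.trans p q) = trans (∑-subsets-↭ h h-↭ p) (∑-subsets-↭ h h-↭ q)

  ∑-subsets-filter : ∀ {Q : Pred A 0ℓ} (Q? : Unary.Decidable Q) (h : List A → Carrier) → ∀ as →
    ∑ (subsets as) (λ bs → [ does (All.all? Q? bs) ] h bs) ≈ ∑ (subsets (filter Q? as)) h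
  ∑-subsets-filter Q? h []       = refl
  ∑-subsets-filter Q? h (a ∷ as) = begin
    ∑ (subsets (a ∷ as)) (λ bs → [ does (All.all? Q? bs) ] h bs) ≈⟨ ∑-subsets-∷ a as _ ⟩
    ∑ (subsets as) (λ bs → [ does (Q? a) ∧ does (All.all? Q? bs) ] h (a ∷ bs)) +
      ∑ (subsets as) (λ bs → [ does (All.all? Q? bs) ] h bs)
      ≈⟨ +-congˡ (∑-subsets-filter Q? h as) ⟩
    ∑ (subsets as) (λ bs → [ does (Q? a) ∧ does (All.all? Q? bs) ] h (a ∷ bs)) +
      ∑ (subsets (filter Q? as)) h
      ≈⟨ step ⟩
    ∑ (subsets (filter Q? (a ∷ as))) h ∎
    where
    step : ∑ (subsets as) (λ bs → [ does (Q? a) ∧ does (All.all? Q? bs) ] h (a ∷ bs)) +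
           ∑ (subsets (filter Q? as)) h ≈ ∑ (subsets (filter Q? (a ∷ as))) h
    step with does (Q? a)
    ... | true  = trans (+-congʳ (∑-subsets-filter Q? (h ∘ (a ∷_)) as)) (sym (∑-subsets-∷ a (filter Q? as) h))
    ... | false = trans (+-congʳ (∑-zero (subsets as))) (+-identityˡ _)

  antichain-∷⁺ : ∀ {a as} → All (Incomparable a) as × Antichain as → Antichain (a ∷ as)
  antichain-∷⁺ (inc , anti) = ((λ _ → ≡.refl) ∷ All.map proj₁ inc) ∷
    All.zipWith (λ (i , q) → proj₂ i ∷ q) (inc , anti)

  antichain-∷⁻ : ∀ {a as} → Antichain (a ∷ as) → All (Incomparable a) as × Antichain as
  antichain-∷⁻ ((_ ∷ above) ∷ rest) =
    All.zipWith (λ { (f , g ∷ _) → f , g }) (above , rest) , All.map All.tail rest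

  antichainSum : List A → Carrier
  antichainSum as = ∑ (subsets as) term

  -- An antichain containing `a` is `a` together with an antichain of elements incomparable to it.
  -- This is the deletion recursion of a weighted independence polynomial, here of the comparability
  -- graph.
  antichainSum-∷ : ∀ a as →
    antichainSum (a ∷ as) ≈ weight a * antichainSum (filter (incomparable? a) as) + antichainSum as
  antichainSum-∷ a as = begin
    antichainSum (a ∷ as) ≈⟨ ∑-subsets-∷ a as term ⟩
    ∑ (subsets as) (term ∘ (a ∷_)) + antichainSum as
      ≈⟨ +-congʳ (∑-cong (subsets as) term-∷) ⟩
    ∑ (subsets as) (λ bs → weight a * [ does (All.all? (incomparable? a) bs) ] term bs) + antichainSum as
      ≈⟨ +-congʳ (∑-*ˡ (weight a) _ (subsets as)) ⟨
    weight a * ∑ (subsets as) (λ bs → [ does (All.all? (incomparable? a) bs) ] term bs) + antichainSum as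
      ≈⟨ +-congʳ (*-congˡ (∑-subsets-filter (incomparable? a) term as)) ⟩
    weight a * antichainSum (filter (incomparable? a) as) + antichainSum as ∎
    where
    term-∷ : ∀ bs → term (a ∷ bs) ≈ weight a * [ does (All.all? (incomparable? a) bs) ] term bs
    term-∷ bs = begin
      [ does (antichain? (a ∷ bs)) ] (weight a * ∏weight bs)
        ≡⟨ ≡.cong ([_] (weight a * ∏weight bs)) (does-⇔ (mk⇔ antichain-∷⁻ antichain-∷⁺)
             (antichain? (a ∷ bs)) (All.all? (incomparable? a) bs ×-dec antichain? bs)) ⟩
      [ does (All.all? (incomparable? a) bs) ∧ does (antichain? bs) ] (weight a * ∏weight bs)
        ≈⟨ []-distrib-*ˡ (weight a) _ _ ⟨
      weight a * [ does (All.all? (incomparable? a) bs) ∧ does (antichain? bs) ] ∏weight bs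
        ≈⟨ *-congˡ ([]-∧ (does (All.all? (incomparable? a) bs)) _ _) ⟩
      weight a * [ does (All.all? (incomparable? a) bs) ] term bs ∎

  antichainSum-[] : antichainSum [] ≈ 1#
  antichainSum-[] = +-identityʳ 1#

  antichainSum-antichain : ∀ {z} as → AllPairs Incomparable as → All (λ a → weight a ≈ z) as →
    antichainSum as ≈ (1# + z) ^ length as
  antichainSum-antichain     []       _            _         = antichainSum-[]
  antichainSum-antichain {z} (a ∷ as) (inc ∷ incs) (wa ∷ ws) = begin
    antichainSum (a ∷ as) ≈⟨ antichainSum-∷ a as ⟩
    weight a * antichainSum (filter (incomparable? a) as) + antichainSum as
      ≡⟨ ≡.cong (λ bs → weight a * antichainSum bs + antichainSum as) (List.filter-all (incomparable? a) inc) ⟩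
    weight a * antichainSum as + antichainSum as
      ≈⟨ +-cong (*-cong wa (antichainSum-antichain as incs ws)) (antichainSum-antichain as incs ws) ⟩
    z * (1# + z) ^ length as + (1# + z) ^ length as
      ≈⟨ solve 2 (λ z p → z :* p :+ p := (con 1 :+ z) :* p) refl z _ ⟩
    (1# + z) ^ suc (length as) ∎

  -- At most one entry of `cs` fits into an antichain, and whichever it is, the same part `es` of
  -- `ds` remains compatible with it.
  antichainSum-chain : ∀ {z es ds} cs → AllPairs (λ c d → ¬ Incomparable c d) cs →
    All (λ c → filter (incomparable? c) ds ≡ es) cs → All (λ c → weight c ≈ z) cs →
    antichainSum (cs ++ ds) ≈ length cs ℕ× (z * antichainSum es) + antichainSum ds
  antichainSum-chain []       _              _         _         = sym (+-identityˡ _)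
  antichainSum-chain {z} {es} {ds} (c ∷ cs) (comp ∷ comps) (f ∷ fs) (wc ∷ ws) = begin
    antichainSum (c ∷ cs ++ ds) ≈⟨ antichainSum-∷ c (cs ++ ds) ⟩
    weight c * antichainSum (filter (incomparable? c) (cs ++ ds)) + antichainSum (cs ++ ds)
      ≡⟨ ≡.cong (λ bs → weight c * antichainSum bs + antichainSum (cs ++ ds)) only-es ⟩
    weight c * antichainSum es + antichainSum (cs ++ ds)
      ≈⟨ +-cong (*-congʳ wc) (antichainSum-chain cs comps fs ws) ⟩
    z * antichainSum es + (length cs ℕ× (z * antichainSum es) + antichainSum ds)
      ≈⟨ +-assoc _ _ _ ⟨
    suc (length cs) ℕ× (z * antichainSum es) + antichainSum ds ∎
    where
    only-es : filter (incomparable? c) (cs ++ ds) ≡ es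
    only-es = ≡.trans (List.filter-++ (incomparable? c) cs ds)
      (≡.cong₂ _++_ (List.filter-none (incomparable? c) comp) f)

-- Join-irreducible elements and atoms of the Hochschild lattice

module _ {N : ℕ} where
  open FiniteLattice (Hoch (suc N))
  open IsBoundedLattice isBoundedLattice
    using (x≤x∨y; y≤x∨y; minimum)
  open Nucleus (Hoch (suc N)) using (⋖-∨)
  open JPoset (suc N)

  ⊥-! : ∀ i → ⊥ ! i ≡ 0F
  ⊥-! i = lookup-replicate i 0F

  ≤-0F : ∀ x y {i} → x ≤ y → y ! i ≡ 0F → x ! i ≡ 0F
  ≤-0F x y {i} x≤y yi≡0 = ≤0F (≡.subst (x ! i Fin.≤_) yi≡0 (x≤y i))

  -- One of the joinands supplies the 1 at `j`, and by (T3) it is then above `𝔞ᵗ j`.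
  𝔞-joinIrreducible : ∀ j → JoinIrreducible (𝔞ᵗ j)
  𝔞-joinIrreducible j =
    (λ eq → contradiction (≡.trans (≡.sym (𝔞-! j ℕ.≤-refl)) (≡.trans (≡.cong (_! j) eq) (⊥-! j))) λ ()) ,
    λ x y eq → split x y eq (∨-! x y j)
    where
    split : ∀ x y → 𝔞ᵗ j ≡ x ∨ y → (x ∨ y) ! j ≡ x ! j ⊎ (x ∨ y) ! j ≡ y ! j → 𝔞ᵗ j ≡ x ⊎ 𝔞ᵗ j ≡ y
    split x y eq (inj₁ e) = inj₁ (antisym {𝔞ᵗ j} {x}
      (𝔞≤-1 x (≡.trans (≡.sym e) (≡.trans (≡.cong (_! j) (≡.sym eq)) (𝔞-! j ℕ.≤-refl))))
      (≡.subst (x ≤_) (≡.sym eq) (x≤x∨y x y)))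
    split x y eq (inj₂ e) = inj₂ (antisym {𝔞ᵗ j} {y}
      (𝔞≤-1 y (≡.trans (≡.sym e) (≡.trans (≡.cong (_! j) (≡.sym eq)) (𝔞-! j ℕ.≤-refl))))
      (≡.subst (y ≤_) (≡.sym eq) (y≤x∨y x y)))

  𝔟-joinIrreducible : ∀ k → JoinIrreducible (𝔟ᵗ k)
  𝔟-joinIrreducible k =
    (λ eq → contradiction (≡.trans (≡.sym (𝔟-! k)) (≡.trans (≡.cong (_! suc k) eq) (⊥-! (suc k)))) λ ()) ,
    λ x y eq → split x y eq (∨-! x y (suc k))
    where
    split : ∀ x y → 𝔟ᵗ k ≡ x ∨ y → (x ∨ y) ! suc k ≡ x ! suc k ⊎ (x ∨ y) ! suc k ≡ y ! suc k →
            𝔟ᵗ k ≡ x ⊎ 𝔟ᵗ k ≡ y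
    split x y eq (inj₁ e) = inj₁ (antisym {𝔟ᵗ k} {x}
      (𝔟≤ x (≡.trans (≡.sym e) (≡.trans (≡.cong (_! suc k) (≡.sym eq)) (𝔟-! k))))
      (≡.subst (x ≤_) (≡.sym eq) (x≤x∨y x y)))
    split x y eq (inj₂ e) = inj₂ (antisym {𝔟ᵗ k} {y}
      (𝔟≤ y (≡.trans (≡.sym e) (≡.trans (≡.cong (_! suc k) (≡.sym eq)) (𝔟-! k))))
      (≡.subst (y ≤_) (≡.sym eq) (y≤x∨y x y)))

  -- If `x` has a 2, it is the join of a lower cover and a 𝔟, so it equals that 𝔟. Without 2s, (T3)
  -- makes it a block of 1s followed by zeros.
  joinIrreducible⇒𝔞⊎𝔟 : ∀ x → JoinIrreducible x → (∃[ j ] x ≡ 𝔞ᵗ j) ⊎ (∃[ k ] x ≡ 𝔟ᵗ k)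
  joinIrreducible⇒𝔞⊎𝔟 x (x≢⊥ , irr) = cases (Fin.any? (λ i → x ! i Fin.≟ 2F))
    where
    has-2 : ∀ i → x ! i ≡ 2F → (∃[ j ] x ≡ 𝔞ᵗ j) ⊎ (∃[ k ] x ≡ 𝔟ᵗ k)
    has-2 zero    eq = contradiction eq (proj₁ (triword x) zero ≡.refl)
    has-2 (suc k) eq = from (lower-2 x (suc k) eq)
      where
      from : ∃[ y ] y ⋖ x × y ! suc k ≢ 2F → (∃[ j ] x ≡ 𝔞ᵗ j) ⊎ (∃[ k ] x ≡ 𝔟ᵗ k)
      from (y , y⋖x , yk≢2) = [ (λ x≡y → contradiction (≡.sym x≡y) (proj₂ (proj₁ y⋖x))) , (λ x≡b → inj₂ (k , x≡b)) ]′
        (irr y (𝔟ᵗ k) (≡.sym (⋖-∨ y x (𝔟ᵗ k) y⋖x (𝔟≤ x eq) (λ b≤y → yk≢2 (≤𝔟 y b≤y)))))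

    no-2 : (∀ i → x ! i ≢ 2F) → (∀ i → x ! i ≢ 1F) ⊎ ∃[ l ] x ! l ≡ 1F × (∀ i → l Fin.< i → x ! i ≢ 1F) →
           (∃[ j ] x ≡ 𝔞ᵗ j) ⊎ (∃[ k ] x ≡ 𝔟ᵗ k)
    no-2 no2 (inj₁ no1) = contradiction (antisym {x} {⊥} x≤⊥ (minimum x)) x≢⊥
      where
      x≤⊥ : x ≤ ⊥
      x≤⊥ i with x ! i | no1 i | no2 i
      ... | 0F | _ | _ = z≤n
      ... | 1F | n | _ = contradiction ≡.refl n
      ... | 2F | _ | n = contradiction ≡.refl n
    no-2 no2 (inj₂ (l , xl≡1 , after)) = inj₁ (l , antisym {x} {𝔞ᵗ l} x≤a (𝔞≤-1 x xl≡1))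
      where
      x≤a : x ≤ 𝔞ᵗ l
      x≤a i with i Fin.≤? l
      ... | yes i≤l = ≡.subst (x ! i Fin.≤_) (≡.sym (𝔞-! l i≤l)) (≤1 (x ! i) (no2 i))
        where
        ≤1 : (k : Fin 3) → k ≢ 2F → Fin._≤_ {3} {3} k 1F
        ≤1 0F _ = z≤n
        ≤1 1F _ = s≤s z≤n
        ≤1 2F n = contradiction ≡.refl n
      ... | no i≰l  = ≡.subst (Fin._≤ 𝔞ᵗ l ! i) (≡.sym xi≡0) z≤n
        where
        0F-only : (k : Fin 3) → k ≢ 1F → k ≢ 2F → k ≡ 0F
        0F-only 0F _ _ = ≡.refl
        0F-only 1F n _ = contradiction ≡.refl n
        0F-only 2F _ n = contradiction ≡.refl n
        xi≡0 : x ! i ≡ 0F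
        xi≡0 = 0F-only (x ! i) (after i (ℕ.≰⇒> i≰l)) (no2 i)

    cases : Dec (∃[ i ] x ! i ≡ 2F) → (∃[ j ] x ≡ 𝔞ᵗ j) ⊎ (∃[ k ] x ≡ 𝔟ᵗ k)
    cases (yes (i , eq)) = has-2 i eq
    cases (no none)      = no-2 (λ i eq → none (i , eq)) (last-1 (value x))

  𝔞s 𝔟s : List (Tri (suc N))
  𝔞s = tabulate 𝔞ᵗ
  𝔟s = tabulate 𝔟ᵗ

  joinIrreducibles-↭ : joinIrreducibles ↭ 𝔞s ++ 𝔟s
  joinIrreducibles-↭ = ∼bag⇒↭ (unique∧set⇒bag (Unique.filter⁺ joinIrreducible? unique)
    (Unique.++⁺ (Unique.tabulate⁺ (𝔞ᵗ-injective _ _)) (Unique.tabulate⁺ (𝔟ᵗ-injective _ _)) disjoint)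
    (λ {x} → mk⇔ (to x) (from x)))
    where
    disjoint : ∀ {x} → ¬ (x ∈ 𝔞s × x ∈ 𝔟s)
    disjoint (a∈ , b∈) with j , eq ← ∈-tabulate⁻ {f = 𝔞ᵗ} a∈ | k , eq′ ← ∈-tabulate⁻ {f = 𝔟ᵗ} b∈ =
      𝔞≢𝔟 j k (≡.trans (≡.sym eq) eq′)

    to : ∀ x → x ∈ joinIrreducibles → x ∈ 𝔞s ++ 𝔟s
    to x x∈ = place (joinIrreducible⇒𝔞⊎𝔟 x (proj₂ (∈-filter⁻ joinIrreducible? {xs = elements} x∈)))
      where
      place : (∃[ j ] x ≡ 𝔞ᵗ j) ⊎ (∃[ k ] x ≡ 𝔟ᵗ k) → x ∈ 𝔞s ++ 𝔟s
      place (inj₁ (j , eq)) = ≡.subst (_∈ 𝔞s ++ 𝔟s) (≡.sym eq) (∈-++⁺ˡ (∈-tabulate⁺ {f = 𝔞ᵗ} j))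
      place (inj₂ (k , eq)) = ≡.subst (_∈ 𝔞s ++ 𝔟s) (≡.sym eq) (∈-++⁺ʳ 𝔞s (∈-tabulate⁺ {f = 𝔟ᵗ} k))

    irreducible : ∀ x → x ∈ 𝔞s ⊎ x ∈ 𝔟s → JoinIrreducible x
    irreducible x (inj₁ x∈) with j , eq ← ∈-tabulate⁻ {f = 𝔞ᵗ} x∈ =
      ≡.subst JoinIrreducible (≡.sym eq) (𝔞-joinIrreducible j)
    irreducible x (inj₂ x∈) with k , eq ← ∈-tabulate⁻ {f = 𝔟ᵗ} x∈ =
      ≡.subst JoinIrreducible (≡.sym eq) (𝔟-joinIrreducible k)

    from : ∀ x → x ∈ 𝔞s ++ 𝔟s → x ∈ joinIrreducibles
    from x x∈ = ∈-filter⁺ joinIrreducible? (complete x) (irreducible x (∈-++⁻ 𝔞s x∈))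

  𝔞-mono : ∀ j k → j Fin.≤ k → 𝔞ᵗ j ≤ 𝔞ᵗ k
  𝔞-mono j k j≤k = 𝔞≤-1 (𝔞ᵗ k) {j} (𝔞-! k j≤k)

  𝔞≰𝔟 : ∀ j k → ¬ 𝔞ᵗ j ≤ 𝔟ᵗ k
  𝔞≰𝔟 j k a≤b = ≤𝔞 (𝔟ᵗ k) j a≤b zero z≤n (𝔟-!-≢ k {zero} λ ())

  𝔟≰𝔞 : ∀ k j → ¬ 𝔟ᵗ k ≤ 𝔞ᵗ j
  𝔟≰𝔞 k j b≤a with suc k Fin.≤? j
  ... | yes k≤j = contradiction (≡.trans (≡.sym (𝔞-! j k≤j)) (≤𝔟 (𝔞ᵗ j) b≤a)) λ ()
  ... | no k≰j  = contradiction (≡.trans (≡.sym (𝔞-!-> j (ℕ.≰⇒> k≰j))) (≤𝔟 (𝔞ᵗ j) b≤a)) λ ()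

  𝔟≤𝔟⇒≡ : ∀ k l → 𝔟ᵗ k ≤ 𝔟ᵗ l → k ≡ l
  𝔟≤𝔟⇒≡ k l b≤b with k Fin.≟ l
  ... | yes k≡l = k≡l
  ... | no k≢l  = contradiction
    (≡.trans (≡.sym (𝔟-!-≢ l (k≢l ∘ Fin.suc-injective))) (≤𝔟 (𝔟ᵗ l) b≤b)) λ ()

  atom-𝔞₁ : Atom (𝔞ᵗ zero)
  atom-𝔞₁ = ⋖-local {x = ⊥} {𝔞ᵗ zero} zero off (s≤s z≤n) sel
    where
    off : ∀ j → j ≢ zero → ⊥ ! j ≡ 𝔞ᵗ zero ! j
    off zero    0≢0 = contradiction ≡.refl 0≢0
    off (suc j) _   = ≡.trans (⊥-! (suc j)) (≡.sym (𝔞-!-> {suc N} zero {suc j} z<s))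
    sel : ∀ z → ⊥ ≤ z → z ≤ 𝔞ᵗ zero → z ! zero ≡ 0F ⊎ z ! zero ≡ 1F
    sel z _ z≤a with z ! zero | z≤a zero
    ... | 0F | _      = inj₁ ≡.refl
    ... | 1F | _      = inj₂ ≡.refl
    ... | 2F | s≤s ()

  atom-𝔟 : ∀ k → Atom (𝔟ᵗ k)
  atom-𝔟 k = ⋖-local {x = ⊥} {𝔟ᵗ k} (suc k)
    (λ j j≢k → ≡.trans (⊥-! j) (≡.sym (𝔟-!-≢ k j≢k)))
    (≡.subst₂ (λ p q → Fin._<_ {3} {3} p q) (≡.sym (⊥-! (suc k))) (≡.sym (𝔟-! k)) (s≤s z≤n))
    λ z _ z≤b → sel z z≤b (z ! suc k) ≡.refl
    where
    sel : ∀ z → z ≤ 𝔟ᵗ k → ∀ d → z ! suc k ≡ d → z ! suc k ≡ ⊥ ! suc k ⊎ z ! suc k ≡ 𝔟ᵗ k ! suc k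
    sel z z≤b 0F eq = inj₁ (≡.trans eq (≡.sym (⊥-! (suc k))))
    -- The first entry of `z` is 0, as in `𝔟ᵗ k`, so (T3) excludes a 1 further on.
    sel z z≤b 1F eq = contradiction eq
      (proj₂ (triword z) zero (suc k) z<s (≤-0F z (𝔟ᵗ k) {zero} z≤b (𝔟-!-≢ k {zero} λ ())))
    sel z z≤b 2F eq = inj₂ (≡.trans eq (≡.sym (𝔟-! k)))

  ¬atom-𝔞 : ∀ k → ¬ Atom (𝔞ᵗ (suc k))
  ¬atom-𝔞 k (_ , between) = between (𝔞ᵗ zero)
    ( (minimum (𝔞ᵗ zero) , λ eq → proj₁ (𝔞-joinIrreducible zero) (≡.sym eq))
    , (𝔞-mono zero (suc k) z≤n , λ eq → contradiction (𝔞ᵗ-injective zero (suc k) eq) λ ()))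

-- Evaluation of the antichain sum

module HochAntichains {c ℓ} (R : CommutativeRing c ℓ) (N : ℕ) (x y : CommutativeRing.Carrier R) where
  open CommutativeRing R hiding (zero)
  open Triangles R
  open Sums R
  open SetoidReasoning setoid
  open FiniteLattice (Hoch (suc N)) using (_≟_; atom?; Atom)
  open JPoset (suc N)
  open AntichainSums R _≟_ {_≤ᴶ_} _≤ᴶ?_ atom? x y public
  open Mult semiring using () renaming (_×_ to _ℕ×_)
  open SemiringSolver commutativeSemiring using (solve; _:=_; _:+_; _:*_; con)

  ∑-antichains : ∑ antichains (λ A → x ^ length A * y ^ countAtoms A) ≈ antichainSum joinIrreducibles
  ∑-antichains = trans (∑-filter isAntichain? _ (subsets joinIrreducibles))
    (∑-cong (subsets joinIrreducibles) (λ A → []-cong (does (isAntichain? A)) (∏weight-≈ A)))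

  weight-atom : ∀ {a} → Atom a → weight a ≈ x * y
  weight-atom {a} at = reflexive (≡.cong (if_then x * y else x) (dec-true (atom? a) at))

  weight-¬atom : ∀ {a} → ¬ Atom a → weight a ≈ x
  weight-¬atom {a} at = reflexive (≡.cong (if_then x * y else x) (dec-false (atom? a) at))

  𝔟-incomparable : ∀ k l → Incomparable (𝔟ᵗ k) (𝔟ᵗ l)
  𝔟-incomparable k l = below k l , below l k
    where
    below : ∀ k l → 𝔟ᵗ k ≤ᴶ 𝔟ᵗ l → 𝔟ᵗ k ≡ 𝔟ᵗ l
    below k l (inj₁ b≤b) = ≡.cong 𝔟ᵗ (𝔟≤𝔟⇒≡ k l b≤b)
    below k l (inj₂ (_ , i , _ , 1<i , b≡a)) = contradiction
      (≡.trans (≡.sym (𝔟-!-≢ l {zero} λ ())) (≡.trans (≡.cong (λ w → lookup w zero) b≡a)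
        (lookup-𝔞-≤ {suc N} {i} {zero} (ℕ.<-trans z<s 1<i)))) λ ()

  𝔞≰ᴶ𝔟 : ∀ j k → ¬ 𝔞ᵗ j ≤ᴶ 𝔟ᵗ k
  𝔞≰ᴶ𝔟 j k (inj₁ a≤b) = 𝔞≰𝔟 j k a≤b
  𝔞≰ᴶ𝔟 j k (inj₂ (a≡b , _)) = contradiction
    (≡.trans (≡.sym (𝔞-! j z≤n)) (≡.trans (≡.cong (λ w → lookup w zero) a≡b)
      (zero-entry k))) λ ()
    where
    zero-entry : ∀ {N} → Fin N → lookup (𝔟 (suc N) 2) zero ≡ 0F
    zero-entry zero    = ≡.refl
    zero-entry (suc _) = ≡.refl

  𝔞₁-incomparable-𝔟 : ∀ k → Incomparable (𝔞ᵗ zero) (𝔟ᵗ k)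
  𝔞₁-incomparable-𝔟 k = (λ a≤b → contradiction a≤b (𝔞≰ᴶ𝔟 zero k)) , λ b≤a → contradiction b≤a (b≰a k)
    where
    b≰a : ∀ k → ¬ 𝔟ᵗ k ≤ᴶ 𝔞ᵗ zero
    b≰a k (inj₁ b≤a) = 𝔟≰𝔞 k zero b≤a
    b≰a k (inj₂ (_ , i , _ , 1<i , a≡a)) = second k 1<i a≡a
      where
      -- The words differ in the second position, which exists because `Fin N` is inhabited.
      second : ∀ {N i} → Fin N → 1 ℕ.< i → 𝔞 (suc N) 1 ≢ 𝔞 (suc N) i
      second {suc N} {i} _ 1<i eq = contradiction
        (≡.trans (≡.sym (lookup-𝔞-> {suc (suc N)} {1} {suc zero} ℕ.≤-refl))
          (≡.trans (≡.cong (λ w → lookup w (suc zero)) eq) (lookup-𝔞-≤ {suc (suc N)} {i} {suc zero} 1<i))) λ ()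

  𝔞-comparable : ∀ {j k} → j ≢ k → ¬ Incomparable (𝔞ᵗ j) (𝔞ᵗ k)
  𝔞-comparable {j} {k} j≢k (f , g) = [ (λ j≤k → j≢k (𝔞ᵗ-injective j k (f (inj₁ (𝔞-mono j k j≤k))))) ,
    (λ k≤j → j≢k (≡.sym (𝔞ᵗ-injective k j (g (inj₁ (𝔞-mono k j k≤j)))))) ]′ (Fin.≤-total j k)

  antichainSum-𝔟s : antichainSum 𝔟s ≈ (1# + x * y) ^ N
  antichainSum-𝔟s = trans
    (antichainSum-antichain 𝔟s (AllPairs.tabulate⁺ (λ {k} {l} _ → 𝔟-incomparable k l))
      (All.tabulate⁺ (λ k → weight-atom (atom-𝔟 k))))
    (reflexive (≡.cong ((1# + x * y) ^_) (List.length-tabulate (𝔟ᵗ {N}))))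


module _ {c ℓ} (R : CommutativeRing c ℓ) (x y : CommutativeRing.Carrier R) where
  open CommutativeRing R hiding (zero)
  open Triangles R
  open SetoidReasoning setoid
  open Mult semiring using (×-congʳ) renaming (_×_ to _ℕ×_)
  open SemiringSolver commutativeSemiring using (solve; _:=_; _:+_; _:*_; con)

  -- The 𝔞⁽ⁱ⁾ with i > 1 form a chain of non-atoms. The added relations of the poset exclude 𝔟⁽²⁾
  -- beside any of them, which leaves one 𝔟 fewer and explains `pred N`. For `N = 0` there is no
  -- 𝔟⁽²⁾, and the list is empty.
  antichainSum-𝔞s++𝔟s : ∀ N → let open HochAntichains R N x y in
    antichainSum (tabulate (λ k → 𝔞ᵗ (suc k)) ++ 𝔟s) ≈
    N ℕ× (x * (1# + x * y) ^ pred N) + (1# + x * y) ^ N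
  antichainSum-𝔞s++𝔟s zero    = trans antichainSum-[] (sym (+-identityˡ _))
    where open HochAntichains R zero x y
  antichainSum-𝔞s++𝔟s (suc N) = begin
    antichainSum (chain ++ 𝔟s)
      ≈⟨ antichainSum-chain chain
           (AllPairs.tabulate⁺ (λ {j} {k} j≢k → 𝔞-comparable {suc j} {suc k} (j≢k ∘ Fin.suc-injective)))
           (All.tabulate⁺ {f = λ k → 𝔞ᵗ (suc k)} only-es) (All.tabulate⁺ (λ k → weight-¬atom (¬atom-𝔞 k))) ⟩
    length chain ℕ× (x * antichainSum es) + antichainSum 𝔟s
      ≡⟨ ≡.cong (λ n → n ℕ× (x * antichainSum es) + antichainSum 𝔟s)
           (List.length-tabulate {n = suc N} (λ k → 𝔞ᵗ (suc k))) ⟩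
    suc N ℕ× (x * antichainSum es) + antichainSum 𝔟s
      ≈⟨ +-cong (×-congʳ (suc N) (*-congˡ sum-es)) antichainSum-𝔟s ⟩
    suc N ℕ× (x * (1# + x * y) ^ N) + (1# + x * y) ^ suc N ∎
    where
    open HochAntichains R (suc N) x y

    chain es : List (Tri (suc (suc N)))
    chain = tabulate (λ k → 𝔞ᵗ (suc k))
    es    = tabulate (λ k → 𝔟ᵗ (suc k))

    𝔞-comparable-𝔟₂ : ∀ k → ¬ Incomparable (𝔞ᵗ (suc k)) (𝔟ᵗ zero)
    𝔞-comparable-𝔟₂ k (_ , g) = 𝔞≢𝔟 (suc k) zero (≡.sym
      -- `𝔟ᵗ zero` is 𝔟⁽²⁾, and `𝔞ᵗ (suc k)` is 𝔞⁽ⁱ⁾ for the index given here, which exceeds 1; so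
      -- an added relation applies.
      (g (inj₂ (≡.refl , suc (toℕ (suc k)) , s≤s (Fin.toℕ<n (suc k)) , s≤s (s≤s z≤n) , ≡.refl))))

    𝔞-incomparable-𝔟 : ∀ k l → Incomparable (𝔞ᵗ (suc k)) (𝔟ᵗ (suc l))
    𝔞-incomparable-𝔟 k l = (λ a≤b → contradiction a≤b (𝔞≰ᴶ𝔟 (suc k) (suc l))) , λ b≤a → contradiction b≤a b≰a
      where
      b≰a : ¬ JPoset._≤ᴶ_ (suc (suc N)) (𝔟ᵗ (suc l)) (𝔞ᵗ (suc k))
      b≰a (inj₁ b≤a)       = 𝔟≰𝔞 (suc l) (suc k) b≤a
      b≰a (inj₂ (b≡b , _)) = contradiction
        (≡.trans (≡.sym (𝔟-! (suc l)))
          (≡.trans (≡.cong (λ w → lookup w (suc (suc l))) b≡b) (𝔟-!-≢ (zero {N}) {suc (suc l)} λ ()))) λ ()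

    only-es : ∀ k → filter (incomparable? (𝔞ᵗ (suc k))) 𝔟s ≡ es
    only-es k = ≡.trans
      (List.filter-reject (incomparable? (𝔞ᵗ (suc k))) {𝔟ᵗ zero} {es} (𝔞-comparable-𝔟₂ k))
      (List.filter-all (incomparable? (𝔞ᵗ (suc k))) (All.tabulate⁺ (𝔞-incomparable-𝔟 k)))

    sum-es : antichainSum es ≈ (1# + x * y) ^ N
    sum-es = trans
      (antichainSum-antichain es (AllPairs.tabulate⁺ (λ {k} {l} _ → 𝔟-incomparable (suc k) (suc l)))
        (All.tabulate⁺ (λ k → weight-atom (atom-𝔟 (suc k)))))
      (reflexive (≡.cong ((1# + x * y) ^_) (List.length-tabulate {n = N} (λ k → 𝔟ᵗ (suc k)))))

  module _ (N : ℕ) where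
    open JPoset (suc N)
    open HochAntichains R N x y

    ∑-antichains-closed : ∑ antichains (λ A → x ^ length A * y ^ countAtoms A) ≈
                          (1# + x * y) ^ suc N + N ℕ× (x * (1# + x * y) ^ pred N)
    ∑-antichains-closed = begin
      ∑ antichains (λ A → x ^ length A * y ^ countAtoms A)
        ≈⟨ ∑-antichains ⟩
      antichainSum joinIrreducibles
        ≈⟨ ∑-subsets-↭ term term-↭ joinIrreducibles-↭ ⟩
      antichainSum (𝔞s ++ 𝔟s)
        -- 𝔞⁽¹⁾ is split off as the only atom among the 𝔞s: it is comparable to all other 𝔞s and
        -- incomparable to all 𝔟s, so its share `x * y * s ^ N` completes `s ^ N` to `s ^ suc N`.
        ≈⟨ antichainSum-∷ (𝔞ᵗ zero) (chain ++ 𝔟s) ⟩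
      weight (𝔞ᵗ zero) * antichainSum (filter (incomparable? (𝔞ᵗ zero)) (chain ++ 𝔟s)) + antichainSum (chain ++ 𝔟s)
        ≡⟨ ≡.cong (λ as → weight (𝔞ᵗ zero) * antichainSum as + antichainSum (chain ++ 𝔟s)) only-𝔟s ⟩
      weight (𝔞ᵗ zero) * antichainSum 𝔟s + antichainSum (chain ++ 𝔟s)
        ≈⟨ +-cong (*-cong (weight-atom atom-𝔞₁) antichainSum-𝔟s) (antichainSum-𝔞s++𝔟s N) ⟩
      x * y * s ^ N + (N ℕ× (x * s ^ pred N) + s ^ N)
        ≈⟨ solve 3 (λ z p q → z :* p :+ (q :+ p) := (con 1 :+ z) :* p :+ q) refl (x * y) (s ^ N) _ ⟩
      s ^ suc N + N ℕ× (x * s ^ pred N) ∎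
      where
      s : Carrier
      s = 1# + x * y
      chain : List (Tri (suc N))
      chain = tabulate (λ k → 𝔞ᵗ (suc k))

      only-𝔟s : filter (incomparable? (𝔞ᵗ zero)) (chain ++ 𝔟s) ≡ 𝔟s
      only-𝔟s = ≡.trans (List.filter-++ (incomparable? (𝔞ᵗ zero)) chain 𝔟s)
        (≡.cong₂ _++_
          (List.filter-none (incomparable? (𝔞ᵗ zero)) (All.tabulate⁺ (λ k → 𝔞-comparable {zero} {suc k} λ ())))
          (List.filter-all (incomparable? (𝔞ᵗ zero)) (All.tabulate⁺ 𝔞₁-incomparable-𝔟)))

open import Data.Nat.Base using (_<_)
open CommutativeRing using (Carrier)

proposition6p19 : ∀ {c ℓ} (R : CommutativeRing c ℓ) (n : ℕ) → 0 < n →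
    let open CommutativeRing R hiding (Carrier)
        open Triangles R
        open JPoset n in
    (x y : Carrier R) (d₁ : IsUnit (y - 1#)) (d₂ : IsUnit (x * (y - 1#) + 1#)) →
    H n x y d₁ d₂ ≈ ∑ antichains (λ A → x ^ length A * y ^ countAtoms A)
proposition6p19 R (suc N) _ x y d₁ d₂ =
  CommutativeRing.trans R (WordSums.H-closed R N x y d₁ d₂)
    (CommutativeRing.sym R (∑-antichains-closed R x y N))
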